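{- Let $k\ge 2$. Let $\mathfrak A$ and $\mathfrak B$ be relational structures of arity at most $k$ with $n:=|V(\mathfrak A)|=|V(\mathfrak B)|$. Suppose there is a sentence $\varphi\in\mathsf C^{k+1}$ with $\mathfrak A\models\varphi$ and $\mathfrak B\not\models\varphi$. Let $d:=\lceil 3(k+1)/2\rceil$. Then there is a sentence $\psi\in\mathsf C^d$ of quantifier rank $q=O(k^2\cdot n^{\lfloor k/2\rfloor+1}\log n)$ such that $\mathfrak A\models\psi$ and $\mathfrak B\not\models\psi$.
   Context: $\mathsf C$ is first-order logic (atomic formulas $x=y$, $R(x_1,\dots,x_r)$; $\wedge$, $\neg$, $\exists$) extended by counting quantifiers $\exists^{\ge j}x\,\varphi$. $\mathsf C^m$ is its fragment using at most $m$ distinct variables (variables may be reused). Quantifier rank is the maximal nesting depth of quantifiers. Arity at most $k$ means all relations have arity at most $k$; universes are finite. $\log$ is base 2. -}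

module Defs where

open import Data.Nat using (ℕ; zero; suc; _+_; _*_; _≤_; _⊔_; _≤ᵇ_)
open import Data.Fin using (Fin; _≟_)
open import Data.Bool using (Bool; true; false; _∧_; not; if_then_else_)
open import Data.Maybe using (Maybe; just; nothing)
open import Relation.Nullary using (does)
open import Relation.Binary.PropositionalEquality using (_≡_)

-- A relational signature: a type of relation symbols with arities.
-- A finite relational structure over it with universe Fin n
-- (every n-element universe is isomorphic to one of this form).
record Structure (Sym : Set) (ar : Sym → ℕ) (n : ℕ) : Set where
  field
    rel : (R : Sym) → (Fin (ar R) → Fin n) → Bool
open Structure public

data Form (Sym : Set) (ar : Sym → ℕ) (m : ℕ) : Set where
  eq   : Fin m → Fin m → Form Sym ar m
  atom : (R : Sym) → (Fin (ar R) → Fin m) → Form Sym ar m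
  and  : Form Sym ar m → Form Sym ar m → Form Sym ar m
  neg  : Form Sym ar m → Form Sym ar m
  ex   : Fin m → Form Sym ar m → Form Sym ar m
  exGE : ℕ → Fin m → Form Sym ar m → Form Sym ar m

anyFin : {l : ℕ} → (Fin l → Bool) → Bool
anyFin {zero} f = false
anyFin {suc l} f = f Fin.zero Data.Bool.∨ anyFin (λ i → f (Fin.suc i))

module _ {Sym : Set} {ar : Sym → ℕ} {m : ℕ} where

  free : Form Sym ar m → Fin m → Bool
  free (eq x y) z = does (x ≟ z) Data.Bool.∨ does (y ≟ z)
  free (atom R xs) z = anyFin (λ i → does (xs i ≟ z))
  free (and φ ψ) z = free φ z Data.Bool.∨ free ψ z
  free (neg φ) z = free φ z
  free (ex x φ) z = not (does (x ≟ z)) ∧ free φ z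
  free (exGE j x φ) z = not (does (x ≟ z)) ∧ free φ z

  Sentence : Form Sym ar m → Set
  Sentence φ = (z : Fin m) → free φ z ≡ false

  qr : Form Sym ar m → ℕ
  qr (eq x y) = 0
  qr (atom R xs) = 0
  qr (and φ ψ) = qr φ ⊔ qr ψ
  qr (neg φ) = qr φ
  qr (ex x φ) = suc (qr φ)
  qr (exGE j x φ) = suc (qr φ)

countTrue : {n : ℕ} → (Fin n → Bool) → ℕ
countTrue {zero} f = 0
countTrue {suc n} f = (if f Fin.zero then 1 else 0) + countTrue (λ i → f (Fin.suc i))

module _ {Sym : Set} {ar : Sym → ℕ} {n : ℕ} (𝔄 : Structure Sym ar n) where

  -- partial assignments (nothing = unassigned; only relevant for free variables,
  -- so irrelevant for sentences)
  Assign : ℕ → Set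
  Assign m = Fin m → Maybe (Fin n)

  update : {m : ℕ} → Assign m → Fin m → Fin n → Assign m
  update α x a y = if does (x ≟ y) then just a else α y

  allAssigned : {l : ℕ} → (Fin l → Maybe (Fin n)) → Maybe (Fin l → Fin n)
  allAssigned {zero} f = just (λ ())
  allAssigned {suc l} f with f Fin.zero | allAssigned (λ i → f (Fin.suc i))
  ... | just a | just g = just (λ { Fin.zero → a ; (Fin.suc i) → g i })
  ... | _ | _ = nothing

  eqM : Maybe (Fin n) → Maybe (Fin n) → Bool
  eqM (just a) (just b) = does (a ≟ b)
  eqM _ _ = false

  eval : {m : ℕ} → Form Sym ar m → Assign m → Bool
  eval (eq x y) α = eqM (α x) (α y)
  eval (atom R xs) α with allAssigned (λ i → α (xs i))
  ... | just as = rel 𝔄 R as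
  ... | nothing = false
  eval (and φ ψ) α = eval φ α ∧ eval ψ α
  eval (neg φ) α = not (eval φ α)
  eval (ex x φ) α = anyFin (λ a → eval φ (update α x a))
  eval (exGE j x φ) α = j ≤ᵇ countTrue (λ a → eval φ (update α x a))

  _⊨_ : {m : ℕ} → Form Sym ar m → Set
  _⊨_ {m} φ = eval φ (λ (_ : Fin m) → nothing) ≡ true

{-# OPTIONS --safe #-}

-- Write k + 1 = h + b with h = ⌊k/2⌋ + 1 and b ≤ h, and view properties of (k+1)-tuples of the two
-- structures as block-diagonal matrices with rows indexed by h-tuples and columns by b-tuples.
-- If l, m, r are definable in rank q, then l mᵀ r is definable in rank q + k + 1, and only
-- h + b + h = ⌈3(k+1)/2⌉ variables are needed. Cutting products in the middle, the whole ternary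
-- ring of operators generated by the rank-q definable matrices becomes definable after
-- O(k log n) such steps.
--
-- A chain T₀ ⊆ T₁ ⊆ … of ternary rings of N × M matrices over ℚ has at most N + M proper steps:
-- for a generic vector z the space Tᵢ z grows, the space {v : m z = 0 ⇒ m v = 0 for m ∈ Tᵢ}
-- shrinks, and if neither changes from T to T′, then T = T′. For the latter let e be the right
-- identity of {m ∈ T : m z = 0}, a polynomial in some Σ sᵀs, and q = 1 − e. Then T′q ⊆ T, and
-- a left identity of T′q is one of all of T′ since z is generic; hence T′TᵀT ⊆ T, so T′e ⊆ T as well.
--
-- So after O(nʰ) rounds the definable matrices are closed under ternary products. Summation over
-- one coordinate is such a product with matrices given by equalities, hence all properties
-- expressible in C^{k+1} are definable. Classical reasoning about subspaces is harmless because
-- equality of rank-q types is decided by a finite list of formulas.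
module Submission where

open import Defs
open import Data.Bool as Bool using (Bool; true; false; if_then_else_; not; _∧_; _∨_)
open import Data.Bool.ListAction using (all)
import Data.Bool.Properties as Boolₚ
open import Data.Empty using (⊥; ⊥-elim)
open import Data.Fin as Fin using (Fin)
import Data.Fin.Properties as Finₚ
open import Data.List using (List; []; _∷_; _++_; map; length; concatMap; cartesianProduct; cartesianProductWith; allFin; upTo; foldr; filter; tabulate)
open import Data.List.Membership.Propositional using (_∈_; _∉_)
open import Data.List.Membership.Propositional.Properties
  using (∈-∃++; ∈-++⁻; ∈-++⁺ˡ; ∈-++⁺ʳ; ∈-map⁺; ∈-map⁻; ∈-cartesianProduct⁺; ∈-cartesianProductWith⁺; ∈-cartesianProductWith⁻;
         ∈-upTo⁺; ∈-upTo⁻; ∈-allFin; ∈-concatMap⁺; ∈-filter⁺; ∈-filter⁻)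
import Data.List.Properties as Listₚ
open import Data.List.Relation.Unary.All as All using (All; []; _∷_)
import Data.List.Relation.Unary.All.Properties as Allₚ
open import Data.List.Relation.Unary.Any as Any using (Any; here; there)
open import Data.Maybe using (Maybe; just; nothing)
open import Data.Nat as ℕ using (ℕ; zero; suc; z≤n; s≤s; _≤ᵇ_)
open import Data.Nat.DivMod using (m≡m%n+[m/n]*n; m%n<n; m*n/n≡m; +-distrib-/-∣ʳ; /-monoˡ-≤)
open import Data.Nat.Divisibility using (divides)
open import Data.Nat.Logarithm using (⌊log₂_⌋; ⌊log₂⌋-mono-≤; ⌊log₂[2^n]⌋≡n)
import Data.Nat.Properties as ℕₚ
import Data.Nat.Solver as ℕ-Solver
open import Data.Product using (Σ; ∃; _×_; _,_; proj₁; proj₂)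
open import Data.Sum using (_⊎_; inj₁; inj₂; [_,_]′)
open import Data.Vec as Vec using (Vec; []; _∷_; lookup; _[_]≔_)
import Data.Vec.Properties as Vecₚ
open import Function using (_∘_; flip; id; case_of_)
open import Relation.Binary.PropositionalEquality hiding (J)
open import Relation.Nullary using (¬_; yes; no; does; ¬?; contradiction)
open import Relation.Nullary.Decidable using (decidable-stable)

-- The dimension of the space of all `N × M` matrices bounds a chain of subspaces only by `N M`, of
-- order `n ^ (k + 1)`. Closure under `a bᵀ c` is what lowers the number of proper steps to `N + M`,
-- and with it the exponent to `h`. No decomposition of the rings into simple blocks is constructed.
-- Positivity of the inner product does the work instead: `mᵀ m z = 0` implies `m z = 0`, and
-- identities arise as polynomials with rational coefficients, so that no eigenvalue or square root
-- forces an extension of ℚ. One vector `z` must serve all stages, because the compared spaces are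
-- built from it; it is made faithful for all of the finitely many stages that can matter. Spans,
-- stalls of chains and faithful vectors are found only under double negation. This is enough:
-- whether the existential closure of a rank-q type of 𝔄 holds in 𝔅 is decided by evaluation, and
-- the linear algebra is used only in the case where it holds, in order to derive `⊥`.

module _ where

  open import Data.Rational as ℚ using (ℚ; 0ℚ; 1ℚ; _+_; _*_; -_; 1/_; ≢-nonZero)
  open import Data.Rational.Properties using (_≟_)
  import Data.Rational.Properties as ℚₚ
  open import Data.Rational.Solver using (module +-*-Solver)
  open +-*-Solver using (solve; _:+_; _:*_; :-_; con; _:=_)

  private variable
    I J X Y : Set

  -- Double negation

  infixl 1 _>>=_
  _>>=_ : ∀ {a b} {A : Set a} {B : Set b} → ¬ ¬ A → (A → ¬ ¬ B) → ¬ ¬ B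
  (m >>= f) k = m λ a → f a k

  return : ∀ {a} {A : Set a} → A → ¬ ¬ A
  return a k = k a

  ≟-stable : {p q : ℚ} → ¬ ¬ p ≡ q → p ≡ q
  ≟-stable {p} {q} = decidable-stable (p ≟ q)

  -- Finite sums

  ∑ : List I → (I → ℚ) → ℚ
  ∑ []       f = 0ℚ
  ∑ (i ∷ is) f = f i + ∑ is f

  ∑-cong : (is : List I) {f g : I → ℚ} → (∀ i → f i ≡ g i) → ∑ is f ≡ ∑ is g
  ∑-cong []       eqn = refl
  ∑-cong (i ∷ is) eqn = cong₂ _+_ (eqn i) (∑-cong is eqn)

  ∑-0 : (is : List I) {f : I → ℚ} → (∀ i → f i ≡ 0ℚ) → ∑ is f ≡ 0ℚ
  ∑-0 []       eqn = refl
  ∑-0 (i ∷ is) eqn = trans (cong₂ _+_ (eqn i) (∑-0 is eqn)) (ℚₚ.+-identityˡ 0ℚ)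

  interchange : ∀ a b c d → (a + b) + (c + d) ≡ (a + c) + (b + d)
  interchange = solve 4 (λ a b c d → (a :+ b) :+ (c :+ d) := (a :+ c) :+ (b :+ d)) refl

  ∑-+ : (is : List I) (f g : I → ℚ) → ∑ is (λ i → f i + g i) ≡ ∑ is f + ∑ is g
  ∑-+ []       f g = sym (ℚₚ.+-identityˡ 0ℚ)
  ∑-+ (i ∷ is) f g = trans (cong ((f i + g i) +_) (∑-+ is f g)) (interchange (f i) (g i) _ _)

  ∑-*ˡ : (is : List I) (c : ℚ) (f : I → ℚ) → ∑ is (λ i → c * f i) ≡ c * ∑ is f
  ∑-*ˡ []       c f = sym (ℚₚ.*-zeroʳ c)
  ∑-*ˡ (i ∷ is) c f = trans (cong (c * f i +_) (∑-*ˡ is c f)) (sym (ℚₚ.*-distribˡ-+ c _ _))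

  ∑-*ʳ : (is : List I) (c : ℚ) (f : I → ℚ) → ∑ is (λ i → f i * c) ≡ ∑ is f * c
  ∑-*ʳ is c f = trans (∑-cong is (λ i → ℚₚ.*-comm (f i) c)) (trans (∑-*ˡ is c f) (ℚₚ.*-comm c _))

  ∑-swap : (is : List I) (js : List J) (f : I → J → ℚ) →
           ∑ is (λ i → ∑ js (f i)) ≡ ∑ js (λ j → ∑ is (λ i → f i j))
  ∑-swap []       js f = sym (∑-0 js (λ _ → refl))
  ∑-swap (i ∷ is) js f = trans (cong (∑ js (f i) +_) (∑-swap is js f)) (sym (∑-+ js (f i) _))

  -- Vectors and inner products

  infix 4 _≗ᵥ_
  _≗ᵥ_ : (u v : I → ℚ) → Set
  u ≗ᵥ v = ∀ i → u i ≡ v i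

  infixl 6 _⊕_ _⊖_
  infixr 7 _⊛_

  _⊛_ : ℚ → (I → ℚ) → I → ℚ
  (c ⊛ v) i = c * v i

  _⊕_ _⊖_ : (u v : I → ℚ) → I → ℚ
  (u ⊕ v) i = u i + v i
  u ⊖ v = u ⊕ (- 1ℚ) ⊛ v

  𝟎 : I → ℚ
  𝟎 _ = 0ℚ

  dot : List I → (u v : I → ℚ) → ℚ
  dot is u v = ∑ is (λ i → u i * v i)

  dot-cong : (is : List I) {u u′ v v′ : I → ℚ} → u ≗ᵥ u′ → v ≗ᵥ v′ → dot is u v ≡ dot is u′ v′
  dot-cong is p q = ∑-cong is (λ i → cong₂ _*_ (p i) (q i))

  dot-comm : (is : List I) (u v : I → ℚ) → dot is u v ≡ dot is v u
  dot-comm is u v = ∑-cong is (λ i → ℚₚ.*-comm (u i) (v i))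

  dot-0ʳ : (is : List I) (u : I → ℚ) {v : I → ℚ} → v ≗ᵥ 𝟎 → dot is u v ≡ 0ℚ
  dot-0ʳ is u eqn = ∑-0 is (λ i → trans (cong (u i *_) (eqn i)) (ℚₚ.*-zeroʳ (u i)))

  dot-0ˡ : (is : List I) {u : I → ℚ} (v : I → ℚ) → u ≗ᵥ 𝟎 → dot is u v ≡ 0ℚ
  dot-0ˡ is {u} v eqn = trans (dot-comm is u v) (dot-0ʳ is v eqn)

  dot-⊕ʳ : (is : List I) (u v w : I → ℚ) → dot is u (v ⊕ w) ≡ dot is u v + dot is u w
  dot-⊕ʳ is u v w = trans (∑-cong is (λ i → ℚₚ.*-distribˡ-+ (u i) (v i) (w i))) (∑-+ is _ _)

  dot-⊕ˡ : (is : List I) (u v w : I → ℚ) → dot is (u ⊕ v) w ≡ dot is u w + dot is v w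
  dot-⊕ˡ is u v w = trans (∑-cong is (λ i → ℚₚ.*-distribʳ-+ (w i) (u i) (v i))) (∑-+ is _ _)

  dot-⊛ʳ : (is : List I) (c : ℚ) (u v : I → ℚ) → dot is u (c ⊛ v) ≡ c * dot is u v
  dot-⊛ʳ is c u v =
    trans (∑-cong is (λ i → solve 3 (λ c x y → x :* (c :* y) := c :* (x :* y)) refl c (u i) (v i)))
          (∑-*ˡ is c _)

  dot-⊛ˡ : (is : List I) (c : ℚ) (u v : I → ℚ) → dot is (c ⊛ u) v ≡ c * dot is u v
  dot-⊛ˡ is c u v = trans (dot-comm is (c ⊛ u) v) (trans (dot-⊛ʳ is c v u) (cong (c *_) (dot-comm is v u)))

  p*p≥0 : ∀ p → 0ℚ ℚ.≤ p * p
  p*p≥0 p with ℚₚ.≤-total 0ℚ p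
  ... | inj₁ 0≤p = subst (ℚ._≤ p * p) (ℚₚ.*-zeroˡ p)
                     (ℚₚ.*-monoʳ-≤-nonNeg p {{ℚ.nonNegative 0≤p}} 0≤p)
  ... | inj₂ p≤0 = subst (ℚ._≤ p * p) (ℚₚ.*-zeroˡ p)
                     (ℚₚ.*-monoʳ-≤-nonPos p {{ℚ.nonPositive p≤0}} p≤0)

  p*q≡0⇒q≡0 : ∀ {p q} → p ≢ 0ℚ → p * q ≡ 0ℚ → q ≡ 0ℚ
  p*q≡0⇒q≡0 {p} {q} p≢0 eqn = begin
    q                ≡⟨ ℚₚ.*-identityˡ q ⟨
    1ℚ * q           ≡⟨ cong (_* q) (ℚₚ.*-inverseˡ p) ⟨
    (1/ p * p) * q   ≡⟨ ℚₚ.*-assoc (1/ p) p q ⟩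
    1/ p * (p * q)   ≡⟨ cong (1/ p *_) eqn ⟩
    1/ p * 0ℚ        ≡⟨ ℚₚ.*-zeroʳ (1/ p) ⟩
    0ℚ               ∎
    where open ≡-Reasoning
          instance _ = ≢-nonZero p≢0

  p*p≡0⇒p≡0 : ∀ p → p * p ≡ 0ℚ → p ≡ 0ℚ
  p*p≡0⇒p≡0 p eqn with p ≟ 0ℚ
  ... | yes p≡0 = p≡0
  ... | no  p≢0 = p*q≡0⇒q≡0 p≢0 eqn

  dot≥0 : (is : List I) (u : I → ℚ) → 0ℚ ℚ.≤ dot is u u
  dot≥0 []       u = ℚₚ.≤-refl
  dot≥0 (i ∷ is) u = subst (ℚ._≤ u i * u i + dot is u u) (ℚₚ.+-identityˡ 0ℚ) (ℚₚ.+-mono-≤ (p*p≥0 (u i)) (dot≥0 is u))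

  p+q≡0⇒p≡0 : ∀ {p q} → 0ℚ ℚ.≤ p → 0ℚ ℚ.≤ q → p + q ≡ 0ℚ → p ≡ 0ℚ
  p+q≡0⇒p≡0 {p} {q} 0≤p 0≤q eqn =
    ℚₚ.≤-antisym (subst₂ ℚ._≤_ (ℚₚ.+-identityʳ p) eqn (ℚₚ.+-monoʳ-≤ p 0≤q)) 0≤p

  p+q≡0⇒q≡0 : ∀ {p q} → 0ℚ ℚ.≤ p → 0ℚ ℚ.≤ q → p + q ≡ 0ℚ → q ≡ 0ℚ
  p+q≡0⇒q≡0 {p} {q} 0≤p 0≤q eqn = p+q≡0⇒p≡0 0≤q 0≤p (trans (ℚₚ.+-comm q p) eqn)

  dot-definite : (is : List I) (u : I → ℚ) → dot is u u ≡ 0ℚ → ∀ {i} → i ∈ is → u i ≡ 0ℚ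
  dot-definite (i ∷ is) u eqn (here refl) = p*p≡0⇒p≡0 (u i) (p+q≡0⇒p≡0 (p*p≥0 (u i)) (dot≥0 is u) eqn)
  dot-definite (i ∷ is) u eqn (there i∈) = dot-definite is u (p+q≡0⇒q≡0 (p*p≥0 (u i)) (dot≥0 is u) eqn) i∈

  dot-⊖ʳ : (is : List I) (u v w : I → ℚ) → dot is u (v ⊖ w) ≡ dot is u v + (- 1ℚ) * dot is u w
  dot-⊖ʳ is u v w = trans (dot-⊕ʳ is u v ((- 1ℚ) ⊛ w)) (cong (dot is u v +_) (dot-⊛ʳ is (- 1ℚ) u w))

  p-p≡0 : ∀ p → p + (- 1ℚ) * p ≡ 0ℚ
  p-p≡0 = solve 1 (λ p → p :+ (:- con 1ℚ) :* p := con 0ℚ) refl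

  ⊖≗𝟎⇒≗ : (u v : I → ℚ) → u ⊖ v ≗ᵥ 𝟎 → u ≗ᵥ v
  ⊖≗𝟎⇒≗ u v eqn i = begin
    u i                         ≡⟨ solve 2 (λ p q → p := (p :+ (:- con 1ℚ) :* q) :+ q) refl (u i) (v i) ⟩
    u i + (- 1ℚ) * v i + v i    ≡⟨ cong (_+ v i) (eqn i) ⟩
    0ℚ + v i                    ≡⟨ ℚₚ.+-identityˡ (v i) ⟩
    v i                         ∎
    where open ≡-Reasoning

  ≗⇒⊖≗𝟎 : {u v : I → ℚ} → u ≗ᵥ v → u ⊖ v ≗ᵥ 𝟎
  ≗⇒⊖≗𝟎 {u = u} eqn i = trans (cong (λ p → u i + (- 1ℚ) * p) (sym (eqn i))) (p-p≡0 (u i))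

  dot-injective : {is : List I} → (∀ i → i ∈ is) → (u v : I → ℚ) →
                  (∀ w → dot is w u ≡ dot is w v) → u ≗ᵥ v
  dot-injective {is = is} cover u v eqn = ⊖≗𝟎⇒≗ u v λ i → dot-definite is n n·n≡0 (cover i)
    where
    n = u ⊖ v
    n·n≡0 : dot is n n ≡ 0ℚ
    n·n≡0 = trans (dot-⊖ʳ is n u v)
      (trans (cong (λ p → p + (- 1ℚ) * dot is n v) (eqn n)) (p-p≡0 (dot is n v)))

  -- Linear combinations and linear independence

  -- The coefficients form an infinite sequence of which only the first `length l` entries count.
  -- Lists of all lengths then share one coefficient type, at the price of the bound `k < length l`
  -- in `Independent` and `Dependence`.
  lincomb : (ℕ → ℚ) → List (I → ℚ) → I → ℚ
  lincomb c []      = 𝟎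
  lincomb c (f ∷ l) = c 0 ⊛ f ⊕ lincomb (c ∘ suc) l

  Independent : List I → List (I → ℚ) → Set
  Independent is l = ∀ c → (∀ {i} → i ∈ is → lincomb c l i ≡ 0ℚ) → ∀ {k} → k ℕ.< length l → c k ≡ 0ℚ

  Span : List (I → ℚ) → (I → ℚ) → Set
  Span l f = Σ (ℕ → ℚ) λ c → f ≗ᵥ lincomb c l

  lincomb-0 : (l : List (I → ℚ)) → lincomb (λ _ → 0ℚ) l ≗ᵥ 𝟎
  lincomb-0 []      i = refl
  lincomb-0 (f ∷ l) i = trans (cong₂ _+_ (ℚₚ.*-zeroˡ (f i)) (lincomb-0 l i)) (ℚₚ.+-identityˡ 0ℚ)

  lincomb-⊛ : ∀ d c (l : List (I → ℚ)) → lincomb (λ k → d * c k) l ≗ᵥ d ⊛ lincomb c l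
  lincomb-⊛ d c []      i = sym (ℚₚ.*-zeroʳ d)
  lincomb-⊛ d c (f ∷ l) i = trans (cong₂ _+_ (ℚₚ.*-assoc d (c 0) (f i)) (lincomb-⊛ d (c ∘ suc) l i))
                                  (sym (ℚₚ.*-distribˡ-+ d _ _))

  lincomb-⊕ : ∀ c d (l : List (I → ℚ)) → lincomb (λ k → c k + d k) l ≗ᵥ lincomb c l ⊕ lincomb d l
  lincomb-⊕ c d []      i = sym (ℚₚ.+-identityˡ 0ℚ)
  lincomb-⊕ c d (f ∷ l) i = trans (cong₂ _+_ (ℚₚ.*-distribʳ-+ (f i) (c 0) (d 0)) (lincomb-⊕ (c ∘ suc) (d ∘ suc) l i))
                                  (interchange (c 0 * f i) (d 0 * f i) _ _)

  lincomb-cong : ∀ {c d} (l : List (I → ℚ)) → (∀ k → k ℕ.< length l → c k ≡ d k) → lincomb c l ≗ᵥ lincomb d l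
  lincomb-cong []      eqn i = refl
  lincomb-cong (f ∷ l) eqn i =
    cong₂ _+_ (cong (_* f i) (eqn 0 (s≤s z≤n))) (lincomb-cong l (λ k k< → eqn (suc k) (s≤s k<)) i)

  lincomb-∘ : ∀ c (k : J → I) (l : List (I → ℚ)) → lincomb c (map (_∘ k) l) ≗ᵥ lincomb c l ∘ k
  lincomb-∘ c k []      i = refl
  lincomb-∘ c k (f ∷ l) i = cong (c 0 * f (k i) +_) (lincomb-∘ (c ∘ suc) k l i)

  -- For r = 1 / f i the result vanishes at i.
  reduce : ℚ → (I → ℚ) → I → (I → ℚ) → (I → ℚ)
  reduce r f i g = g ⊕ (- (g i * r)) ⊛ f

  lincomb-reduce : ∀ c r (f : I → ℚ) i l j →
    lincomb c (map (reduce r f i) l) j ≡ lincomb c l j + (- (lincomb c l i * r)) * f j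
  lincomb-reduce c r f i [] j =
    solve 2 (λ r y → con 0ℚ := con 0ℚ :+ (:- (con 0ℚ :* r)) :* y) refl r (f j)
  lincomb-reduce c r f i (g ∷ l) j =
    trans (cong (c 0 * reduce r f i g j +_) (lincomb-reduce (c ∘ suc) r f i l j))
          (solve 7 (λ c a b r y p q → c :* (a :+ (:- (b :* r)) :* y) :+ (p :+ (:- (q :* r)) :* y)
                       := (c :* a :+ p) :+ (:- ((c :* b :+ q) :* r)) :* y) refl
                 (c 0) (g j) (g i) r (f j) (lincomb (c ∘ suc) l j) (lincomb (c ∘ suc) l i))

  nonzero? : (is : List I) (f : I → ℚ) → (∃ λ i → i ∈ is × f i ≢ 0ℚ) ⊎ (∀ {i} → i ∈ is → f i ≡ 0ℚ)
  nonzero? []       f = inj₂ λ ()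
  nonzero? (i ∷ is) f with f i ≟ 0ℚ | nonzero? is f
  ... | no  ≢0 | _                   = inj₁ (i , here refl , ≢0)
  ... | yes ≡0 | inj₁ (j , j∈ , ≢0) = inj₁ (j , there j∈ , ≢0)
  ... | yes ≡0 | inj₂ all0          = inj₂ λ { (here refl) → ≡0 ; (there i∈) → all0 i∈ }

  Dependence : List I → List (I → ℚ) → Set
  Dependence is l =
    Σ (ℕ → ℚ) λ c → (∃ λ k → k ℕ.< length l × c k ≢ 0ℚ) × (∀ {i} → i ∈ is → lincomb c l i ≡ 0ℚ)

  -- Gaussian elimination: if `f` is nonzero at `i`, clearing coordinate `i` from the other vectors
  -- leaves one vector and one coordinate fewer, and coordinate `i` then dictates the coefficient of
  -- `f`. The recursion runs on `r` because the reduced list is not a sublist of the given one.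
  dependent : ∀ r (l : List (I → ℚ)) (is : List I) → length l ≡ r → length is ℕ.< r → Dependence is l
  dependent (suc r) (f ∷ l) is len is<l with nonzero? is f
  ... | inj₂ f≡0 = c , (0 , s≤s z≤n , λ ()) , λ {i} i∈ →
          trans (cong₂ _+_ (trans (cong (1ℚ *_) (f≡0 i∈)) (ℚₚ.*-zeroʳ 1ℚ)) (lincomb-0 l i)) (ℚₚ.+-identityˡ 0ℚ)
    where c : ℕ → ℚ
          c zero    = 1ℚ
          c (suc _) = 0ℚ
  ... | inj₁ (i , i∈ , fi≢0) with ∈-∃++ i∈
  ...   | as , bs , refl = c , (suc k , s≤s (subst (k ℕ.<_) (Listₚ.length-map _ l) k<) , ck≢0) , zeros
    where
    instance _ = ≢-nonZero fi≢0
    q = 1/ f i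
    shorter : length (as ++ bs) ℕ.< r
    shorter = subst (ℕ._< r) (sym (Listₚ.length-++ as))
      (ℕₚ.≤-pred (subst (λ x → suc x ℕ.≤ suc r)
         (trans (Listₚ.length-++ as) (ℕₚ.+-suc (length as) (length bs))) is<l))
    rec : Dependence (as ++ bs) (map (reduce q f i) l)
    rec = dependent r (map (reduce q f i) l) (as ++ bs)
            (trans (Listₚ.length-map _ l) (ℕₚ.suc-injective len)) shorter
    c′ = proj₁ rec
    k = proj₁ (proj₁ (proj₂ rec))
    k< = proj₁ (proj₂ (proj₁ (proj₂ rec)))
    ck≢0 = proj₂ (proj₂ (proj₁ (proj₂ rec)))
    c : ℕ → ℚ
    c zero    = - (lincomb c′ l i * q)
    c (suc k) = c′ k
    zeros′ : ∀ {j} → j ∈ as ++ bs → lincomb c (f ∷ l) j ≡ 0ℚ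
    zeros′ {j} j∈ = trans (ℚₚ.+-comm (c 0 * f j) _)
                          (trans (sym (lincomb-reduce c′ q f i l j)) (proj₂ (proj₂ rec) j∈))
    zeroᵢ : lincomb c (f ∷ l) i ≡ 0ℚ
    zeroᵢ = trans (cong (_+ lincomb c′ l i)
               (trans (solve 3 (λ p r y → (:- (p :* r)) :* y := (:- p) :* (r :* y)) refl (lincomb c′ l i) q (f i))
                      (trans (cong ((- lincomb c′ l i) *_) (ℚₚ.*-inverseˡ (f i))) (ℚₚ.*-identityʳ (- lincomb c′ l i)))))
               (ℚₚ.+-inverseˡ (lincomb c′ l i))
    zeros : ∀ {j} → j ∈ as ++ i ∷ bs → lincomb c (f ∷ l) j ≡ 0ℚ
    zeros j∈ with ∈-++⁻ as j∈
    ... | inj₁ j∈as         = zeros′ (∈-++⁺ˡ j∈as)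
    ... | inj₂ (here refl)  = zeroᵢ
    ... | inj₂ (there j∈bs) = zeros′ (∈-++⁺ʳ as j∈bs)

  independent-length : {is : List I} (l : List (I → ℚ)) → Independent is l → length l ℕ.≤ length is
  independent-length {is = is} l ind = ℕₚ.≮⇒≥ λ is<l →
    let c , (k , k< , ck≢0) , zeros = dependent _ l is refl is<l in ck≢0 (ind c zeros k<)

  independent-∷ : {is : List I} → (∀ i → i ∈ is) → (l : List (I → ℚ)) {f : I → ℚ} →
                  Independent is l → ¬ Span l f → Independent is (f ∷ l)
  independent-∷ cover l {f} ind f∉ c zeros with c 0 ≟ 0ℚ
  ... | no c0≢0 = ⊥-elim (f∉ ((λ k → (- r) * c (suc k)) , λ i → trans (eqn i) (sym (lincomb-⊛ (- r) (c ∘ suc) l i))))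
    where
    instance _ = ≢-nonZero c0≢0
    r = 1/ c 0
    eqn : ∀ i → f i ≡ (- r) * lincomb (c ∘ suc) l i
    eqn i = begin
      f i                                                          ≡⟨ ℚₚ.*-identityˡ (f i) ⟨
      1ℚ * f i                                                     ≡⟨ cong (_* f i) (ℚₚ.*-inverseˡ (c 0)) ⟨
      (r * c 0) * f i                                              ≡⟨ solve 4 (λ r c y p → (r :* c) :* y := r :* (c :* y :+ p) :+ (:- r) :* p) refl r (c 0) (f i) p ⟩
      r * (c 0 * f i + p) + (- r) * p                              ≡⟨ cong (λ x → r * x + (- r) * p) (zeros (cover i)) ⟩
      r * 0ℚ + (- r) * p                                           ≡⟨ solve 2 (λ r p → r :* con 0ℚ :+ p := p) refl r ((- r) * p) ⟩
      (- r) * p                                                    ∎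
      where open ≡-Reasoning
            p = lincomb (c ∘ suc) l i
  ... | yes c0≡0 = all0
    where
    all0 : ∀ {k} → k ℕ.< suc (length l) → c k ≡ 0ℚ
    tail : ∀ {i} → i ∈ _ → lincomb (c ∘ suc) l i ≡ 0ℚ
    tail {i} i∈ = trans (trans (sym (ℚₚ.+-identityˡ _))
        (cong (_+ lincomb (c ∘ suc) l i) (sym (trans (cong (_* f i) c0≡0) (ℚₚ.*-zeroˡ (f i)))))) (zeros i∈)
    all0 {zero}  _        = c0≡0
    all0 {suc k} (s≤s k<) = ind (c ∘ suc) tail k<

  record Subspace (P : (I → ℚ) → Set) : Set where
    field
      ext   : ∀ {f g} → f ≗ᵥ g → P f → P g
      zero∈ : P 𝟎
      add   : ∀ {f g} → P f → P g → P (f ⊕ g)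
      scale : ∀ c {f} → P f → P (c ⊛ f)

    lincomb∈ : ∀ c {l} → All P l → P (lincomb c l)
    lincomb∈ c []       = zero∈
    lincomb∈ c (p ∷ ps) = add (scale (c 0) p) (lincomb∈ (c ∘ suc) ps)

  module _ {is : List I} (cover : ∀ i → i ∈ is) where

    -- Unlimited growth would produce more independent vectors than coordinates. `P` speaks of the
    -- whole list, so that the condition on the next vector may depend on how many came before.
    no-growth : (P : List (I → ℚ) → Set) → P [] →
      (∀ l → length l ℕ.≤ length is → P l → ¬ ¬ ∃ λ f → ¬ Span l f × P (f ∷ l)) → ⊥
    no-growth P P[] grow = lists (suc (length is)) ℕₚ.≤-refl λ { (l , len , ind , _) →
        ℕₚ.<-irrefl refl (subst (ℕ._≤ length is) len (independent-length l ind)) }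
      where
      lists : ∀ k → k ℕ.≤ suc (length is) → ¬ ¬ Σ (List (I → ℚ)) λ l → length l ≡ k × Independent is l × P l
      lists zero    _  = return ([] , refl , (λ _ _ ()) , P[])
      lists (suc k) k< = lists k (ℕₚ.≤-trans (ℕₚ.n≤1+n k) k<) >>= λ { (l , len , ind , Pl) →
        grow l (subst (ℕ._≤ length is) (sym len) (ℕₚ.≤-pred k<)) Pl >>= λ { (f , f∉ , Pf) →
        return (f ∷ l , cong suc len , independent-∷ cover l ind f∉ , Pf) } }

    -- A list in `K` that cannot be prolonged spans `K`; both double negations are due to `K` being
    -- undecidable in general.
    finitely-spanned : (K : (I → ℚ) → Set) →
      ¬ ¬ Σ (List (I → ℚ)) λ l → All K l × (∀ f → K f → ¬ ¬ Span l f)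
    finitely-spanned K none = no-growth (All K) [] λ l _ Kl stuck →
      none (l , Kl , λ f Kf f∉ → stuck (f , f∉ , Kf ∷ Kl))

    -- At each stage a vector is taken from `P (suc k)` outside `P k`. The earlier ones all lie in
    -- the subspace `P k`, so it is outside their span, and proper steps are bounded by the
    -- dimension.
    chain-stops : (P : ℕ → (I → ℚ) → Set) → (∀ k → Subspace (P k)) → (∀ k {f} → P k f → P (suc k) f) →
      ¬ ¬ Σ ℕ λ k → k ℕ.≤ length is × (∀ f → P (suc k) f → ¬ ¬ P k f)
    chain-stops P sub mono none = no-growth (λ l → All (P (length l)) l) [] λ l len Pl stuck →
      none (length l , len , λ f Pf f∉ →
        stuck (f , (λ { (c , eqn) → f∉ (Subspace.ext (sub _) (λ i → sym (eqn i)) (Subspace.lincomb∈ (sub _) c Pl)) })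
                 , Pf ∷ All.map (mono _) Pl))

  -- Matrices

  Mat : Set → Set → Set
  Mat X Y = X → Y → ℚ

  infix 4 _≗ₘ_
  _≗ₘ_ : (m m′ : Mat X Y) → Set
  m ≗ₘ m′ = ∀ x y → m x y ≡ m′ x y

  infixl 6 _⊞_ _⊟_
  infixr 7 _⊠_

  _⊞_ _⊟_ : (m m′ : Mat X Y) → Mat X Y
  (m ⊞ m′) x = m x ⊕ m′ x
  (m ⊟ m′) x = m x ⊖ m′ x

  _⊠_ : ℚ → Mat X Y → Mat X Y
  (c ⊠ m) x = c ⊛ m x

  𝟎ₘ : Mat X Y
  𝟎ₘ _ = 𝟎

  app : List Y → Mat X Y → (Y → ℚ) → X → ℚ
  app ys m z x = dot ys (m x) z

  module _ (ys : List Y) where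

    app-cong : (m : Mat X Y) {u v : Y → ℚ} → u ≗ᵥ v → app ys m u ≗ᵥ app ys m v
    app-cong m eqn x = dot-cong ys {m x} (λ _ → refl) eqn

    app-congₘ : {m m′ : Mat X Y} (z : Y → ℚ) → m ≗ₘ m′ → app ys m z ≗ᵥ app ys m′ z
    app-congₘ z eqn x = dot-cong ys (eqn x) (λ _ → refl)

    app-⊕ : (m : Mat X Y) (u v : Y → ℚ) → app ys m (u ⊕ v) ≗ᵥ app ys m u ⊕ app ys m v
    app-⊕ m u v x = dot-⊕ʳ ys (m x) u v

    app-⊛ : (m : Mat X Y) (c : ℚ) (u : Y → ℚ) → app ys m (c ⊛ u) ≗ᵥ c ⊛ app ys m u
    app-⊛ m c u x = dot-⊛ʳ ys c (m x) u

    app-0 : (m : Mat X Y) {u : Y → ℚ} → u ≗ᵥ 𝟎 → app ys m u ≗ᵥ 𝟎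
    app-0 m eqn x = dot-0ʳ ys (m x) eqn

    app-⊞ : (m m′ : Mat X Y) (z : Y → ℚ) → app ys (m ⊞ m′) z ≗ᵥ app ys m z ⊕ app ys m′ z
    app-⊞ m m′ z x = dot-⊕ˡ ys (m x) (m′ x) z

    app-⊠ : (c : ℚ) (m : Mat X Y) (z : Y → ℚ) → app ys (c ⊠ m) z ≗ᵥ c ⊛ app ys m z
    app-⊠ c m z x = dot-⊛ˡ ys c (m x) z

    app-𝟎ₘ : (z : Y → ℚ) → app ys (𝟎ₘ {X = X}) z ≗ᵥ 𝟎
    app-𝟎ₘ z x = dot-0ˡ ys z (λ _ → refl)

    app-⊟ : (m m′ : Mat X Y) (z : Y → ℚ) → app ys (m ⊟ m′) z ≗ᵥ app ys m z ⊖ app ys m′ z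
    app-⊟ m m′ z x = trans (app-⊞ m ((- 1ℚ) ⊠ m′) z x) (cong (app ys m z x +_) (app-⊠ (- 1ℚ) m′ z x))

    app-⊖ : (m : Mat X Y) (u v : Y → ℚ) → app ys m (u ⊖ v) ≗ᵥ app ys m u ⊖ app ys m v
    app-⊖ m u v x = dot-⊖ʳ ys (m x) u v

    app-∑ : (m : Mat X Y) (js : List J) (g : J → Y → ℚ) (z : J → ℚ) (x : X) →
      ∑ js (λ j → app ys m (g j) x * z j) ≡ app ys m (λ y → ∑ js (λ j → g j y * z j)) x
    app-∑ m js g z x = begin
      ∑ js (λ j → app ys m (g j) x * z j)
        ≡⟨ ∑-cong js (λ j → sym (∑-*ʳ ys (z j) (λ y → m x y * g j y))) ⟩
      ∑ js (λ j → ∑ ys (λ y → m x y * g j y * z j))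
        ≡⟨ ∑-swap js ys _ ⟩
      ∑ ys (λ y → ∑ js (λ j → m x y * g j y * z j))
        ≡⟨ ∑-cong ys (λ y → trans (∑-cong js (λ j → ℚₚ.*-assoc (m x y) (g j y) (z j))) (∑-*ˡ js (m x y) _)) ⟩
      app ys m (λ y → ∑ js (λ j → g j y * z j)) x ∎
      where open ≡-Reasoning

  adjoint : (xs : List X) (ys : List Y) (m : Mat X Y) (z : Y → ℚ) (w : X → ℚ) →
            dot xs (app ys m z) w ≡ dot ys z (app xs (flip m) w)
  adjoint xs ys m z w = begin
    ∑ xs (λ x → ∑ ys (λ y → m x y * z y) * w x)
      ≡⟨ ∑-cong xs (λ x → sym (∑-*ʳ ys (w x) _)) ⟩
    ∑ xs (λ x → ∑ ys (λ y → m x y * z y * w x))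
      ≡⟨ ∑-swap xs ys _ ⟩
    ∑ ys (λ y → ∑ xs (λ x → m x y * z y * w x))
      ≡⟨ ∑-cong ys (λ y → trans
           (∑-cong xs (λ x → solve 3 (λ a b c → a :* b :* c := b :* (a :* c)) refl (m x y) (z y) (w x)))
           (∑-*ˡ xs (z y) _)) ⟩
    dot ys z (app xs (flip m) w) ∎
    where open ≡-Reasoning

  -- Ternary products, Gram operators and their right identities

  module Operators {X Y : Set} {xs : List X} {ys : List Y}
                   (coverˣ : ∀ x → x ∈ xs) (coverʸ : ∀ y → y ∈ ys) where

    infixr 8 _∙_ _ᵀ∙_

    _∙_ : Mat X Y → (Y → ℚ) → X → ℚ
    _∙_ = app ys

    _ᵀ∙_ : Mat X Y → (X → ℚ) → Y → ℚ
    m ᵀ∙ w = app xs (flip m) w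

    adjointᵀ : (m : Mat X Y) (w : X → ℚ) (z : Y → ℚ) → dot ys (m ᵀ∙ w) z ≡ dot xs w (m ∙ z)
    adjointᵀ m = adjoint ys xs (flip m)

    ∙-injective : (m m′ : Mat X Y) → (∀ z → m ∙ z ≗ᵥ m′ ∙ z) → m ≗ₘ m′
    ∙-injective m m′ eqn x = dot-injective coverʸ (m x) (m′ x) λ w →
      trans (dot-comm ys w (m x)) (trans (eqn w x) (dot-comm ys (m′ x) w))

    ᵀ∙-injective : (m m′ : Mat X Y) → (∀ w → m ᵀ∙ w ≗ᵥ m′ ᵀ∙ w) → m ≗ₘ m′
    ᵀ∙-injective m m′ eqn x y = dot-injective coverˣ (flip m y) (flip m′ y) (λ w →
      trans (dot-comm xs w (flip m y)) (trans (eqn w y) (dot-comm xs (flip m′ y) w))) x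

    -- Because `⟨m z, m z⟩ = ⟨z, mᵀ m z⟩`.
    ∙-definite : (m : Mat X Y) (z : Y → ℚ) → m ᵀ∙ m ∙ z ≗ᵥ 𝟎 → m ∙ z ≗ᵥ 𝟎
    ∙-definite m z eqn x = dot-definite xs (m ∙ z)
      (trans (adjoint xs ys m z (m ∙ z)) (dot-0ʳ ys z eqn)) (coverˣ x)

    -- The ternary product a bᵀ c.
    tern : (a b c : Mat X Y) → Mat X Y
    tern a b c x y = (a ∙ b ᵀ∙ flip c y) x

    tern-∙ : (a b c : Mat X Y) (z : Y → ℚ) → tern a b c ∙ z ≗ᵥ a ∙ b ᵀ∙ c ∙ z
    tern-∙ a b c z x = trans (app-∑ ys a ys (λ y → b ᵀ∙ flip c y) z x)
      (app-cong ys a (λ y′ → app-∑ xs (flip b) ys (λ y → flip c y) z y′) x)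

    tern-ᵀ∙ : (a b c : Mat X Y) (w : X → ℚ) → tern a b c ᵀ∙ w ≗ᵥ c ᵀ∙ b ∙ a ᵀ∙ w
    tern-ᵀ∙ a b c w = dot-injective coverʸ _ _ λ z → begin
      dot ys z (tern a b c ᵀ∙ w)         ≡⟨ adjoint xs ys (tern a b c) z w ⟨
      dot xs (tern a b c ∙ z) w          ≡⟨ dot-cong xs (tern-∙ a b c z) (λ _ → refl) ⟩
      dot xs (a ∙ b ᵀ∙ c ∙ z) w          ≡⟨ adjoint xs ys a (b ᵀ∙ c ∙ z) w ⟩
      dot ys (b ᵀ∙ c ∙ z) (a ᵀ∙ w)       ≡⟨ adjointᵀ b (c ∙ z) (a ᵀ∙ w) ⟩
      dot xs (c ∙ z) (b ∙ a ᵀ∙ w)        ≡⟨ adjoint xs ys c z (b ∙ a ᵀ∙ w) ⟩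
      dot ys z (c ᵀ∙ b ∙ a ᵀ∙ w)         ∎
      where open ≡-Reasoning

    -- The operator `S = Σ sᵀ s`, kept as a map on vectors: matrices indexed by `Y × Y` are never
    -- formed.
    gram : List (Mat X Y) → (Y → ℚ) → Y → ℚ
    gram []       z = 𝟎
    gram (s ∷ ss) z = s ᵀ∙ s ∙ z ⊕ gram ss z

    gram-cong : ∀ ss {u v} → u ≗ᵥ v → gram ss u ≗ᵥ gram ss v
    gram-cong []       eqn y = refl
    gram-cong (s ∷ ss) eqn y = cong₂ _+_ (app-cong xs (flip s) (app-cong ys s eqn) y) (gram-cong ss eqn y)

    gram-⊕ : ∀ ss u v → gram ss (u ⊕ v) ≗ᵥ gram ss u ⊕ gram ss v
    gram-⊕ []       u v y = sym (ℚₚ.+-identityˡ 0ℚ)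
    gram-⊕ (s ∷ ss) u v y = trans
      (cong₂ _+_ (trans (app-cong xs (flip s) (app-⊕ ys s u v) y) (app-⊕ xs (flip s) (s ∙ u) (s ∙ v) y))
                 (gram-⊕ ss u v y))
      (interchange ((s ᵀ∙ s ∙ u) y) ((s ᵀ∙ s ∙ v) y) (gram ss u y) (gram ss v y))

    gram-⊛ : ∀ ss c u → gram ss (c ⊛ u) ≗ᵥ c ⊛ gram ss u
    gram-⊛ []       c u y = sym (ℚₚ.*-zeroʳ c)
    gram-⊛ (s ∷ ss) c u y = trans
      (cong₂ _+_ (trans (app-cong xs (flip s) (app-⊛ ys s c u) y) (app-⊛ xs (flip s) c (s ∙ u) y))
                 (gram-⊛ ss c u y))
      (sym (ℚₚ.*-distribˡ-+ c ((s ᵀ∙ s ∙ u) y) (gram ss u y)))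

    gram-0 : ∀ ss z → (∀ {s} → s ∈ ss → s ∙ z ≗ᵥ 𝟎) → gram ss z ≗ᵥ 𝟎
    gram-0 []       z eqn y = refl
    gram-0 (s ∷ ss) z eqn y = trans
      (cong₂ _+_ (app-0 xs (flip s) (eqn (here refl)) y) (gram-0 ss z (eqn ∘ there) y)) (ℚₚ.+-identityˡ 0ℚ)

    dot-gram : ∀ ss u w → dot ys (gram ss u) w ≡ ∑ ss (λ s → dot xs (s ∙ u) (s ∙ w))
    dot-gram []       u w = dot-0ˡ ys w (λ _ → refl)
    dot-gram (s ∷ ss) u w = trans (dot-⊕ˡ ys (s ᵀ∙ s ∙ u) (gram ss u) w)
      (cong₂ _+_ (adjointᵀ s (s ∙ u) w) (dot-gram ss u w))

    ∑-squares : ∀ ss u → ∑ ss (λ s → dot xs (s ∙ u) (s ∙ u)) ≡ 0ℚ → ∀ {s} → s ∈ ss → s ∙ u ≗ᵥ 𝟎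
    ∑-squares (s ∷ ss) u eqn = λ where
        (here refl) x → dot-definite xs (s ∙ u) (p+q≡0⇒p≡0 (dot≥0 xs (s ∙ u)) (nonneg ss) eqn) (coverˣ x)
        (there s∈)    → ∑-squares ss u (p+q≡0⇒q≡0 (dot≥0 xs (s ∙ u)) (nonneg ss) eqn) s∈
      where
      nonneg : ∀ ss → 0ℚ ℚ.≤ ∑ ss (λ s → dot xs (s ∙ u) (s ∙ u))
      nonneg []       = ℚₚ.≤-refl
      nonneg (s ∷ ss) = subst (ℚ._≤ dot xs (s ∙ u) (s ∙ u) + ∑ ss (λ s → dot xs (s ∙ u) (s ∙ u)))
        (ℚₚ.+-identityˡ 0ℚ) (ℚₚ.+-mono-≤ (dot≥0 xs (s ∙ u)) (nonneg ss))

    gram-definite : ∀ ss u → gram ss u ≗ᵥ 𝟎 → ∀ {s} → s ∈ ss → s ∙ u ≗ᵥ 𝟎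
    gram-definite ss u eqn = ∑-squares ss u (trans (sym (dot-gram ss u u)) (dot-0ˡ ys u eqn))

    -- As `S` is symmetric, `⟨S u, S u⟩ = Σ ⟨s u, s S u⟩ = 0`, so already `S u = 0`. This allows a
    -- factor `S` to be cancelled from a polynomial relation.
    gram²-definite : ∀ ss u → (∀ {s} → s ∈ ss → s ∙ gram ss u ≗ᵥ 𝟎) → ∀ {s} → s ∈ ss → s ∙ u ≗ᵥ 𝟎
    gram²-definite ss u eqn = gram-definite ss u λ y → dot-definite ys (gram ss u)
      (trans (dot-gram ss u (gram ss u)) (∑-0∈ ss (λ {s} s∈ → dot-0ʳ xs (s ∙ u) (eqn s∈)))) (coverʸ y)
      where
      ∑-0∈ : ∀ {I : Set} (is : List I) {f : I → ℚ} → (∀ {i} → i ∈ is → f i ≡ 0ℚ) → ∑ is f ≡ 0ℚ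
      ∑-0∈ []       eqn = refl
      ∑-0∈ (i ∷ is) eqn = trans (cong₂ _+_ (eqn (here refl)) (∑-0∈ is (eqn ∘ there))) (ℚₚ.+-identityˡ 0ℚ)

    -- Coefficients are listed lowest degree first.
    horner : List (Mat X Y) → List ℚ → (Y → ℚ) → Y → ℚ
    horner ss []       z = 𝟎
    horner ss (c ∷ cs) z = c ⊛ z ⊕ gram ss (horner ss cs z)

    horner-cong : ∀ ss cs {u v} → u ≗ᵥ v → horner ss cs u ≗ᵥ horner ss cs v
    horner-cong ss []       eqn y = refl
    horner-cong ss (c ∷ cs) eqn y = cong₂ _+_ (cong (c *_) (eqn y)) (gram-cong ss (horner-cong ss cs eqn) y)

    gram-horner : ∀ ss cs z → gram ss (horner ss cs z) ≗ᵥ horner ss cs (gram ss z)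
    gram-horner ss []       z y = gram-0 ss 𝟎 (λ {s} _ → app-0 ys s (λ _ → refl)) y
    gram-horner ss (c ∷ cs) z y = trans (gram-⊕ ss (c ⊛ z) (gram ss (horner ss cs z)) y)
      (cong₂ _+_ (gram-⊛ ss c z y) (gram-cong ss (gram-horner ss cs z) y))

    horner-0 : ∀ ss cs {z} → z ≗ᵥ 𝟎 → horner ss cs z ≗ᵥ 𝟎
    horner-0 ss []       eqn y = refl
    horner-0 ss (c ∷ cs) eqn y = trans
      (cong₂ _+_ (trans (cong (c *_) (eqn y)) (ℚₚ.*-zeroʳ c))
                 (trans (gram-cong ss (horner-0 ss cs eqn) y) (gram-0 ss 𝟎 (λ {s} _ → app-0 ys s (λ _ → refl)) y)))
      (ℚₚ.+-identityˡ 0ℚ)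

    horner-map : ∀ ss d cs z → horner ss (map (d *_) cs) z ≗ᵥ d ⊛ horner ss cs z
    horner-map ss d []       z y = sym (ℚₚ.*-zeroʳ d)
    horner-map ss d (c ∷ cs) z y = trans
      (cong₂ _+_ (ℚₚ.*-assoc d c (z y))
                 (trans (gram-cong ss (horner-map ss d cs z) y) (gram-⊛ ss d (horner ss cs z) y)))
      (sym (ℚₚ.*-distribˡ-+ d (c * z y) (gram ss (horner ss cs z) y)))

    -- The product `m S`, written with ternary products `m sᵀ s` so that it stays in every ternary
    -- ring containing `m` and `ss`.
    rmul : List (Mat X Y) → Mat X Y → Mat X Y
    rmul []       m = 𝟎ₘ
    rmul (s ∷ ss) m = tern m s s ⊞ rmul ss m

    rmul-∙ : ∀ ss m z → rmul ss m ∙ z ≗ᵥ m ∙ gram ss z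
    rmul-∙ []       m z x = trans (app-𝟎ₘ ys z x) (sym (app-0 ys m (λ _ → refl) x))
    rmul-∙ (s ∷ ss) m z x = trans (app-⊞ ys (tern m s s) (rmul ss m) z x) (trans
      (cong₂ _+_ (tern-∙ m s s z x) (rmul-∙ ss m z x))
      (sym (app-⊕ ys m (s ᵀ∙ s ∙ z) (gram ss z) x)))

    rhorner : List (Mat X Y) → List ℚ → Mat X Y → Mat X Y
    rhorner ss []       m = 𝟎ₘ
    rhorner ss (c ∷ cs) m = c ⊠ m ⊞ rhorner ss cs (rmul ss m)

    rhorner-∙ : ∀ ss cs m z → rhorner ss cs m ∙ z ≗ᵥ m ∙ horner ss cs z
    rhorner-∙ ss []       m z x = trans (app-𝟎ₘ ys z x) (sym (app-0 ys m (λ _ → refl) x))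
    rhorner-∙ ss (c ∷ cs) m z x = trans (app-⊞ ys (c ⊠ m) (rhorner ss cs (rmul ss m)) z x) (trans
      (cong₂ _+_ (trans (app-⊠ ys c m z x) (sym (app-⊛ ys m c z x)))
                 (trans (rhorner-∙ ss cs (rmul ss m) z x) (rmul-∙ ss m (horner ss cs z) x)))
      (sym (app-⊕ ys m (c ⊛ z) (gram ss (horner ss cs z)) x)))

    -- For S = gram ss, the element e = S g(S) is a right identity for ss. It is found by dividing a
    -- polynomial relation for S by S, which is possible because S is symmetric.
    Unit : List (Mat X Y) → List ℚ → Set
    Unit ss cs = ∀ z {s} → s ∈ ss → s ∙ (z ⊖ gram ss (horner ss cs z)) ≗ᵥ 𝟎

    cancel : ∀ ss cs → Any (_≢ 0ℚ) cs → (∀ z {s} → s ∈ ss → s ∙ horner ss cs z ≗ᵥ 𝟎) → Σ (List ℚ) (Unit ss)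
    cancel ss (c ∷ cs) nz kills with c ≟ 0ℚ
    -- A zero constant term leaves `S` times a polynomial of lower degree, and the factor `S` is
    -- cancelled.
    ... | yes refl = cancel ss cs (tail nz) λ z → gram²-definite ss (horner ss cs z) λ {s} s∈ x →
            trans (app-cong ys s (λ y → sym (trans (cong (_+ gram ss (horner ss cs z) y) (ℚₚ.*-zeroˡ (z y)))
                                                   (ℚₚ.+-identityˡ _))) x)
                  (kills z s∈ x)
      where
      tail : Any (_≢ 0ℚ) (0ℚ ∷ cs) → Any (_≢ 0ℚ) cs
      tail (here 0≢0) = contradiction refl 0≢0
      tail (there nz) = nz
    -- Division by `c` turns the relation into `1 − S g(S)` with `g` equal to `−cs / c`.
    ... | no c≢0 = map ((- r) *_) cs , λ z {s} s∈ x →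
            trans (app-cong ys s (eqn z) x)
                  (trans (app-⊛ ys s r (horner ss (c ∷ cs) z) x)
                         (trans (cong (r *_) (kills z s∈ x)) (ℚₚ.*-zeroʳ r)))
      where
      instance _ = ≢-nonZero c≢0
      r = 1/ c
      eqn : ∀ z → z ⊖ gram ss (horner ss (map ((- r) *_) cs) z) ≗ᵥ r ⊛ horner ss (c ∷ cs) z
      eqn z y = begin
        z y + (- 1ℚ) * gram ss (horner ss (map ((- r) *_) cs) z) y
          ≡⟨ cong (λ p → z y + (- 1ℚ) * p) (trans (gram-cong ss (horner-map ss (- r) cs z) y)
                                                  (gram-⊛ ss (- r) (horner ss cs z) y)) ⟩
        z y + (- 1ℚ) * ((- r) * g)
          ≡⟨ cong (_+ (- 1ℚ) * ((- r) * g)) (trans (sym (ℚₚ.*-identityˡ (z y))) (cong (_* z y) (sym (ℚₚ.*-inverseˡ c)))) ⟩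
        r * c * z y + (- 1ℚ) * ((- r) * g)
          ≡⟨ solve 4 (λ r c z g → r :* c :* z :+ (:- con 1ℚ) :* ((:- r) :* g) := r :* (c :* z :+ g)) refl r c (z y) g ⟩
        r * (c * z y + g) ∎
        where open ≡-Reasoning
              g = gram ss (horner ss cs z) y

    -- The functions `(s, x, y) ↦ (s Sⁱ) x y` for `i < r`. Once `r` exceeds the number of triples
    -- over `ss`, `xs` and `ys` they are dependent, which is one polynomial relation for `S` valid
    -- for all `s` in `ss`.
    powers : List (Mat X Y) → ℕ → List (Mat X Y × X × Y → ℚ)
    powers ss zero    = []
    powers ss (suc r) = (λ (s , x , y) → s x y) ∷ map (_∘ λ (s , x , y) → rmul ss s , x , y) (powers ss r)

    length-powers : ∀ ss r → length (powers ss r) ≡ r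
    length-powers ss zero    = refl
    length-powers ss (suc r) = cong suc (trans (Listₚ.length-map _ (powers ss r)) (length-powers ss r))

    coefficients : ℕ → (ℕ → ℚ) → List ℚ
    coefficients zero    c = []
    coefficients (suc r) c = c 0 ∷ coefficients r (c ∘ suc)

    coefficients-≢0 : ∀ r c {k} → k ℕ.< r → c k ≢ 0ℚ → Any (_≢ 0ℚ) (coefficients r c)
    coefficients-≢0 (suc r) c {zero}  _        ck≢0 = here ck≢0
    coefficients-≢0 (suc r) c {suc k} (s≤s k<) ck≢0 = there (coefficients-≢0 r (c ∘ suc) k< ck≢0)

    rhorner-powers : ∀ ss r c s x y → rhorner ss (coefficients r c) s x y ≡ lincomb c (powers ss r) (s , x , y)
    rhorner-powers ss zero    c s x y = refl
    rhorner-powers ss (suc r) c s x y = cong (c 0 * s x y +_)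
      (trans (rhorner-powers ss r (c ∘ suc) (rmul ss s) x y) (sym (lincomb-∘ (c ∘ suc) _ (powers ss r) (s , x , y))))

    unit : ∀ ss → Σ (List ℚ) (Unit ss)
    unit ss = cancel ss cs
        (coefficients-≢0 r c (subst (k ℕ.<_) (length-powers ss r) k<) ck≢0)
        λ z {s} s∈ x → trans (sym (rhorner-∙ ss cs s z x)) (dot-0ˡ ys z λ y →
          trans (rhorner-powers ss r c s x y)
                (zeros (∈-cartesianProduct⁺ s∈ (∈-cartesianProduct⁺ (coverˣ x) (coverʸ y)))))
      where
      entries = cartesianProduct ss (cartesianProduct xs ys)
      r = suc (length entries)
      dep = dependent r (powers ss r) entries (length-powers ss r) ℕₚ.≤-refl
      c = proj₁ dep
      k = proj₁ (proj₁ (proj₂ dep))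
      k< = proj₁ (proj₂ (proj₁ (proj₂ dep)))
      ck≢0 = proj₂ (proj₂ (proj₁ (proj₂ dep)))
      zeros = proj₂ (proj₂ dep)
      cs = coefficients r c

    lincomb-∙ : ∀ c (l : List (X × Y → ℚ)) v → (∀ {f} → f ∈ l → (λ x y → f (x , y)) ∙ v ≗ᵥ 𝟎) →
                (λ x y → lincomb c l (x , y)) ∙ v ≗ᵥ 𝟎
    lincomb-∙ c []      v kills x = app-𝟎ₘ ys v x
    lincomb-∙ c (f ∷ l) v kills x = trans
      (app-⊞ ys (c 0 ⊠ (λ x y → f (x , y))) (λ x y → lincomb (c ∘ suc) l (x , y)) v x)
      (trans (cong₂ _+_ (trans (app-⊠ ys (c 0) (λ x y → f (x , y)) v x) (trans (cong (c 0 *_) (kills (here refl) x)) (ℚₚ.*-zeroʳ (c 0))))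
                        (lincomb-∙ (c ∘ suc) l v (kills ∘ there) x))
             (ℚₚ.+-identityˡ 0ℚ))

    -- A finite spanning list has the same common kernel as `K`, and a finite list is what `gram`
    -- and `unit` can handle.
    finite-kernel : (K : Mat X Y → Set) → ¬ ¬ Σ (List (Mat X Y)) λ ss →
      All K ss × (∀ v → (∀ {s} → s ∈ ss → s ∙ v ≗ᵥ 𝟎) → ∀ m → K m → m ∙ v ≗ᵥ 𝟎)
    finite-kernel K =
      finitely-spanned {is = cartesianProduct xs ys} (λ (x , y) → ∈-cartesianProduct⁺ (coverˣ x) (coverʸ y))
                       (λ f → K (λ x y → f (x , y))) >>= λ (l , Kl , spans) →
      return (map (λ f x y → f (x , y)) l , Allₚ.map⁺ Kl , λ v kills m Km x → ≟-stable (
        spans (λ (x , y) → m x y) Km >>= λ (c , eqn) →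
        return (trans (app-congₘ ys v (λ x y → eqn (x , y)) x)
                      (lincomb-∙ c l v (λ f∈ → kills (∈-map⁺ _ f∈)) x))))

  -- Comparison of two ternary rings, one inside the other

  module Ternary {X Y : Set} {xs : List X} {ys : List Y}
                 (coverˣ : ∀ x → x ∈ xs) (coverʸ : ∀ y → y ∈ ys) where

    open Operators coverˣ coverʸ
    -- With rows and columns exchanged, right identities become left identities. Lists `ps` over
    -- `Mat Y X` hold transposes of members of the ring.
    module ᵀ = Operators coverʸ coverˣ

    -- Left multiplication by `Σ pᵀ p`; with `a = pᵀ` this is a sum of ternary products `a aᵀ m`.
    lmul : List (Mat Y X) → Mat X Y → Mat X Y
    lmul []       m = 𝟎ₘ
    lmul (p ∷ ps) m = tern (flip p) (flip p) m ⊞ lmul ps m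

    lmul-∙ : ∀ ps m z → lmul ps m ∙ z ≗ᵥ ᵀ.gram ps (m ∙ z)
    lmul-∙ []       m z x = app-𝟎ₘ ys z x
    lmul-∙ (p ∷ ps) m z x = trans (app-⊞ ys (tern (flip p) (flip p) m) (lmul ps m) z x)
      (cong₂ _+_ (tern-∙ (flip p) (flip p) m z x) (lmul-∙ ps m z x))

    lmul-ᵀ∙ : ∀ ps m w → lmul ps m ᵀ∙ w ≗ᵥ m ᵀ∙ ᵀ.gram ps w
    lmul-ᵀ∙ []       m w y = trans (app-𝟎ₘ xs w y) (sym (app-0 xs (flip m) (λ _ → refl) y))
    lmul-ᵀ∙ (p ∷ ps) m w y = trans (app-⊞ xs (flip (tern (flip p) (flip p) m)) (flip (lmul ps m)) w y) (trans
      (cong₂ _+_ (tern-ᵀ∙ (flip p) (flip p) m w y) (lmul-ᵀ∙ ps m w y))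
      (sym (app-⊕ xs (flip m) (app ys (flip p) (app xs p w)) (ᵀ.gram ps w) y)))

    lhorner : List (Mat Y X) → List ℚ → Mat X Y → Mat X Y
    lhorner ps []       m = 𝟎ₘ
    lhorner ps (c ∷ cs) m = c ⊠ m ⊞ lmul ps (lhorner ps cs m)

    lhorner-∙ : ∀ ps cs m z → lhorner ps cs m ∙ z ≗ᵥ ᵀ.horner ps cs (m ∙ z)
    lhorner-∙ ps []       m z x = app-𝟎ₘ ys z x
    lhorner-∙ ps (c ∷ cs) m z x = trans (app-⊞ ys (c ⊠ m) (lmul ps (lhorner ps cs m)) z x)
      (cong₂ _+_ (app-⊠ ys c m z x)
                 (trans (lmul-∙ ps (lhorner ps cs m) z x) (ᵀ.gram-cong ps (lhorner-∙ ps cs m z) x)))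

    lhorner-ᵀ∙ : ∀ ps cs m w → lhorner ps cs m ᵀ∙ w ≗ᵥ m ᵀ∙ ᵀ.horner ps cs w
    lhorner-ᵀ∙ ps []       m w y = trans (app-𝟎ₘ xs w y) (sym (app-0 xs (flip m) (λ _ → refl) y))
    lhorner-ᵀ∙ ps (c ∷ cs) m w y = trans
      (app-⊞ xs (flip (c ⊠ m)) (flip (lmul ps (lhorner ps cs m))) w y) (trans
      (cong₂ _+_ (trans (app-⊠ xs c (flip m) w y) (sym (app-⊛ xs (flip m) c w y)))
                 (trans (lmul-ᵀ∙ ps (lhorner ps cs m) w y)
                 (trans (lhorner-ᵀ∙ ps cs m (ᵀ.gram ps w) y)
                        (app-cong xs (flip m) (λ x → sym (ᵀ.gram-horner ps cs w x)) y))))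
      (sym (app-⊕ xs (flip m) (c ⊛ w) (ᵀ.gram ps (ᵀ.horner ps cs w)) y)))

    -- Ternary rings of operators.
    record IsTernary (T : Mat X Y → Set) : Set where
      field
        ext    : ∀ {m m′} → m ≗ₘ m′ → T m → T m′
        zero∈  : T 𝟎ₘ
        add    : ∀ {m m′} → T m → T m′ → T (m ⊞ m′)
        scale  : ∀ c {m} → T m → T (c ⊠ m)
        tern∈  : ∀ {a b c} → T a → T b → T c → T (tern a b c)
        stable : ∀ {m} → ¬ ¬ T m → T m

      sub : ∀ {m m′} → T m → T m′ → T (m ⊟ m′)
      sub p q = add p (scale (- 1ℚ) q)

      rmul∈ : ∀ {ss m} → All T ss → T m → T (rmul ss m)
      rmul∈ []         Tm = zero∈
      rmul∈ (Ts ∷ Tss) Tm = add (tern∈ Tm Ts Ts) (rmul∈ Tss Tm)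

      rhorner∈ : ∀ {ss} cs {m} → All T ss → T m → T (rhorner ss cs m)
      rhorner∈ []       Tss Tm = zero∈
      rhorner∈ (c ∷ cs) Tss Tm = add (scale c Tm) (rhorner∈ cs Tss (rmul∈ Tss Tm))

      lmul∈ : ∀ {ps m} → All (T ∘ flip) ps → T m → T (lmul ps m)
      lmul∈ []         Tm = zero∈
      lmul∈ (Tp ∷ Tps) Tm = add (tern∈ Tp Tp Tm) (lmul∈ Tps Tm)

      lhorner∈ : ∀ {ps} cs {m} → All (T ∘ flip) ps → T m → T (lhorner ps cs m)
      lhorner∈ []       Tps Tm = zero∈
      lhorner∈ (c ∷ cs) Tps Tm = add (scale c Tm) (lmul∈ Tps (lhorner∈ cs Tps Tm))

    -- The genericity demanded of `z`: no nonzero member of `T` has all its columns orthogonal to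
    -- the orbit `T z`.
    Faithful : (Mat X Y → Set) → (Y → ℚ) → Set
    Faithful T z = ∀ m → T m → (∀ a → T a → m ᵀ∙ a ∙ z ≗ᵥ 𝟎) → m ≗ₘ 𝟎ₘ

    module Comparison {T T′ : Mat X Y → Set} (tro : IsTernary T) (tro′ : IsTernary T′)
      (T⊆T′ : ∀ {m} → T m → T′ m) (z : Y → ℚ)
      (orbit : ∀ m′ → T′ m′ → ¬ ¬ Σ (Mat X Y) λ m → T m × m′ ∙ z ≗ᵥ m ∙ z)
      (annihilator : ∀ v → (∀ m → T m → m ∙ z ≗ᵥ 𝟎 → m ∙ v ≗ᵥ 𝟎) →
                           ∀ m′ → T′ m′ → m′ ∙ z ≗ᵥ 𝟎 → m′ ∙ v ≗ᵥ 𝟎)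
      (faithful : Faithful T′ z) where

      private
        module T  = IsTernary tro
        module T′ = IsTernary tro′

      module RightUnit (ss : List (Mat X Y)) (Tss : All T ss)
        (ss·z≡0 : ∀ {s} → s ∈ ss → s ∙ z ≗ᵥ 𝟎)
        (spans : ∀ v → (∀ {s} → s ∈ ss → s ∙ v ≗ᵥ 𝟎) → ∀ m → T m → m ∙ z ≗ᵥ 𝟎 → m ∙ v ≗ᵥ 𝟎) where

        cs = proj₁ (unit ss)

        e : (Y → ℚ) → Y → ℚ
        e v = gram ss (horner ss cs v)

        -- `S` commutes with its polynomials, so `e z = g(S) S z`, and `S z = 0`.
        e·z≡0 : e z ≗ᵥ 𝟎
        e·z≡0 y = trans (gram-horner ss cs z y) (horner-0 ss cs (gram-0 ss z ss·z≡0) y)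

        mulₑ : Mat X Y → Mat X Y
        mulₑ m = rhorner ss cs (rmul ss m)

        mulₑ-∙ : ∀ m v → mulₑ m ∙ v ≗ᵥ m ∙ e v
        mulₑ-∙ m v x = trans (rhorner-∙ ss cs (rmul ss m) v x) (rmul-∙ ss m (horner ss cs v) x)

        -- Right multiplication by q = 1 − e.
        mulq : Mat X Y → Mat X Y
        mulq m = m ⊟ mulₑ m

        mulq-∙ : ∀ m v → mulq m ∙ v ≗ᵥ m ∙ (v ⊖ e v)
        mulq-∙ m v x = trans (app-⊟ ys m (mulₑ m) v x) (trans
          (cong (λ p → (m ∙ v) x + (- 1ℚ) * p) (mulₑ-∙ m v x)) (sym (app-⊖ ys m v (e v) x)))

        mulq-z : ∀ m → mulq m ∙ z ≗ᵥ m ∙ z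
        mulq-z m x = trans (mulq-∙ m z x) (app-cong ys m (λ y → trans
          (cong (λ p → z y + (- 1ℚ) * p) (e·z≡0 y))
          (solve 1 (λ p → p :+ (:- con 1ℚ) :* con 0ℚ := p) refl (z y))) x)

        mulq∈T : ∀ {m} → T m → T (mulq m)
        mulq∈T Tm = T.sub Tm (T.rhorner∈ cs Tss (T.rmul∈ Tss Tm))

        -- If `m` in `T` agrees with `m′` at `z`, then `m′ − m` annihilates `z`. All of `ss`
        -- vanishes on the range of `q`, so by `annihilator` this difference does too, and
        -- `m′ q = m q`.
        mulq-T′ : ∀ {m′} → T′ m′ → T (mulq m′)
        mulq-T′ {m′} T′m′ = T.stable (orbit m′ T′m′ >>= λ (m , Tm , eqn) →
          return (T.ext (∙-injective (mulq m) (mulq m′) λ v x →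
            trans (mulq-∙ m v x) (trans (sym (same m Tm eqn v x)) (sym (mulq-∙ m′ v x)))) (mulq∈T Tm)))
          where
          same : ∀ m → T m → m′ ∙ z ≗ᵥ m ∙ z → ∀ v → m′ ∙ (v ⊖ e v) ≗ᵥ m ∙ (v ⊖ e v)
          same m Tm eqn v = ⊖≗𝟎⇒≗ _ _ λ x → trans (sym (app-⊟ ys m′ m (v ⊖ e v) x))
            (annihilator (v ⊖ e v) (spans (v ⊖ e v) (proj₂ (unit ss) v)) (m′ ⊟ m)
               (T′.sub T′m′ (T⊆T′ Tm)) (λ x → trans (app-⊟ ys m′ m z x) (≗⇒⊖≗𝟎 eqn x)) x)

        module LeftUnit (ps : List (Mat Y X))
          (ps⊆T′q : All (λ p → Σ (Mat X Y) λ m → T′ m × flip p ≗ₘ mulq m) ps)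
          (spansᵀ : ∀ w → (∀ {p} → p ∈ ps → app xs p w ≗ᵥ 𝟎) → ∀ m → T′ m → mulq m ᵀ∙ w ≗ᵥ 𝟎) where

          cs′ = proj₁ (ᵀ.unit ps)

          e′ : (X → ℚ) → X → ℚ
          e′ w = ᵀ.gram ps (ᵀ.horner ps cs′ w)

          Tps : All (T ∘ flip) ps
          Tps = All.map (λ (m , T′m , eqn) → T.ext (λ x y → sym (eqn x y)) (mulq-T′ T′m)) ps⊆T′q

          T′ps : All (T′ ∘ flip) ps
          T′ps = All.map T⊆T′ Tps

          e′mul : Mat X Y → Mat X Y
          e′mul m = lmul ps (lhorner ps cs′ m)

          e′mul-∙ : ∀ m v → e′mul m ∙ v ≗ᵥ e′ (m ∙ v)
          e′mul-∙ m v x = trans (lmul-∙ ps (lhorner ps cs′ m) v x) (ᵀ.gram-cong ps (lhorner-∙ ps cs′ m v) x)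

          e′mul-ᵀ∙ : ∀ m w → e′mul m ᵀ∙ w ≗ᵥ m ᵀ∙ e′ w
          e′mul-ᵀ∙ m w y = trans (lmul-ᵀ∙ ps (lhorner ps cs′ m) w y) (trans (lhorner-ᵀ∙ ps cs′ m (ᵀ.gram ps w) y)
            (app-cong xs (flip m) (λ x → sym (ᵀ.gram-horner ps cs′ w x)) y))

          e′-fixes-T′q : ∀ {m} → T′ m → mulq m ≗ₘ e′mul (mulq m)
          e′-fixes-T′q {m} T′m = ᵀ∙-injective _ _ λ w y → trans
            (⊖≗𝟎⇒≗ (mulq m ᵀ∙ w) (mulq m ᵀ∙ e′ w) (λ y → trans (sym (app-⊖ xs (flip (mulq m)) w (e′ w) y))
               (spansᵀ (w ⊖ e′ w) (λ p∈ → proj₂ (ᵀ.unit ps) w p∈) m T′m y)) y)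
            (sym (e′mul-ᵀ∙ (mulq m) w y))

          -- `m z = m q z` because `q z = z`, and `e′` fixes `m q`.
          e′-fixes-T′z : ∀ {m} → T′ m → m ∙ z ≗ᵥ e′ (m ∙ z)
          e′-fixes-T′z {m} T′m x = trans (sym (mulq-z m x)) (trans
            (app-congₘ ys z (e′-fixes-T′q T′m) x) (trans (e′mul-∙ (mulq m) z x)
            (ᵀ.gram-cong ps (ᵀ.horner-cong ps cs′ (mulq-z m)) x)))

          e′mul∈T′ : ∀ {m} → T′ m → T′ (e′mul m)
          e′mul∈T′ T′m = T′.lmul∈ T′ps (T′.lhorner∈ cs′ T′ps T′m)

          -- The columns of `m − e′ m` are orthogonal to every `a z`, because `e′` is symmetric and
          -- fixes `a z`; faithfulness makes the difference vanish.
          e′-fixes-T′ : ∀ {m} → T′ m → m ≗ₘ e′mul m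
          e′-fixes-T′ {m} T′m x = ⊖≗𝟎⇒≗ (m x) (e′mul m x) (faithful (m ⊟ e′mul m) (T′.sub T′m (e′mul∈T′ T′m))
            (λ a T′a y → trans (app-⊟ xs (flip m) (flip (e′mul m)) (a ∙ z) y)
               (≗⇒⊖≗𝟎 (λ y → trans (app-cong xs (flip m) (e′-fixes-T′z T′a) y) (sym (e′mul-ᵀ∙ m (a ∙ z) y))) y)) x)

          -- The summand `pᵀ p m sᵀ s′` regroups as `pᵀ tᵀ s′` with `t = s mᵀ pᵀ`. Since `pᵀ = a q`
          -- with `a` in `T′`, also `t = (s mᵀ a) q` lies in `T′q`, hence in `T`.
          lmul-tern : ∀ qs → All (λ p → Σ (Mat X Y) λ m → T′ m × flip p ≗ₘ mulq m) qs → All (T ∘ flip) qs →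
            ∀ {m s s′} → T′ m → T s → T s′ → T (tern (lmul qs m) s s′)
          lmul-tern [] [] [] {m} {s} {s′} T′m Ts Ts′ = T.ext
            (∙-injective _ _ λ v x → trans (app-𝟎ₘ ys v x) (sym (trans (tern-∙ 𝟎ₘ s s′ v x) (app-𝟎ₘ ys (s ᵀ∙ s′ ∙ v) x))))
            T.zero∈
          lmul-tern (p ∷ qs) ((a , T′a , eqn) ∷ qs⊆) (Tp ∷ Tqs) {m} {s} {s′} T′m Ts Ts′ = T.ext
            (∙-injective _ _ λ v x → trans (app-⊞ ys (tern (flip p) t s′) (tern (lmul qs m) s s′) v x) (trans
               (cong₂ _+_ (trans (tern-∙ (flip p) t s′ v x) (trans
                             (app-cong ys (flip p) (λ y → tern-ᵀ∙ s m (flip p) (s′ ∙ v) y) x)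
                             (sym (tern-∙ (flip p) (flip p) m (s ᵀ∙ s′ ∙ v) x))))
                          (tern-∙ (lmul qs m) s s′ v x))
               (sym (trans (tern-∙ (lmul (p ∷ qs) m) s s′ v x)
                           (app-⊞ ys (tern (flip p) (flip p) m) (lmul qs m) (s ᵀ∙ s′ ∙ v) x)))))
            (T.add (T.tern∈ Tp Tt Ts′) (lmul-tern qs qs⊆ Tqs T′m Ts Ts′))
            where
            t = tern s m (flip p)
            Tt : T t
            Tt = T.ext (∙-injective _ _ λ v x → trans (mulq-∙ (tern s m a) v x) (trans
                   (tern-∙ s m a (v ⊖ e v) x) (trans
                   (app-cong ys s (app-cong xs (flip m) (λ x → trans (sym (mulq-∙ a v x)) (sym (app-congₘ ys v eqn x)))) x)
                   (sym (tern-∙ s m (flip p) v x)))))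
                 (mulq-T′ (T′.tern∈ (T⊆T′ Ts) T′m T′a))

          T′TT⊆T : ∀ {m s s′} → T′ m → T s → T s′ → T (tern m s s′)
          T′TT⊆T {m} {s} {s′} T′m Ts Ts′ = T.ext
            (∙-injective _ _ λ v x → trans (tern-∙ (e′mul m) s s′ v x) (trans
               (sym (app-congₘ ys (s ᵀ∙ s′ ∙ v) (e′-fixes-T′ T′m) x)) (sym (tern-∙ m s s′ v x))))
            (lmul-tern ps ps⊆T′q Tps (T′.lhorner∈ cs′ T′ps T′m) Ts Ts′)

          -- In `m = m q + m e` the first term is covered by `mulq-T′`, and `m e` is a polynomial in
          -- `S` applied to the sum of the products `m sᵀ s`, which lie in `T′TᵀT`.
          T′⊆T : ∀ {m} → T′ m → T m
          T′⊆T {m} T′m = T.ext (λ x y → solve 2 (λ p q → (p :+ (:- con 1ℚ) :* q) :+ q := p) refl (m x y) (mulₑ m x y))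
              (T.add (mulq-T′ T′m) (T.rhorner∈ cs Tss (rmul-ss ss Tss)))
            where
            rmul-ss : ∀ rs → All T rs → T (rmul rs m)
            rmul-ss []       []         = T.zero∈
            rmul-ss (s ∷ rs) (Ts ∷ Trs) = T.add (T′TT⊆T T′m Ts Ts) (rmul-ss rs Trs)

      inclusion : ∀ {m} → T′ m → T m
      inclusion T′m = T.stable (
        finite-kernel (λ m → T m × m ∙ z ≗ᵥ 𝟎) >>= λ (ss , Kss , spans) →
        let module R = RightUnit ss (All.map proj₁ Kss) (λ s∈ → proj₂ (All.lookup Kss s∈))
                                 (λ v kills m Tm mz → spans v kills m (Tm , mz)) in
        ᵀ.finite-kernel (λ p → Σ (Mat X Y) λ m → T′ m × flip p ≗ₘ R.mulq m) >>= λ (ps , Kps , spansᵀ) →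
        let module L = R.LeftUnit ps Kps (λ w kills m T′m → spansᵀ w kills (flip (R.mulq m)) (m , T′m , λ _ _ → refl)) in
        return (L.T′⊆T T′m))

  -- Naturals as rationals, and generic perturbations

  ι : ℕ → ℚ
  ι zero    = 0ℚ
  ι (suc n) = 1ℚ + ι n

  ι≥0 : ∀ n → 0ℚ ℚ.≤ ι n
  ι≥0 zero    = ℚₚ.≤-refl
  ι≥0 (suc n) = subst (ℚ._≤ 1ℚ + ι n) (ℚₚ.+-identityˡ 0ℚ) (ℚₚ.+-mono-≤ (p*p≥0 1ℚ) (ι≥0 n))

  ι-suc≢0 : ∀ n → ι (suc n) ≢ 0ℚ
  ι-suc≢0 n eqn = contradiction (p+q≡0⇒p≡0 (p*p≥0 1ℚ) (ι≥0 n) eqn) λ ()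

  ι-injective : ∀ m n → ι m ≡ ι n → m ≡ n
  ι-injective zero    zero    eqn = refl
  ι-injective zero    (suc n) eqn = contradiction (sym eqn) (ι-suc≢0 n)
  ι-injective (suc m) zero    eqn = contradiction eqn (ι-suc≢0 m)
  ι-injective (suc m) (suc n) eqn = cong suc (ι-injective m n (trans (cancel₁ (ι m)) (trans (cong ((- 1ℚ) +_) eqn) (sym (cancel₁ (ι n))))))
    where
    cancel₁ : ∀ p → p ≡ (- 1ℚ) + (1ℚ + p)
    cancel₁ = solve 1 (λ p → p := (:- con 1ℚ) :+ (con 1ℚ :+ p)) refl

  lincomb-map-cong : {A : Set} {f g : A → I → ℚ} → ∀ c as → (∀ a → f a ≗ᵥ g a) →
                     lincomb c (map f as) ≗ᵥ lincomb c (map g as)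
  lincomb-map-cong c []       eqn i = refl
  lincomb-map-cong c (a ∷ as) eqn i = cong₂ _+_ (cong (c 0 *_) (eqn a i)) (lincomb-map-cong (c ∘ suc) as eqn i)

  -- Independence of the vectors p a is inherited by μ p a + q a for some μ = 1, 2, …: relations
  -- for distinct μ are eigenvectors for distinct eigenvalues, hence independent themselves.
  module Perturbation {A I : Set} (is : List I) (p q : A → I → ℚ) (as : List A)
                      (independent : Independent is (map p as)) where

    r = length as

    shifted : ℚ → A → I → ℚ
    shifted μ a = μ ⊛ p a ⊕ q a

    lincomb-shifted : ∀ c μ as i → lincomb c (map (shifted μ) as) i ≡
                      μ * lincomb c (map p as) i + lincomb c (map q as) i
    lincomb-shifted c μ []       i = solve 1 (λ μ → con 0ℚ := μ :* con 0ℚ :+ con 0ℚ) refl μ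
    lincomb-shifted c μ (a ∷ as) i = trans (cong (c 0 * shifted μ a i +_) (lincomb-shifted (c ∘ suc) μ as i))
      (solve 6 (λ c μ a b x y → c :* (μ :* a :+ b) :+ (μ :* x :+ y) := μ :* (c :* a :+ x) :+ (c :* b :+ y)) refl
         (c 0) μ (p a i) (q a i) (lincomb (c ∘ suc) (map p as) i) (lincomb (c ∘ suc) (map q as) i))

    Relation : ℚ × (ℕ → ℚ) → Set
    Relation (μ , c) = (∀ {i} → i ∈ is → lincomb c (map (shifted μ) as) i ≡ 0ℚ) × ∃ λ k → k ℕ.< r × c k ≢ 0ℚ

    scaled : List (ℚ × (ℕ → ℚ)) → List (ℕ → ℚ)
    scaled = map λ (μ , c) → μ ⊛ c

    relations : ∀ d ps → All Relation ps → ∀ {i} → i ∈ is →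
      lincomb (lincomb d (scaled ps)) (map p as) i + lincomb (lincomb d (map proj₂ ps)) (map q as) i ≡ 0ℚ
    relations d []             []         {i} i∈ = trans
      (cong₂ _+_ (lincomb-0 (map p as) i) (lincomb-0 (map q as) i)) (ℚₚ.+-identityˡ 0ℚ)
    relations d ((μ , c) ∷ ps) (rel ∷ rels) {i} i∈ = begin
      lincomb (d 0 ⊛ μ ⊛ c ⊕ D′) (map p as) i + lincomb (d 0 ⊛ c ⊕ D) (map q as) i
        ≡⟨ cong₂ _+_
            (trans (lincomb-⊕ (d 0 ⊛ μ ⊛ c) D′ (map p as) i)
                   (cong (_+ y) (trans (lincomb-⊛ (d 0) (μ ⊛ c) (map p as) i) (cong (d 0 *_) (lincomb-⊛ μ c (map p as) i)))))
            (trans (lincomb-⊕ (d 0 ⊛ c) D (map q as) i)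
                   (cong (_+ y′) (lincomb-⊛ (d 0) c (map q as) i))) ⟩
      (d 0 * (μ * x) + y) + (d 0 * x′ + y′)
        ≡⟨ solve 6 (λ d μ x x′ y y′ → (d :* (μ :* x) :+ y) :+ (d :* x′ :+ y′) := d :* (μ :* x :+ x′) :+ (y :+ y′)) refl
             (d 0) μ x x′ y y′ ⟩
      d 0 * (μ * x + x′) + (y + y′)
        ≡⟨ cong₂ (λ a b → d 0 * a + b) (trans (sym (lincomb-shifted c μ as i)) (proj₁ rel i∈)) (relations (d ∘ suc) ps rels i∈) ⟩
      d 0 * 0ℚ + 0ℚ
        ≡⟨ solve 1 (λ d → d :* con 0ℚ :+ con 0ℚ := con 0ℚ) refl (d 0) ⟩
      0ℚ ∎
      where
      open ≡-Reasoning
      D  = lincomb (d ∘ suc) (map proj₂ ps)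
      D′ = lincomb (d ∘ suc) (scaled ps)
      x  = lincomb c (map p as) i
      x′ = lincomb c (map q as) i
      y  = lincomb D′ (map p as) i
      y′ = lincomb D (map q as) i

    -- The factors `μ − ν` that the remaining weights acquire when the eigenvalue `ν` is eliminated.
    gap : ℚ → List (ℚ × (ℕ → ℚ)) → ℕ → ℚ
    gap ν []             j       = 0ℚ
    gap ν ((μ , _) ∷ ps) zero    = μ + (- 1ℚ) * ν
    gap ν (_ ∷ ps)       (suc j) = gap ν ps j

    lincomb-gap : ∀ ν d ps k → lincomb (λ j → d j * gap ν ps j) (map proj₂ ps) k ≡
                  lincomb d (scaled ps) k + (- 1ℚ) * (ν * lincomb d (map proj₂ ps) k)
    lincomb-gap ν d []             k = solve 1 (λ ν → con 0ℚ := con 0ℚ :+ (:- con 1ℚ) :* (ν :* con 0ℚ)) refl ν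
    lincomb-gap ν d ((μ , c) ∷ ps) k = trans
      (cong (d 0 * (μ + (- 1ℚ) * ν) * c k +_) (lincomb-gap ν (d ∘ suc) ps k))
      (solve 6 (λ d μ ν c x y → d :* (μ :+ (:- con 1ℚ) :* ν) :* c :+ (x :+ (:- con 1ℚ) :* (ν :* y))
                  := (d :* (μ :* c) :+ x) :+ (:- con 1ℚ) :* (ν :* (d :* c :+ y))) refl
         (d 0) μ ν (c k) (lincomb (d ∘ suc) (scaled ps) k) (lincomb (d ∘ suc) (map proj₂ ps) k))

    gap≢0 : ∀ ν ps → All (λ (μ , _) → μ ≢ ν) ps → ∀ {j} → j ℕ.< length (map proj₂ ps) → gap ν ps j ≢ 0ℚ
    gap≢0 ν ((μ , _) ∷ ps) (μ≢ν ∷ _)  {zero}  _        eqn = μ≢ν (⊖≗𝟎⇒≗ (λ (_ : ℕ) → μ) (λ _ → ν) (λ _ → eqn) 0)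
    gap≢0 ν (_ ∷ ps)       (_ ∷ μs≢ν) {suc j} (s≤s j<) eqn = gap≢0 ν ps μs≢ν j< eqn

    data Distinct : List (ℚ × (ℕ → ℚ)) → Set where
      []  : Distinct []
      _∷_ : ∀ {ν c ps} → All (λ (μ , _) → μ ≢ ν) ps → Distinct ps → Distinct ((ν , c) ∷ ps)

    -- If `D = Σ d c` is zero, the `q`-part of the combined relation vanishes, and independence of
    -- the `p a` gives `D′ = Σ d μ c = 0`. In `D′ − ν D` the head cancels and the other weights
    -- become `d (μ − ν)`, so the induction applies.
    eigenvectors : ∀ ps → All Relation ps → Distinct ps → Independent (upTo r) (map proj₂ ps)
    eigenvectors [] [] [] d zeros ()
    eigenvectors ((ν , c) ∷ ps) (rel ∷ rels) (μs≢ν ∷ distinct) d zeros = all0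
      where
      D  = lincomb d (map proj₂ ((ν , c) ∷ ps))
      D′ = lincomb d (scaled ((ν , c) ∷ ps))
      D≡0 : ∀ k → k ℕ.< r → D k ≡ 0ℚ
      D≡0 k k< = zeros (∈-upTo⁺ k<)
      D·q≡0 : ∀ i → lincomb D (map q as) i ≡ 0ℚ
      D·q≡0 i = trans (lincomb-cong (map q as) (λ k k< → D≡0 k (subst (k ℕ.<_) (Listₚ.length-map q as) k<)) i)
                      (lincomb-0 (map q as) i)
      D′≡0 : ∀ {k} → k ℕ.< r → D′ k ≡ 0ℚ
      D′≡0 {k} k< = independent D′ (λ {i} i∈ → trans (sym (ℚₚ.+-identityʳ _)) (trans
          (cong (lincomb D′ (map p as) i +_) (sym (D·q≡0 i))) (relations d ((ν , c) ∷ ps) (rel ∷ rels) i∈)))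
        (subst (k ℕ.<_) (sym (Listₚ.length-map p as)) k<)
      tail-zeros : ∀ {k} → k ∈ upTo r → lincomb (λ j → d (suc j) * gap ν ps j) (map proj₂ ps) k ≡ 0ℚ
      tail-zeros {k} k∈ = begin
        lincomb (λ j → d (suc j) * gap ν ps j) (map proj₂ ps) k
          ≡⟨ lincomb-gap ν (d ∘ suc) ps k ⟩
        x + (- 1ℚ) * (ν * y)
          ≡⟨ solve 5 (λ d ν c x y → x :+ (:- con 1ℚ) :* (ν :* y)
               := (d :* (ν :* c) :+ x) :+ (:- con 1ℚ) :* (ν :* (d :* c :+ y))) refl (d 0) ν (c k) x y ⟩
        D′ k + (- 1ℚ) * (ν * D k)
          ≡⟨ cong₂ (λ a b → a + (- 1ℚ) * (ν * b)) (D′≡0 (∈-upTo⁻ k∈)) (D≡0 k (∈-upTo⁻ k∈)) ⟩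
        0ℚ + (- 1ℚ) * (ν * 0ℚ)
          ≡⟨ solve 1 (λ ν → con 0ℚ :+ (:- con 1ℚ) :* (ν :* con 0ℚ) := con 0ℚ) refl ν ⟩
        0ℚ ∎
        where open ≡-Reasoning
              x = lincomb (d ∘ suc) (scaled ps) k
              y = lincomb (d ∘ suc) (map proj₂ ps) k
      tail0 : ∀ {j} → j ℕ.< length (map proj₂ ps) → d (suc j) ≡ 0ℚ
      tail0 {j} j< = p*q≡0⇒q≡0 (gap≢0 ν ps μs≢ν j<) (trans (ℚₚ.*-comm (gap ν ps j) (d (suc j)))
        (eigenvectors ps rels distinct (λ j → d (suc j) * gap ν ps j) tail-zeros j<))
      k₀ = proj₁ (proj₂ rel)
      head0 : d 0 ≡ 0ℚ
      head0 = p*q≡0⇒q≡0 (proj₂ (proj₂ (proj₂ rel))) (trans (ℚₚ.*-comm (c k₀) (d 0)) (trans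
        (sym (ℚₚ.+-identityʳ _)) (trans
        (cong (d 0 * c k₀ +_) (sym (trans (lincomb-cong (map proj₂ ps) (λ j j< → tail0 j<) k₀) (lincomb-0 (map proj₂ ps) k₀))))
        (D≡0 k₀ (proj₁ (proj₂ (proj₂ rel)))))))
      all0 : ∀ {j} → j ℕ.< suc (length (map proj₂ ps)) → d j ≡ 0ℚ
      all0 {zero}  _        = head0
      all0 {suc j} (s≤s j<) = tail0 j<

    perturb : ¬ ¬ Σ ℕ λ n → Independent is (map (shifted (ι (suc n))) as)
    -- `suc r` failing values of `μ` would give `suc r` independent coefficient vectors on `r`
    -- coordinates.
    perturb none = collect (suc r) λ (ps , len , rels , distinct , _) →
        ℕₚ.<-irrefl refl (subst₂ ℕ._≤_ (trans (Listₚ.length-map proj₂ ps) len) (Listₚ.length-upTo r)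
          (independent-length (map proj₂ ps) (eigenvectors ps rels distinct)))
      where
      relation : ∀ n → ¬ ¬ Σ (ℕ → ℚ) λ c → Relation (ι (suc n) , c)
      relation n no-relation = none (n , λ c zeros {k} k< → ≟-stable λ ck≢0 →
        no-relation (c , zeros , k , subst (k ℕ.<_) (Listₚ.length-map _ as) k< , ck≢0))
      collect : ∀ s → ¬ ¬ Σ (List (ℚ × (ℕ → ℚ))) λ ps → length ps ≡ s × All Relation ps × Distinct ps ×
                All (λ (μ , _) → ∃ λ n → n ℕ.< s × μ ≡ ι (suc n)) ps
      collect zero    = return ([] , refl , [] , [] , [])
      collect (suc s) = collect s >>= λ (ps , len , rels , distinct , below) → relation s >>= λ (c , rel) →
        return ((ι (suc s) , c) ∷ ps , cong suc len , rel ∷ rels ,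
          All.map (λ { (n , n<s , refl) eqn → ℕₚ.<-irrefl (ℕₚ.suc-injective (ι-injective _ _ eqn)) n<s }) below ∷ distinct ,
          (s , ℕₚ.≤-refl , refl) ∷ All.map (λ (n , n<s , eqn) → n , ℕₚ.m<n⇒m<1+n n<s , eqn) below)

  δ : ℕ → ℕ → ℚ
  δ i j with i ℕ.≟ j
  ... | yes _ = 1ℚ
  ... | no  _ = 0ℚ

  -- The length of a chain of ternary rings

  module TernaryChain {X Y : Set} {xs : List X} {ys : List Y}
                      (coverˣ : ∀ x → x ∈ xs) (coverʸ : ∀ y → y ∈ ys) where

    open Operators coverˣ coverʸ
    open Ternary coverˣ coverʸ

    module _ (T : ℕ → Mat X Y → Set) (tro : ∀ i → IsTernary (T i)) where

      private module T i = IsTernary (tro i)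

      -- The vector `m z` placed in the `i`-th copy of `X`. Independence of such vectors measures
      -- all orbits `T i z` together, so that one `z` can be improved for every member of the chain.
      orbit-vector : (Y → ℚ) → ℕ × Mat X Y → ℕ × X → ℚ
      orbit-vector z (i , m) (j , x) = δ i j * (m ∙ z) x

      orbit-vector-shift : ∀ μ z v a → orbit-vector (μ ⊛ z ⊕ v) a ≗ᵥ μ ⊛ orbit-vector z a ⊕ orbit-vector v a
      orbit-vector-shift μ z v (i , m) (j , x) = trans
        (cong (δ i j *_) (trans (app-⊕ ys m (μ ⊛ z) v x) (cong (_+ (m ∙ v) x) (app-⊛ ys m μ z x))))
        (solve 4 (λ d μ a b → d :* (μ :* a :+ b) := μ :* (d :* a) :+ d :* b) refl (δ i j) μ ((m ∙ z) x) ((m ∙ v) x))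

      part : ℕ → (ℕ → ℚ) → List (ℕ × Mat X Y) → Mat X Y
      part i c []             = 𝟎ₘ
      part i c ((j , a) ∷ as) with j ℕ.≟ i
      ... | yes _ = c 0 ⊠ a ⊞ part i (c ∘ suc) as
      ... | no  _ = part i (c ∘ suc) as

      -- The coefficients used by `part i`, with zeros elsewhere: a relation inside the `i`-th copy
      -- becomes one for the whole list.
      restrict : ℕ → (ℕ → ℚ) → List (ℕ × Mat X Y) → ℕ → ℚ
      restrict i c []             k       = 0ℚ
      restrict i c ((j , a) ∷ as) (suc k) = restrict i (c ∘ suc) as k
      restrict i c ((j , a) ∷ as) zero with j ℕ.≟ i
      ... | yes _ = c 0
      ... | no  _ = 0ℚ

      part∈ : ∀ i c as → All (λ (j , a) → T j a) as → T i (part i c as)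
      part∈ i c []             []        = T.zero∈ i
      part∈ i c ((j , a) ∷ as) (Ta ∷ Tas) with j ℕ.≟ i
      ... | yes refl = T.add i (T.scale i (c 0) Ta) (part∈ i (c ∘ suc) as Tas)
      ... | no  _    = part∈ i (c ∘ suc) as Tas

      part-∙ : ∀ i c as w x → (part i c as ∙ w) x ≡ lincomb c (map (orbit-vector w) as) (i , x)
      part-∙ i c []             w x = app-𝟎ₘ ys w x
      part-∙ i c ((j , a) ∷ as) w x with j ℕ.≟ i
      ... | yes refl = trans (app-⊞ ys (c 0 ⊠ a) (part i (c ∘ suc) as) w x)
              (cong₂ _+_ (trans (app-⊠ ys (c 0) a w x) (cong (c 0 *_) (sym (ℚₚ.*-identityˡ _)))) (part-∙ i (c ∘ suc) as w x))
      ... | no _ = trans (part-∙ i (c ∘ suc) as w x) (solve 3 (λ c a p → p := c :* (con 0ℚ :* a) :+ p) refl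
              (c 0) ((a ∙ w) x) (lincomb (c ∘ suc) (map (orbit-vector w) as) (i , x)))

      restrict-lincomb : ∀ i c as w j x →
        lincomb (restrict i c as) (map (orbit-vector w) as) (j , x) ≡ δ i j * (part i c as ∙ w) x
      restrict-lincomb i c [] w j x = sym (trans (cong (δ i j *_) (app-𝟎ₘ ys w x)) (ℚₚ.*-zeroʳ (δ i j)))
      restrict-lincomb i c ((k , a) ∷ as) w j x with k ℕ.≟ i
      ... | yes refl = trans (cong (c 0 * (δ i j * (a ∙ w) x) +_) (restrict-lincomb i (c ∘ suc) as w j x)) (trans
              (solve 4 (λ c d a p → c :* (d :* a) :+ d :* p := d :* (c :* a :+ p)) refl
                 (c 0) (δ i j) ((a ∙ w) x) ((part i (c ∘ suc) as ∙ w) x))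
              (cong (δ i j *_) (sym (trans (app-⊞ ys (c 0 ⊠ a) (part i (c ∘ suc) as) w x)
                                           (cong (_+ (part i (c ∘ suc) as ∙ w) x) (app-⊠ ys (c 0) a w x))))))
      ... | no _ = trans (cong (0ℚ * (δ k j * (a ∙ w) x) +_) (restrict-lincomb i (c ∘ suc) as w j x))
              (solve 2 (λ a p → con 0ℚ :* a :+ p := p) refl (δ k j * (a ∙ w) x) (δ i j * (part i (c ∘ suc) as ∙ w) x))

      -- If m witnesses that z is not faithful for T i, then v = mᵀ m r (r a row of m) is such that the
      -- orbits of z and v are orthogonal, so (i , m) can be added to the list at a generic μ z + v.
      module Enlarge (L : ℕ) (z : Y → ℚ) (as : List (ℕ × Mat X Y))
        (independent : Independent (cartesianProduct (upTo L) xs) (map (orbit-vector z) as))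
        (Tas : All (λ (j , a) → T j a) as)
        (i : ℕ) (i<L : i ℕ.< L) (m : Mat X Y) (Tm : T i m) (unfaithful : ∀ a → T i a → m ᵀ∙ a ∙ z ≗ᵥ 𝟎)
        (x₀ : X) (y₀ : Y) (m≢0 : m x₀ y₀ ≢ 0ℚ) where

        is = cartesianProduct (upTo L) xs

        u : X → ℚ
        u = m ∙ m x₀

        v : Y → ℚ
        v = m ᵀ∙ u

        -- Otherwise `⟨v, v⟩ = ⟨u, m v⟩ = 0`, so `mᵀ m` kills the row `m x₀`, hence `m` does, and
        -- this row is orthogonal to itself.
        mv≢0 : ¬ m ∙ v ≗ᵥ 𝟎
        mv≢0 mv≡0 = m≢0 (dot-definite ys (m x₀) (u≡0 x₀) (coverʸ y₀))
          where
          v≡0 : v ≗ᵥ 𝟎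
          v≡0 y = dot-definite ys v (trans (adjointᵀ m u v) (dot-0ʳ xs u mv≡0)) (coverʸ y)
          u≡0 : u ≗ᵥ 𝟎
          u≡0 = ∙-definite m (m x₀) v≡0

        mz≡0 : m ∙ z ≗ᵥ 𝟎
        mz≡0 = ∙-definite m z (unfaithful m Tm)

        -- The inner product equals `⟨m a′ᵀ a z, u⟩`. As `m a′ᵀ a` is again in `T i`, unfaithfulness
        -- gives `mᵀ m a′ᵀ a z = 0`, hence `m a′ᵀ a z = 0`.
        orthogonal : ∀ {a a′} → T i a → T i a′ → dot xs (a ∙ z) (a′ ∙ v) ≡ 0ℚ
        orthogonal {a} {a′} Ta Ta′ = begin
          dot xs (a ∙ z) (a′ ∙ m ᵀ∙ u)            ≡⟨ adjointᵀ a′ (a ∙ z) (m ᵀ∙ u) ⟨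
          dot ys (a′ ᵀ∙ a ∙ z) (m ᵀ∙ u)           ≡⟨ adjoint xs ys m (a′ ᵀ∙ a ∙ z) u ⟨
          dot xs (m ∙ a′ ᵀ∙ a ∙ z) u              ≡⟨ dot-0ˡ xs u (∙-definite m (a′ ᵀ∙ a ∙ z) (λ y →
              trans (sym (app-cong xs (flip m) (tern-∙ m a′ a z) y)) (unfaithful (tern m a′ a) (T.tern∈ i Tm Ta′ Ta) y))) ⟩
          0ℚ ∎
          where open ≡-Reasoning

        module _ (n : ℕ) where

          μ = ι (suc n)
          z′ = μ ⊛ z ⊕ v

          mz′≡mv : m ∙ z′ ≗ᵥ m ∙ v
          mz′≡mv x = trans (app-⊕ ys m (μ ⊛ z) v x) (trans (cong (_+ (m ∙ v) x)
            (trans (app-⊛ ys m μ z x) (trans (cong (μ *_) (mz≡0 x)) (ℚₚ.*-zeroʳ μ)))) (ℚₚ.+-identityˡ _))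

          -- In copy `i` a relation reads `c₀ m v + μ A z + A v = 0`, where `A` is the part of the
          -- combination in `T i`. Pairing with `A z` leaves `μ ⟨A z, A z⟩ = 0`. Independence at `z`
          -- then makes the coefficients in `A` zero, so `A v = 0` and `c₀ = 0`, and a relation
          -- between the shifted vectors remains.
          enlarged : Independent is (map (λ a → μ ⊛ orbit-vector z a ⊕ orbit-vector v a) as) →
                     Independent is (map (orbit-vector z′) ((i , m) ∷ as))
          enlarged shifted-independent c zeros = all0
            where
            c′ = c ∘ suc
            A = part i c′ as
            TA = part∈ i c′ as Tas
            δii : δ i i ≡ 1ℚ
            δii with i ℕ.≟ i
            ... | yes _ = refl
            ... | no i≢i = contradiction refl i≢i
            vanishes : ∀ x → c 0 * (m ∙ v) x + (μ * (A ∙ z) x + (A ∙ v) x) ≡ 0ℚ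
            vanishes x = trans (cong₂ _+_
                (cong (c 0 *_) (trans (sym (mz′≡mv x)) (trans (sym (ℚₚ.*-identityˡ _)) (cong (_* (m ∙ z′) x) (sym δii)))))
                (trans (sym (trans (app-⊕ ys A (μ ⊛ z) v x) (cong (_+ (A ∙ v) x) (app-⊛ ys A μ z x))))
                       (part-∙ i c′ as z′ x)))
              (zeros (∈-cartesianProduct⁺ (∈-upTo⁺ i<L) (coverˣ x)))
            Az≡0 : A ∙ z ≗ᵥ 𝟎
            Az≡0 x = dot-definite xs (A ∙ z) (p*q≡0⇒q≡0 (ι-suc≢0 n) (begin
              μ * dot xs (A ∙ z) (A ∙ z)
                ≡⟨ solve 2 (λ c p → p := c :* con 0ℚ :+ (p :+ con 0ℚ)) refl (c 0) _ ⟩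
              c 0 * 0ℚ + (μ * dot xs (A ∙ z) (A ∙ z) + 0ℚ)
                ≡⟨ cong₂ (λ p q → c 0 * p + (μ * dot xs (A ∙ z) (A ∙ z) + q)) (orthogonal TA Tm) (orthogonal TA TA) ⟨
              c 0 * dot xs (A ∙ z) (m ∙ v) + (μ * dot xs (A ∙ z) (A ∙ z) + dot xs (A ∙ z) (A ∙ v))
                ≡⟨ cong₂ _+_ (dot-⊛ʳ xs (c 0) (A ∙ z) (m ∙ v)) (trans (dot-⊕ʳ xs (A ∙ z) (μ ⊛ A ∙ z) (A ∙ v))
                     (cong (_+ dot xs (A ∙ z) (A ∙ v)) (dot-⊛ʳ xs μ (A ∙ z) (A ∙ z)))) ⟨
              dot xs (A ∙ z) (c 0 ⊛ m ∙ v) + dot xs (A ∙ z) (μ ⊛ A ∙ z ⊕ A ∙ v)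
                ≡⟨ dot-⊕ʳ xs (A ∙ z) (c 0 ⊛ m ∙ v) (μ ⊛ A ∙ z ⊕ A ∙ v) ⟨
              dot xs (A ∙ z) (c 0 ⊛ m ∙ v ⊕ (μ ⊛ A ∙ z ⊕ A ∙ v))
                ≡⟨ dot-0ʳ xs (A ∙ z) vanishes ⟩
              0ℚ ∎)) (coverˣ x)
              where open ≡-Reasoning
            restricted≡0 : ∀ {k} → k ℕ.< length as → restrict i c′ as k ≡ 0ℚ
            restricted≡0 {k} k< = independent (restrict i c′ as) (λ { {j , x} _ → trans (restrict-lincomb i c′ as z j x)
                (trans (cong (δ i j *_) (Az≡0 x)) (ℚₚ.*-zeroʳ (δ i j))) })
              (subst (k ℕ.<_) (sym (Listₚ.length-map _ as)) k<)
            Av≡0 : A ∙ v ≗ᵥ 𝟎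
            Av≡0 x = begin
              (A ∙ v) x           ≡⟨ ℚₚ.*-identityˡ _ ⟨
              1ℚ * (A ∙ v) x      ≡⟨ cong (_* (A ∙ v) x) δii ⟨
              δ i i * (A ∙ v) x   ≡⟨ restrict-lincomb i c′ as v i x ⟨
              lincomb (restrict i c′ as) (map (orbit-vector v) as) (i , x)
                ≡⟨ lincomb-cong (map (orbit-vector v) as) (λ k k< → restricted≡0 (subst (k ℕ.<_) (Listₚ.length-map _ as) k<)) (i , x) ⟩
              lincomb (λ _ → 0ℚ) (map (orbit-vector v) as) (i , x) ≡⟨ lincomb-0 (map (orbit-vector v) as) (i , x) ⟩
              0ℚ ∎
              where open ≡-Reasoning
            c0·mv≡0 : ∀ x → c 0 * (m ∙ v) x ≡ 0ℚ
            c0·mv≡0 x = trans (solve 2 (λ p μ → p := p :+ (μ :* con 0ℚ :+ con 0ℚ)) refl (c 0 * (m ∙ v) x) μ)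
              (trans (cong₂ (λ p q → c 0 * (m ∙ v) x + (μ * p + q)) (sym (Az≡0 x)) (sym (Av≡0 x))) (vanishes x))
            c0≡0 : c 0 ≡ 0ℚ
            c0≡0 = ≟-stable λ c0≢0 → mv≢0 λ x → p*q≡0⇒q≡0 c0≢0 (c0·mv≡0 x)
            tail : ∀ {b} → b ∈ is → lincomb c′ (map (λ a → μ ⊛ orbit-vector z a ⊕ orbit-vector v a) as) b ≡ 0ℚ
            tail {b} b∈ = begin
              lincomb c′ (map (λ a → μ ⊛ orbit-vector z a ⊕ orbit-vector v a) as) b
                ≡⟨ lincomb-map-cong c′ as (orbit-vector-shift μ z v) b ⟨
              lincomb c′ (map (orbit-vector z′) as) b
                ≡⟨ solve 2 (λ a p → p := con 0ℚ :* a :+ p) refl (orbit-vector z′ (i , m) b) _ ⟩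
              0ℚ * orbit-vector z′ (i , m) b + lincomb c′ (map (orbit-vector z′) as) b
                ≡⟨ cong (λ p → p * orbit-vector z′ (i , m) b + lincomb c′ (map (orbit-vector z′) as) b) c0≡0 ⟨
              c 0 * orbit-vector z′ (i , m) b + lincomb c′ (map (orbit-vector z′) as) b
                ≡⟨ zeros b∈ ⟩
              0ℚ ∎
              where open ≡-Reasoning
            all0 : ∀ {k} → k ℕ.< suc (length (map (orbit-vector z′) as)) → c k ≡ 0ℚ
            all0 {zero}  _        = c0≡0
            all0 {suc k} (s≤s k<) = shifted-independent c′ tail
              (subst (k ℕ.<_) (trans (Listₚ.length-map _ as) (sym (Listₚ.length-map _ as))) k<)

        enlarge : ¬ ¬ Σ (Y → ℚ) λ z′ → Independent is (map (orbit-vector z′) ((i , m) ∷ as))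
        enlarge = Perturbation.perturb is (orbit-vector z) (orbit-vector v) as independent >>= λ (n , ind) →
          return (z′ n , enlarged n ind)

      -- Each failure of faithfulness prolongs an independent list of orbit vectors, and restricting
      -- to `i < L` bounds its length by `L` times that of `xs`.
      faithful-vector : ∀ L → ¬ ¬ Σ (Y → ℚ) λ z → ∀ i → i ℕ.< L → Faithful (T i) z
      faithful-vector L none = grow (suc (length is)) λ (z , as , len , ind , _) →
          ℕₚ.<-irrefl refl (subst (ℕ._≤ length is) (trans (Listₚ.length-map _ as) len)
            (independent-length (map (orbit-vector z) as) ind))
        where
        is = cartesianProduct (upTo L) xs
        grow : ∀ s → ¬ ¬ Σ (Y → ℚ) λ z → Σ (List (ℕ × Mat X Y)) λ as →
               length as ≡ s × Independent is (map (orbit-vector z) as) × All (λ (j , a) → T j a) as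
        grow zero    = return (𝟎 , [] , refl , (λ _ _ ()) , [])
        grow (suc s) = grow s >>= λ (z , as , len , ind , Tas) stuck →
          none (z , λ i i<L m Tm unfaithful x y → ≟-stable λ m≢0 →
            Enlarge.enlarge L z as ind Tas i i<L m Tm unfaithful x y m≢0 λ (z′ , ind′) →
              stuck (z′ , (i , m) ∷ as , cong suc len , ind′ , Tm ∷ Tas))

      -- With z faithful for the members of the chain, the space T i · z ⊕ (annihilator of z in T i, as rows)
      -- grows with i, and T i cannot grow without it.
      ternary-chain-stops : (∀ i {m} → T i m → T (suc i) m) →
        ¬ ¬ Σ ℕ λ i → i ℕ.≤ length xs ℕ.+ length ys × (∀ {m} → T (suc i) m → T i m)
      -- Comparing `T i` with `T (suc i)` asks for faithfulness at `suc i`, which may exceed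
      -- `length xs + length ys` by one; hence two `suc`.
      ternary-chain-stops mono = faithful-vector (suc (suc (length xs ℕ.+ length ys))) >>= λ (z , faithful) →
          chain-stops {is = map inj₁ xs ++ map inj₂ ys} cover (P z) (sub z) (P-mono z) >>= λ (i , i≤′ , stop) →
          let i≤ = subst (i ℕ.≤_) size i≤′ in
          return (i , i≤ , λ {m} T′m → Comparison.inclusion (tro i) (tro (suc i)) (mono i) z
            (λ m′ T′m′ → stop [ m′ ∙ z , 𝟎 ]′ (return (m′ , T′m′ , λ _ → refl) , λ v _ → dot-0ˡ ys v (λ _ → refl)) >>= λ Pi →
               proj₁ Pi)
            -- The row vector `m′ᵀ m′ v` belongs to stage `suc i`, hence to stage `i`; pairing it
            -- with `v` gives `⟨m′ v, m′ v⟩ = 0`.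
            (λ v ann m′ T′m′ m′z≡0 x → ≟-stable (stop [ 𝟎 , m′ ᵀ∙ m′ ∙ v ]′
                 ( return (𝟎ₘ , T.zero∈ (suc i) , λ x → sym (app-𝟎ₘ ys z x))
                 , λ w ann′ → trans (adjointᵀ m′ (m′ ∙ v) w) (dot-0ʳ xs (m′ ∙ v) (ann′ m′ T′m′ m′z≡0))) >>= λ Pi →
               return (dot-definite xs (m′ ∙ v) (trans (sym (adjointᵀ m′ (m′ ∙ v) v)) (proj₂ Pi v ann)) (coverˣ x))))
            (faithful (suc i) (s≤s (s≤s i≤))) T′m)
        where
        size : length (map {B = X ⊎ Y} inj₁ xs ++ map inj₂ ys) ≡ length xs ℕ.+ length ys
        size = trans (Listₚ.length-++ (map inj₁ xs)) (cong₂ ℕ._+_ (Listₚ.length-map inj₁ xs) (Listₚ.length-map inj₂ ys))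
        cover : ∀ k → k ∈ map inj₁ xs ++ map inj₂ ys
        cover (inj₁ x) = ∈-++⁺ˡ (∈-map⁺ inj₁ (coverˣ x))
        cover (inj₂ y) = ∈-++⁺ʳ (map inj₁ xs) (∈-map⁺ inj₂ (coverʸ y))
        Annihilated : (Y → ℚ) → ℕ → (Y → ℚ) → Set
        Annihilated z i v = ∀ m → T i m → m ∙ z ≗ᵥ 𝟎 → m ∙ v ≗ᵥ 𝟎
        -- `Annihilated` shrinks along the chain, so its orthogonal complement is taken: together
        -- with the orbit it forms a single growing chain of subspaces.
        P : (Y → ℚ) → ℕ → (X ⊎ Y → ℚ) → Set
        P z i f = (¬ ¬ Σ (Mat X Y) λ m → T i m × f ∘ inj₁ ≗ᵥ m ∙ z)
                × (∀ v → Annihilated z i v → dot ys (f ∘ inj₂) v ≡ 0ℚ)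
        P-mono : ∀ z i {f} → P z i f → P z (suc i) f
        P-mono z i (orbit , rows) =
          (orbit >>= λ (m , Tm , eqn) → return (m , mono i Tm , eqn)) ,
          λ v ann → rows v λ m Tm → ann m (mono i Tm)
        sub : ∀ z i → Subspace (P z i)
        sub z i = record
          { ext   = λ eqn (orbit , rows) →
              (orbit >>= λ (m , Tm , eqn′) → return (m , Tm , λ x → trans (sym (eqn (inj₁ x))) (eqn′ x))) ,
              λ v ann → trans (dot-cong ys {v = v} (λ y → sym (eqn (inj₂ y))) (λ _ → refl)) (rows v ann)
          ; zero∈ = return (𝟎ₘ , T.zero∈ i , λ x → sym (app-𝟎ₘ ys z x)) , λ v _ → dot-0ˡ ys v (λ _ → refl)
          ; add   = λ {f} {g} (orbit , rows) (orbit′ , rows′) →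
              (orbit >>= λ (m , Tm , eqn) → orbit′ >>= λ (m′ , Tm′ , eqn′) →
                 return (m ⊞ m′ , T.add i Tm Tm′ , λ x → trans (cong₂ _+_ (eqn x) (eqn′ x)) (sym (app-⊞ ys m m′ z x)))) ,
              λ v ann → trans (dot-⊕ˡ ys (f ∘ inj₂) (g ∘ inj₂) v)
                              (trans (cong₂ _+_ (rows v ann) (rows′ v ann)) (ℚₚ.+-identityˡ 0ℚ))
          ; scale = λ c {f} (orbit , rows) →
              (orbit >>= λ (m , Tm , eqn) →
                 return (c ⊠ m , T.scale i c Tm , λ x → trans (cong (c *_) (eqn x)) (sym (app-⊠ ys c m z x)))) ,
              λ v ann → trans (dot-⊛ˡ ys c (f ∘ inj₂) v) (trans (cong (c *_) (rows v ann)) (ℚₚ.*-zeroʳ c))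
          }

  -- The ternary ring generated by a space of matrices

  length-cartesianProductWith : {A B C : Set} (f : A → B → C) (as : List A) (bs : List B) →
    length (cartesianProductWith f as bs) ≡ length as ℕ.* length bs
  length-cartesianProductWith f []       bs = refl
  length-cartesianProductWith f (a ∷ as) bs = trans (Listₚ.length-++ (map (f a) bs))
    (cong₂ ℕ._+_ (Listₚ.length-map (f a) bs) (length-cartesianProductWith f as bs))

  record IsMatrixSpace (V : Mat X Y → Set) : Set where
    field
      ext    : ∀ {m m′} → m ≗ₘ m′ → V m → V m′
      zero∈  : V 𝟎ₘ
      add    : ∀ {m m′} → V m → V m′ → V (m ⊞ m′)
      scale  : ∀ c {m} → V m → V (c ⊠ m)
      stable : ∀ {m} → ¬ ¬ V m → V m

  module Generation {X Y : Set} {xs : List X} {ys : List Y}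
                    (coverˣ : ∀ x → x ∈ xs) (coverʸ : ∀ y → y ∈ ys) where

    open Operators coverˣ coverʸ
    open Ternary coverˣ coverʸ

    tern-cong : ∀ {a a′ b b′ c c′} → a ≗ₘ a′ → b ≗ₘ b′ → c ≗ₘ c′ → tern a b c ≗ₘ tern a′ b′ c′
    tern-cong {a} {a′} {b} {b′} {c} {c′} p q r x y = trans (app-congₘ ys (b ᵀ∙ flip c y) p x)
      (app-cong ys a′ (λ y′ → trans (app-congₘ xs (flip c y) (flip q) y′) (app-cong xs (flip b′) (λ x′ → r x′ y) y′)) x)

    tern-⊞₁ : ∀ a a′ b c → tern (a ⊞ a′) b c ≗ₘ tern a b c ⊞ tern a′ b c
    tern-⊞₁ a a′ b c x y = app-⊞ ys a a′ (b ᵀ∙ flip c y) x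

    tern-⊞₂ : ∀ a b b′ c → tern a (b ⊞ b′) c ≗ₘ tern a b c ⊞ tern a b′ c
    tern-⊞₂ a b b′ c x y = trans (app-cong ys a (app-⊞ xs (flip b) (flip b′) (flip c y)) x)
      (app-⊕ ys a (b ᵀ∙ flip c y) (b′ ᵀ∙ flip c y) x)

    tern-⊞₃ : ∀ a b c c′ → tern a b (c ⊞ c′) ≗ₘ tern a b c ⊞ tern a b c′
    tern-⊞₃ a b c c′ x y = trans (app-cong ys a (app-⊕ xs (flip b) (flip c y) (flip c′ y)) x)
      (app-⊕ ys a (b ᵀ∙ flip c y) (b ᵀ∙ flip c′ y) x)

    tern-⊠₃ : ∀ d a b c → tern a b (d ⊠ c) ≗ₘ d ⊠ tern a b c
    tern-⊠₃ d a b c x y = trans (app-cong ys a (app-⊛ xs (flip b) d (flip c y)) x) (app-⊛ ys a d (b ᵀ∙ flip c y) x)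

    tern-assocˡ : ∀ a b c d e → tern (tern a b c) d e ≗ₘ tern a b (tern c d e)
    tern-assocˡ a b c d e x y = tern-∙ a b c (d ᵀ∙ flip e y) x

    tern-assocᵐ : ∀ a b c d e → tern a (tern b c d) e ≗ₘ tern a d (tern c b e)
    tern-assocᵐ a b c d e x y = app-cong ys a (tern-ᵀ∙ b c d (flip e y)) x

    module _ (V : Mat X Y → Set) (space : IsMatrixSpace V) where

      private module V = IsMatrixSpace space

      -- Sums of products a₀ b₁ᵀ a₁ b₂ᵀ a₂ … bₗᵀ aₗ with l ≤ k.
      data Word : ℕ → Mat X Y → Set where
        base : ∀ {k m} → V m → Word k m
        step : ∀ {k a b w} → V a → V b → Word k w → Word (suc k) (tern a b w)
        plus : ∀ {k m m′} → Word k m → Word k m′ → Word k (m ⊞ m′)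
        conv : ∀ {k m m′} → m ≗ₘ m′ → Word k m → Word k m′

      word-mono : ∀ {k l m} → k ℕ.≤ l → Word k m → Word l m
      word-mono k≤l       (base Vm)     = base Vm
      word-mono (s≤s k≤l) (step Va Vb w) = step Va Vb (word-mono k≤l w)
      word-mono k≤l       (plus w w′)   = plus (word-mono k≤l w) (word-mono k≤l w′)
      word-mono k≤l       (conv eqn w)   = conv eqn (word-mono k≤l w)

      word-scale : ∀ {k m} c → Word k m → Word k (c ⊠ m)
      word-scale c (base Vm)                 = base (V.scale c Vm)
      word-scale c (step {a = a} {b} {w} Va Vb Ww) = conv (tern-⊠₃ c a b w) (step Va Vb (word-scale c Ww))
      word-scale c (plus {m = m} {m′} w w′)  =
        conv (λ x y → sym (ℚₚ.*-distribˡ-+ c (m x y) (m′ x y))) (plus (word-scale c w) (word-scale c w′))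
      word-scale c (conv eqn w)               = conv (λ x y → cong (c *_) (eqn x y)) (word-scale c w)

      Gen : Mat X Y → Set
      Gen m = ∃ λ k → Word k m

      gen-plus : ∀ {m m′} → Gen m → Gen m′ → Gen (m ⊞ m′)
      gen-plus (k , w) (l , w′) = k ℕ.+ l , plus (word-mono (ℕₚ.m≤m+n k l) w) (word-mono (ℕₚ.m≤n+m l k) w′)

      gen-conv : ∀ {m m′} → m ≗ₘ m′ → Gen m → Gen m′
      gen-conv eqn (k , w) = k , conv eqn w

      -- Transposition reverses the middle word: `a (u u′ᵀ w)ᵀ c = a wᵀ (u′ uᵀ c)`, so its factors
      -- move pair by pair onto `c`.
      gen-tern₁ : ∀ {k a b c} → V a → Word k b → Gen c → Gen (tern a b c)
      gen-tern₁ Va (base Vb) (l , w) = suc l , step Va Vb w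
      gen-tern₁ {a = a} {c = c} Va (step {a = u} {b = u′} {w = w} Vu Vu′ Ww) (l , Wc) =
        gen-conv (λ x y → sym (tern-assocᵐ a u u′ w c x y)) (gen-tern₁ Va Ww (suc l , step Vu′ Vu Wc))
      gen-tern₁ {a = a} {c = c} Va (plus {m = m} {m′} w w′) Gc =
        gen-conv (λ x y → sym (tern-⊞₂ a m m′ c x y)) (gen-plus (gen-tern₁ Va w Gc) (gen-tern₁ Va w′ Gc))
      gen-tern₁ {a = a} {c = c} Va (conv eqn w) Gc =
        gen-conv (tern-cong {a} {a} {c = c} {c} (λ _ _ → refl) eqn (λ _ _ → refl)) (gen-tern₁ Va w Gc)

      gen-tern : ∀ {k a b c} → Word k a → Gen b → Gen c → Gen (tern a b c)
      gen-tern (base Va) (_ , w) Gc = gen-tern₁ Va w Gc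
      gen-tern {b = b} {c} (step {a = u} {b = u′} {w = w} Vu Vu′ Ww) Gb Gc =
        let l , w′ = gen-tern Ww Gb Gc in
        gen-conv (λ x y → sym (tern-assocˡ u u′ w b c x y)) (suc l , step Vu Vu′ w′)
      gen-tern {b = b} {c} (plus {m = m} {m′} w w′) Gb Gc =
        gen-conv (λ x y → sym (tern-⊞₁ m m′ b c x y)) (gen-plus (gen-tern w Gb Gc) (gen-tern w′ Gb Gc))
      gen-tern {b = b} {c} (conv eqn w) Gb Gc =
        gen-conv (tern-cong {b = b} {b} {c} {c} eqn (λ _ _ → refl) (λ _ _ → refl)) (gen-tern w Gb Gc)

      Generated : Mat X Y → Set
      Generated m = ¬ ¬ Gen m

      generated-ternary : IsTernary Generated
      generated-ternary = record
        { ext    = λ eqn G → G >>= λ g → return (gen-conv eqn g)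
        ; zero∈  = return (0 , base V.zero∈)
        ; add    = λ G G′ → G >>= λ g → G′ >>= λ g′ → return (gen-plus g g′)
        ; scale  = λ c G → G >>= λ (k , w) → return (k , word-scale c w)
        ; tern∈  = λ Ga Gb Gc → Ga >>= λ (_ , a) → Gb >>= λ b → Gc >>= λ c → return (gen-tern a b c)
        ; stable = λ ¬¬G → ¬¬G >>= id
        }

      -- A long product is cut after `k` pairs as `a vᵀ b`. `Q` ranges over all additive predicates
      -- because the recursion on `k` replaces it by `Q (tern a b _)` for the pair just passed.
      split : (Q : Mat X Y → Set) → (∀ {m m′} → m ≗ₘ m′ → Q m → Q m′) → (∀ {m m′} → Q m → Q m′ → Q (m ⊞ m′)) →
        ∀ k l → (∀ {w} → Word k w → Q w) → (∀ {a v b} → Word k a → V v → Word l b → Q (tern a v b)) →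
        ∀ {w} → Word (suc (k ℕ.+ l)) w → Q w
      split Q ext add k l short long (base Vw)   = short (base Vw)
      split Q ext add k l short long (plus w w′) = add (split Q ext add k l short long w) (split Q ext add k l short long w′)
      split Q ext add k l short long (conv eqn w) = ext eqn (split Q ext add k l short long w)
      split Q ext add zero l short long (step Va Vb w) = long (base Va) Vb w
      split Q ext add (suc k) l short long (step {a = a} {b} Va Vb w) =
        split (λ w → Q (tern a b w))
          (λ eqn → ext (tern-cong {a} {a} {b} {b} (λ _ _ → refl) (λ _ _ → refl) eqn))
          (λ {m} {m′} p q → ext (λ x y → sym (tern-⊞₃ a b m m′ x y)) (add p q))
          k l
          (λ w → short (step Va Vb w))
          (λ {a′} {v} {b′} Wa Vv Wb → ext (tern-assocˡ a b a′ v b′) (long (step Va Vb Wa) Vv Wb))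
          w

      words-shorten : ∀ k → (∀ {m} → Word (suc k) m → ¬ ¬ Word k m) → ∀ {l m} → Word l m → ¬ ¬ Word k m
      words-shorten k stop (base Vm)      = return (base Vm)
      words-shorten k stop (step Va Vb w) = words-shorten k stop w >>= λ w′ → stop (step Va Vb w′)
      words-shorten k stop (plus w w′)    = words-shorten k stop w >>= λ u → words-shorten k stop w′ >>= λ u′ → return (plus u u′)
      words-shorten k stop (conv eqn w)    = words-shorten k stop w >>= λ u → return (conv eqn u)

      -- The words of length at most `k` form a growing chain of subspaces. After the first step
      -- that adds nothing, longer words shorten from their tails, so the first stall is final.
      words-stop : ¬ ¬ Σ ℕ λ k → k ℕ.≤ length xs ℕ.* length ys × (∀ {m} → Generated m → ¬ ¬ Word k m)
      words-stop =
        chain-stops {is = cartesianProduct xs ys} (λ (x , y) → ∈-cartesianProduct⁺ (coverˣ x) (coverʸ y))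
          (λ k f → Word k (λ x y → f (x , y)))
          (λ k → record { ext   = λ eqn → conv (λ x y → eqn (x , y))
                        ; zero∈ = base V.zero∈
                        ; add   = plus
                        ; scale = λ c → word-scale c })
          (λ k → word-mono (ℕₚ.n≤1+n k)) >>= λ (k , k≤ , stop) →
        return (k , subst (k ℕ.≤_) (length-cartesianProductWith _,_ xs ys) k≤ , λ {m} G → G >>= λ (_ , w) →
          words-shorten k (λ {m} → stop (λ (x , y) → m x y)) w)

    module Levels (V : ℕ → Mat X Y → Set) (space : ∀ q → IsMatrixSpace (V q))
      (mono : ∀ {q r m} → q ℕ.≤ r → V q m → V r m)
      (cost : ℕ) (tern-cost : ∀ {q a b c} → V q a → V q b → V q c → V (cost ℕ.+ q) (tern a b c)) where

      -- The number `2 ^ j − 1`: a ternary product joins two words of length `l` through one middle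
      -- factor into a word of length `2 l + 1`.
      word-length : ℕ → ℕ
      word-length zero    = 0
      word-length (suc j) = suc (word-length j ℕ.+ word-length j)

      word-level : ∀ q j {w} → Word (V q) (space q) (word-length j) w → V (j ℕ.* cost ℕ.+ q) w
      word-level q zero (base Vm)    = Vm
      word-level q zero (plus w w′)  = IsMatrixSpace.add (space q) (word-level q zero w) (word-level q zero w′)
      word-level q zero (conv eqn w)  = IsMatrixSpace.ext (space q) eqn (word-level q zero w)
      word-level q (suc j) = split (V q) (space q) (V r) (IsMatrixSpace.ext (space r)) (IsMatrixSpace.add (space r))
          (word-length j) (word-length j)
          (λ w → mono (ℕₚ.+-monoˡ-≤ q (ℕₚ.m≤n+m (j ℕ.* cost) cost)) (word-level q j w))
          (λ {a} {v} {b} Wa Vv Wb → subst (λ l → V l (tern a v b)) (sym (ℕₚ.+-assoc cost (j ℕ.* cost) q))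
            (tern-cost (word-level q j Wa) (mono (ℕₚ.m≤n+m q (j ℕ.* cost)) Vv) (word-level q j Wb)))
        where r = suc j ℕ.* cost ℕ.+ q

      -- Stage `i` sits at level `l i`, and all that it generates is in `V` one stage later. If
      -- stage `suc i` generates nothing beyond stage `i`, ternary products at level `l (suc i)`
      -- therefore fall back into that level.
      closed-level : ∀ j → length xs ℕ.* length ys ℕ.≤ word-length j →
        ¬ ¬ Σ ℕ λ q → q ℕ.≤ suc (length xs ℕ.+ length ys) ℕ.* (j ℕ.* cost) ×
                      (∀ {a b c} → V q a → V q b → V q c → V q (tern a b c))
      closed-level j long = TernaryChain.ternary-chain-stops coverˣ coverʸ T (λ i → generated-ternary (V (l i)) (space (l i)))
          (λ i G → G >>= λ (k , w) → return (k , lift i w)) >>= λ (i , i≤ , stop) →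
        return (l (suc i) , ℕₚ.*-monoˡ-≤ (j ℕ.* cost) (s≤s i≤) , λ {a} {b} {c} Va Vb Vc →
          generated-level i (stop (return (1 , step Va Vb (base Vc)))))
        where
        l : ℕ → ℕ
        l i = i ℕ.* (j ℕ.* cost)
        T : ℕ → Mat X Y → Set
        T i = Generated (V (l i)) (space (l i))
        lift : ∀ i {k w} → Word (V (l i)) (space (l i)) k w → Word (V (l (suc i))) (space (l (suc i))) k w
        lift i (base Vm)      = base (mono (ℕₚ.m≤n+m (l i) (j ℕ.* cost)) Vm)
        lift i (step Va Vb w) = step (mono (ℕₚ.m≤n+m (l i) (j ℕ.* cost)) Va) (mono (ℕₚ.m≤n+m (l i) (j ℕ.* cost)) Vb) (lift i w)
        lift i (plus w w′)    = plus (lift i w) (lift i w′)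
        lift i (conv eqn w)    = conv eqn (lift i w)
        generated-level : ∀ i {m} → T i m → V (l (suc i)) m
        generated-level i G = IsMatrixSpace.stable (space (l (suc i))) (
          words-stop (V (l i)) (space (l i)) >>= λ (k , k≤ , short) → short G >>= λ w →
          return (word-level (l i) j (word-mono (V (l i)) (space (l i)) (ℕₚ.≤-trans k≤ long) w)))

  -- Semantics

  anyFin-cong : ∀ {l} {f g : Fin l → Bool} → (∀ i → f i ≡ g i) → anyFin f ≡ anyFin g
  anyFin-cong {zero}  f≡g = refl
  anyFin-cong {suc l} f≡g = cong₂ _∨_ (f≡g Fin.zero) (anyFin-cong (f≡g ∘ Fin.suc))

  anyFin-true : ∀ {l} (f : Fin l → Bool) i → f i ≡ true → anyFin f ≡ true
  anyFin-true f Fin.zero    fi rewrite fi = refl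
  anyFin-true f (Fin.suc i) fi rewrite anyFin-true (f ∘ Fin.suc) i fi = Boolₚ.∨-zeroʳ (f Fin.zero)

  anyFin-witness : ∀ {l} (f : Fin l → Bool) → anyFin f ≡ true → ∃ λ i → f i ≡ true
  anyFin-witness {suc l} f any with f Fin.zero in f0
  ... | true  = Fin.zero , f0
  ... | false = let i , fi = anyFin-witness (f ∘ Fin.suc) any in Fin.suc i , fi

  countTrue-cong : ∀ {l} {f g : Fin l → Bool} → (∀ i → f i ≡ g i) → countTrue f ≡ countTrue g
  countTrue-cong {zero}  f≡g = refl
  countTrue-cong {suc l} f≡g = cong₂ ℕ._+_ (cong (if_then 1 else 0) (f≡g Fin.zero)) (countTrue-cong (f≡g ∘ Fin.suc))

  countTrue≤ : ∀ {l} (f : Fin l → Bool) → countTrue f ℕ.≤ l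
  countTrue≤ {zero}  f = z≤n
  countTrue≤ {suc l} f with f Fin.zero
  ... | true  = s≤s (countTrue≤ (f ∘ Fin.suc))
  ... | false = ℕₚ.m≤n⇒m≤1+n (countTrue≤ (f ∘ Fin.suc))

  anyFin≡1≤count : ∀ {l} (f : Fin l → Bool) → anyFin f ≡ (1 ≤ᵇ countTrue f)
  anyFin≡1≤count {zero}  f = refl
  anyFin≡1≤count {suc l} f with f Fin.zero
  ... | true  = refl
  ... | false = anyFin≡1≤count (f ∘ Fin.suc)

  private variable
    A Sym : Set
    ar : Sym → ℕ
    d k m n : ℕ

  module _ (S : Structure Sym ar n) where

    allAssigned-cong : ∀ {l} {f g : Fin l → Maybe (Fin n)} → (∀ i → f i ≡ g i) → allAssigned S f ≡ allAssigned S g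
    allAssigned-cong {zero} f≡g = refl
    allAssigned-cong {suc l} {f} {g} f≡g
      with f Fin.zero | g Fin.zero | f≡g Fin.zero
         | allAssigned S (f ∘ Fin.suc) | allAssigned S (g ∘ Fin.suc) | allAssigned-cong (f≡g ∘ Fin.suc)
    ... | just a  | .(just a) | refl | just h  | .(just h) | refl = refl
    ... | just a  | .(just a) | refl | nothing | .nothing  | refl = refl
    ... | nothing | .nothing  | refl | _       | _         | _    = refl

    eval-atom : ∀ {m m′} R (xs : Fin (ar R) → Fin m) (xs′ : Fin (ar R) → Fin m′) (α : Assign S m) (β : Assign S m′) →
                (∀ i → α (xs i) ≡ β (xs′ i)) → eval S (atom R xs) α ≡ eval S (atom R xs′) β
    eval-atom R xs xs′ α β α≡β with allAssigned S (α ∘ xs) | allAssigned S (β ∘ xs′) | allAssigned-cong {f = α ∘ xs} {g = β ∘ xs′} α≡β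
    ... | just as | .(just as) | refl = refl
    ... | nothing | .nothing   | refl = refl

    does-refl : (x : Fin m) → does (x Fin.≟ x) ≡ true
    does-refl x with x Fin.≟ x
    ... | yes _   = refl
    ... | no x≢x = contradiction refl x≢x

    update-agree : {α β : Assign S m} (x : Fin m) (a : Fin n) (z : Fin m) →
                   (does (x Fin.≟ z) ≡ false → α z ≡ β z) → update S α x a z ≡ update S β x a z
    update-agree x a z α≡β with does (x Fin.≟ z)
    ... | true  = refl
    ... | false = α≡β refl

    -- Connects the empty assignment, at which `⊨` evaluates sentences, with the total assignments
    -- that carry types.
    eval-agree : (φ : Form Sym ar m) (α β : Assign S m) → (∀ z → free φ z ≡ true → α z ≡ β z) →
                 eval S φ α ≡ eval S φ β
    eval-agree (eq x y) α β α≡β = cong₂ (eqM S)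
      (α≡β x (cong (_∨ does (y Fin.≟ x)) (does-refl x)))
      (α≡β y (trans (cong (does (x Fin.≟ y) ∨_) (does-refl y)) (Boolₚ.∨-zeroʳ _)))
    eval-agree (atom R xs) α β α≡β = eval-atom R xs xs α β λ i →
      α≡β (xs i) (anyFin-true (λ j → does (xs j Fin.≟ xs i)) i (does-refl (xs i)))
    eval-agree (and φ ψ) α β α≡β = cong₂ _∧_
      (eval-agree φ α β (λ z f → α≡β z (cong (_∨ free ψ z) f)))
      (eval-agree ψ α β (λ z f → α≡β z (trans (cong (free φ z ∨_) f) (Boolₚ.∨-zeroʳ _))))
    eval-agree (neg φ) α β α≡β = cong not (eval-agree φ α β α≡β)
    eval-agree (ex x φ) α β α≡β = anyFin-cong λ a → eval-agree φ _ _ λ z f →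
      update-agree {α = α} {β} x a z λ x≠z → α≡β z (cong₂ (λ p q → not p ∧ q) x≠z f)
    eval-agree (exGE j x φ) α β α≡β = cong (j ≤ᵇ_) (countTrue-cong λ a → eval-agree φ _ _ λ z f →
      update-agree {α = α} {β} x a z λ x≠z → α≡β z (cong₂ (λ p q → not p ∧ q) x≠z f))

    total : Vec (Fin n) m → Assign S m
    total α i = just (lookup α i)

    update-total : (α : Vec (Fin n) m) (x : Fin m) (a : Fin n) → ∀ y → update S (total α) x a y ≡ total (α [ x ]≔ a) y
    update-total α x a y with x Fin.≟ y
    ... | yes refl = cong just (sym (Vecₚ.lookup∘update x α a))
    ... | no  x≢y  = cong just (sym (Vecₚ.lookup∘update′ (x≢y ∘ sym) α a))

    eval-ex : ∀ x (φ : Form Sym ar m) α →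
              eval S (ex x φ) (total α) ≡ anyFin (λ a → eval S φ (total (α [ x ]≔ a)))
    eval-ex x φ α = anyFin-cong λ a → eval-agree φ _ _ λ z _ → update-total α x a z

    eval-exGE : ∀ j x (φ : Form Sym ar m) α →
                eval S (exGE j x φ) (total α) ≡ (j ≤ᵇ countTrue (λ a → eval S φ (total (α [ x ]≔ a))))
    eval-exGE j x φ α = cong (j ≤ᵇ_) (countTrue-cong λ a → eval-agree φ _ _ λ z _ → update-total α x a z)

  exs : List (Fin m) → Form Sym ar m → Form Sym ar m
  exs xs φ = foldr ex φ xs

  qr-exs : ∀ xs (φ : Form Sym ar m) → qr (exs xs φ) ≡ length xs ℕ.+ qr φ
  qr-exs []       φ = refl
  qr-exs (x ∷ xs) φ = cong suc (qr-exs xs φ)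

  free-exs : ∀ xs (φ : Form Sym ar m) {z} → z ∈ xs → free (exs xs φ) z ≡ false
  free-exs (x ∷ xs) φ {z} z∈ with x Fin.≟ z
  free-exs (x ∷ xs) φ {z} z∈ | yes _ = refl
  free-exs (x ∷ xs) φ {z} (here refl) | no z≢z = contradiction refl z≢z
  free-exs (x ∷ xs) φ {z} (there z∈)  | no _   = free-exs xs φ z∈

  -- Agreement with `α` is demanded only outside the variables still to be quantified, so the
  -- induction can start from the empty assignment when `xs` lists all variables.
  exs-intro : (S : Structure Sym ar n) (xs : List (Fin m)) (φ : Form Sym ar m) (α : Vec (Fin n) m) (β : Assign S m) →
    (∀ z → z ∉ xs → β z ≡ total S α z) → eval S φ (total S α) ≡ true → eval S (exs xs φ) β ≡ true
  exs-intro S []       φ α β agree holds = trans (eval-agree S φ β (total S α) (λ z _ → agree z λ ())) holds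
  exs-intro S (x ∷ xs) φ α β agree holds =
    anyFin-true (λ a → eval S (exs xs φ) (update S β x a)) (lookup α x) (exs-intro S xs φ α _ agree′ holds)
    where
    agree′ : ∀ z → z ∉ xs → update S β x (lookup α x) z ≡ total S α z
    agree′ z z∉ with x Fin.≟ z
    ... | yes refl = refl
    ... | no  x≢z  = agree z λ { (here z≡x) → x≢z (sym z≡x) ; (there z∈) → z∉ z∈ }

  exs-elim : (S : Structure Sym ar n) (xs : List (Fin m)) (φ : Form Sym ar m) (α : Vec (Fin n) m) (β : Assign S m) →
    (∀ z → z ∉ xs → β z ≡ total S α z) → eval S (exs xs φ) β ≡ true →
    Σ (Vec (Fin n) m) λ α′ → eval S φ (total S α′) ≡ true
  exs-elim S []       φ α β agree holds = α , trans (eval-agree S φ (total S α) β (λ z _ → sym (agree z λ ()))) holds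
  exs-elim S (x ∷ xs) φ α β agree holds =
    let a , holds′ = anyFin-witness (λ a → eval S (exs xs φ) (update S β x a)) holds in
    exs-elim S xs φ (α [ x ]≔ a) (update S β x a) (agree′ a) holds′
    where
    agree′ : ∀ a z → z ∉ xs → update S β x a z ≡ total S (α [ x ]≔ a) z
    agree′ a z z∉ with x Fin.≟ z
    ... | yes refl = cong just (sym (Vecₚ.lookup∘update x α a))
    ... | no  x≢z  = trans (agree z λ { (here z≡x) → x≢z (sym z≡x) ; (there z∈) → z∉ z∈ })
                           (cong just (sym (Vecₚ.lookup∘update′ (x≢z ∘ sym) α a)))

  -- Sums and counts over lists

  vecs : {A : Set} → List A → ∀ k → List (Vec A k)
  vecs as zero    = [] ∷ []
  vecs as (suc k) = cartesianProductWith _∷_ as (vecs as k)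

  ∈-vecs : {A : Set} {as : List A} → (∀ a → a ∈ as) → ∀ {k} (v : Vec A k) → v ∈ vecs as k
  ∈-vecs cover []      = here refl
  ∈-vecs cover (a ∷ v) = ∈-cartesianProductWith⁺ _∷_ (cover a) (∈-vecs cover v)

  length-vecs : {A : Set} (as : List A) → ∀ k → length (vecs as k) ≡ length as ℕ.^ k
  length-vecs as zero    = refl
  length-vecs as (suc k) = trans (length-cartesianProductWith _∷_ as (vecs as k)) (cong (length as ℕ.*_) (length-vecs as k))

  ∑-++ : {I : Set} (is js : List I) (f : I → ℚ) → ∑ (is ++ js) f ≡ ∑ is f + ∑ js f
  ∑-++ []       js f = sym (ℚₚ.+-identityˡ _)
  ∑-++ (i ∷ is) js f = trans (cong (f i +_) (∑-++ is js f)) (sym (ℚₚ.+-assoc (f i) (∑ is f) (∑ js f)))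

  ∑-map : {I J : Set} (g : I → J) (is : List I) (f : J → ℚ) → ∑ (map g is) f ≡ ∑ is (f ∘ g)
  ∑-map g []       f = refl
  ∑-map g (i ∷ is) f = cong (f (g i) +_) (∑-map g is f)

  ∑-cartesianProductWith : {I J K : Set} (g : I → J → K) (is : List I) (js : List J) (f : K → ℚ) →
    ∑ (cartesianProductWith g is js) f ≡ ∑ is (λ i → ∑ js (λ j → f (g i j)))
  ∑-cartesianProductWith g []       js f = refl
  ∑-cartesianProductWith g (i ∷ is) js f = trans (∑-++ (map (g i) js) _ f)
    (cong₂ _+_ (∑-map (g i) js f) (∑-cartesianProductWith g is js f))

  ∑-tabulate : {I : Set} (g : Fin n → I) (f : I → ℚ) → ∑ (tabulate g) f ≡ ∑ (allFin n) (f ∘ g)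
  ∑-tabulate {n = zero}  g f = refl
  ∑-tabulate {n = suc n} g f = cong (f (g Fin.zero) +_)
    (trans (∑-tabulate (g ∘ Fin.suc) f) (sym (∑-tabulate Fin.suc (f ∘ g))))

  count : {A : Set} → (A → Bool) → List A → ℕ
  count p []       = 0
  count p (a ∷ as) = (if p a then 1 else 0) ℕ.+ count p as

  count-tabulate : {A : Set} (p : A → Bool) (g : Fin n → A) → count p (tabulate g) ≡ countTrue (p ∘ g)
  count-tabulate {n = zero}  p g = refl
  count-tabulate {n = suc n} p g = cong ((if p (g Fin.zero) then 1 else 0) ℕ.+_) (count-tabulate p (g ∘ Fin.suc))

  count-∈ : {A : Set} (p : A → Bool) (as : List A) {k : ℕ} → count p as ≡ suc k → ∃ λ a → a ∈ as × p a ≡ true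
  count-∈ p (a ∷ as) c with p a in pa
  ... | true  = a , here refl , pa
  ... | false = let b , b∈ , pb = count-∈ p as c in b , there b∈ , pb

  count-extract : {A : Set} (p : A → Bool) (as bs : List A) (b : A) →
    count p (as ++ b ∷ bs) ≡ (if p b then 1 else 0) ℕ.+ count p (as ++ bs)
  count-extract p []       bs b = refl
  count-extract p (a ∷ as) bs b rewrite count-extract p as bs b with p a | p b
  ... | true  | true  = refl
  ... | true  | false = refl
  ... | false | _     = refl

  ∑-extract : {A : Set} (f : A → ℚ) (as bs : List A) (b : A) → ∑ (as ++ b ∷ bs) f ≡ f b + ∑ (as ++ bs) f
  ∑-extract f []       bs b = refl
  ∑-extract f (a ∷ as) bs b = trans (cong (f a +_) (∑-extract f as bs b))
    (solve 3 (λ x y z → x :+ (y :+ z) := y :+ (x :+ z)) refl (f a) (f b) (∑ (as ++ bs) f))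

  -- The head `a` is matched with some `b` of its class, which exists because that class is nonempty
  -- in `bs` too; removing both keeps all class counts equal.
  ∑-matching : {A : Set} (cls : A → A → Bool) (f : A → ℚ) → (∀ a → cls a a ≡ true) →
    (∀ {a b} → cls a b ≡ true → f a ≡ f b) → (∀ {a b} → cls a b ≡ true → ∀ c → cls c a ≡ cls c b) →
    ∀ as bs → (∀ c → count (cls c) as ≡ count (cls c) bs) → ∑ as f ≡ ∑ bs f
  ∑-matching cls f reflexive f-cls cls-cls [] [] counts = refl
  ∑-matching cls f reflexive f-cls cls-cls [] (b ∷ bs) counts with cls b b | reflexive b | counts b
  ... | .true | refl | ()
  ∑-matching cls f reflexive f-cls cls-cls (a ∷ as) bs counts with count-∈ (cls a) bs {count (cls a) as}
    (trans (sym (counts a)) (cong (λ t → (if t then 1 else 0) ℕ.+ count (cls a) as) (reflexive a)))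
  ... | b , b∈ , a~b with ∈-∃++ b∈
  ...   | bs₁ , bs₂ , refl = trans
      (cong₂ _+_ (f-cls a~b) (∑-matching cls f reflexive f-cls cls-cls as (bs₁ ++ bs₂) counts′))
      (sym (∑-extract f bs₁ bs₂ b))
    where
    counts′ : ∀ c → count (cls c) as ≡ count (cls c) (bs₁ ++ bs₂)
    counts′ c = ℕₚ.+-cancelˡ-≡ (if cls c a then 1 else 0) _ _ (trans (counts c) (trans
      (count-extract (cls c) bs₁ bs₂ b) (cong (λ t → (if t then 1 else 0) ℕ.+ count (cls c) (bs₁ ++ bs₂)) (sym (cls-cls a~b c)))))

  -- Counts in an `n`-element universe never exceed `n`, so the finitely many thresholds listed in
  -- `forms` determine them.
  ≤ᵇ-injective : ∀ {c c′ n} → c ℕ.≤ n → c′ ℕ.≤ n → (∀ j → j ℕ.≤ n → (j ≤ᵇ c) ≡ (j ≤ᵇ c′)) → c ≡ c′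
  ≤ᵇ-injective {c} {c′} c≤n c′≤n same = ℕₚ.≤-antisym
    (ℕₚ.≤ᵇ⇒≤ c c′ (subst Bool.T (same c c≤n) (ℕₚ.≤⇒≤ᵇ (ℕₚ.≤-refl {c}))))
    (ℕₚ.≤ᵇ⇒≤ c′ c (subst Bool.T (sym (same c′ c′≤n)) (ℕₚ.≤⇒≤ᵇ (ℕₚ.≤-refl {c′}))))

  put : ∀ {A : Set} {d k} → Vec (Fin d) k → Vec A k → Vec A d → Vec A d
  put []       []      α = α
  put (x ∷ xs) (a ∷ v) α = put xs v (α [ x ]≔ a)

  -- Rank-q types of points of the two structures

  module Types {Sym : Set} {ar : Sym → ℕ} {n d : ℕ} (𝔄 𝔅 : Structure Sym ar n) (syms : List Sym) (x₀ : Fin d) where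

    str : Bool → Structure Sym ar n
    str true  = 𝔄
    str false = 𝔅

    Point : Set
    Point = Bool × Vec (Fin n) d

    ev : Form Sym ar d → Point → Bool
    ev φ (s , α) = eval (str s) φ (total (str s) α)

    move : Fin d → Fin n → Point → Point
    move x a (s , α) = s , α [ x ]≔ a

    equations : List (Form Sym ar d)
    equations = cartesianProductWith eq (allFin d) (allFin d)

    -- Restricted to `syms`, as the signature may be infinite. Arguments are listed as vectors, so a
    -- given atom is met only up to pointwise equality of its argument function; `eval-atom` bridges
    -- this.
    atoms : List (Form Sym ar d)
    atoms = concatMap (λ R → map (λ xs → atom R (lookup xs)) (vecs (allFin d) (ar R))) syms

    -- All sign patterns over the list. `eq x₀ x₀` stands for truth; it holds at every total
    -- assignment.
    cells : List (Form Sym ar d) → List (Form Sym ar d)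
    cells []      = eq x₀ x₀ ∷ []
    cells (φ ∷ l) = map (and φ) (cells l) ++ map (and (neg φ)) (cells l)

    -- Up to equivalence, all formulas of quantifier rank at most q over the atoms are Boolean
    -- combinations of these.
    forms : ℕ → List (Form Sym ar d)
    forms zero    = equations ++ atoms
    forms (suc q) = forms q ++ cartesianProductWith (λ (j , x) → exGE j x)
      (cartesianProduct (upTo (suc n)) (allFin d)) (cells (forms q))

    infix 4 _≈[_]_
    record _≈[_]_ (t : Point) (q : ℕ) (t′ : Point) : Set where
      constructor agree
      field same : ∀ {φ} → φ ∈ forms q → ev φ t ≡ ev φ t′
    open _≈[_]_

    ≈-mono : ∀ {q r t t′} → q ℕ.≤ r → t ≈[ r ] t′ → t ≈[ q ] t′
    ≈-mono {r = zero}  z≤n t≈t′ = t≈t′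
    ≈-mono {q} {suc r} q≤ t≈t′ with ℕₚ.m≤n⇒m<n∨m≡n q≤
    ... | inj₁ (s≤s q≤r) = ≈-mono q≤r (agree (same t≈t′ ∘ ∈-++⁺ˡ))
    ... | inj₂ refl      = t≈t′

    cell : Point → List (Form Sym ar d) → Form Sym ar d
    cell t []      = eq x₀ x₀
    cell t (φ ∷ l) = and (if ev φ t then φ else neg φ) (cell t l)

    cell∈ : ∀ t l → cell t l ∈ cells l
    cell∈ t []      = here refl
    cell∈ t (φ ∷ l) with ev φ t
    ... | true  = ∈-++⁺ˡ (∈-map⁺ (and φ) (cell∈ t l))
    ... | false = ∈-++⁺ʳ (map (and φ) (cells l)) (∈-map⁺ (and (neg φ)) (cell∈ t l))

    cell-intro : ∀ t t′ l → (∀ {φ} → φ ∈ l → ev φ t ≡ ev φ t′) → ev (cell t l) t′ ≡ true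
    cell-intro t (s , α) []      same = does-refl (str s) (lookup α x₀)
    cell-intro t t′      (φ ∷ l) same with ev φ t | same (here refl)
    ... | true  | p = cong₂ _∧_ (sym p) (cell-intro t t′ l (same ∘ there))
    ... | false | p = cong₂ _∧_ (cong not (sym p)) (cell-intro t t′ l (same ∘ there))

    ∧-true : ∀ {a b} → a ∧ b ≡ true → a ≡ true × b ≡ true
    ∧-true {true} {true} _ = refl , refl

    cell-elim : ∀ t t′ l → ev (cell t l) t′ ≡ true → ∀ {φ} → φ ∈ l → ev φ t ≡ ev φ t′
    cell-elim t t′ (φ ∷ l) holds (there φ∈) = cell-elim t t′ l (proj₂ (∧-true {ev (if ev φ t then φ else neg φ) t′} holds)) φ∈
    cell-elim t t′ (φ ∷ l) holds (here refl) with ev φ t | holds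
    ... | true  | p = sym (proj₁ (∧-true p))
    ... | false | p = sym (trans (sym (Boolₚ.not-involutive _)) (cong not (proj₁ (∧-true p))))

    qr-cells : ∀ {q} l → (∀ {φ} → φ ∈ l → qr φ ℕ.≤ q) → ∀ {χ} → χ ∈ cells l → qr χ ℕ.≤ q
    qr-cells []      bound (here refl) = z≤n
    qr-cells (φ ∷ l) bound χ∈ with ∈-++⁻ (map (and φ) (cells l)) χ∈
    ... | inj₁ χ∈₁ with ∈-map⁻ (and φ) χ∈₁
    ...   | χ′ , χ′∈ , refl = ℕₚ.⊔-lub (bound (here refl)) (qr-cells l (bound ∘ there) χ′∈)
    qr-cells (φ ∷ l) bound χ∈ | inj₂ χ∈₂ with ∈-map⁻ (and (neg φ)) χ∈₂
    ...   | χ′ , χ′∈ , refl = ℕₚ.⊔-lub (bound (here refl)) (qr-cells l (bound ∘ there) χ′∈)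

    qr-atoms : ∀ syms {φ} → φ ∈ concatMap (λ R → map (λ xs → atom R (lookup xs)) (vecs (allFin d) (ar R))) syms → qr φ ℕ.≤ 0
    qr-atoms (R ∷ syms) φ∈ with ∈-++⁻ (map (λ xs → atom R (lookup xs)) (vecs (allFin d) (ar R))) φ∈
    ... | inj₁ φ∈₁ with ∈-map⁻ _ φ∈₁
    ...   | _ , _ , refl = z≤n
    qr-atoms (R ∷ syms) φ∈ | inj₂ φ∈₂ = qr-atoms syms φ∈₂

    qr-forms : ∀ q {φ} → φ ∈ forms q → qr φ ℕ.≤ q
    qr-forms zero φ∈ with ∈-++⁻ equations φ∈
    ... | inj₂ φ∈₂ = qr-atoms syms φ∈₂
    ... | inj₁ φ∈₁ with ∈-cartesianProductWith⁻ eq (allFin d) (allFin d) φ∈₁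
    ...   | _ , _ , _ , _ , refl = z≤n
    qr-forms (suc q) φ∈ with ∈-++⁻ (forms q) φ∈
    ... | inj₁ φ∈₁ = ℕₚ.m≤n⇒m≤1+n (qr-forms q φ∈₁)
    ... | inj₂ φ∈₂ with ∈-cartesianProductWith⁻ (λ (j , x) → exGE j x) (cartesianProduct (upTo (suc n)) (allFin d)) (cells (forms q)) φ∈₂
    ...   | _ , _ , _ , χ∈ , refl = s≤s (qr-cells (forms q) (qr-forms q) χ∈)

    Respects : ∀ {A : Set} → ℕ → (Point → A) → Set
    Respects q f = ∀ {t t′} → t ≈[ q ] t′ → f t ≡ f t′

    -- A single formula `cell` expresses a rank-`q` type, and one counting quantifier fixes how many
    -- values of `x` lead to that type. The sum of a function of the type depends on these numbers
    -- only.
    sum-respects : ∀ {q} (f : Point → ℚ) x → Respects q f → Respects (suc q) (λ t → ∑ (allFin n) (λ a → f (move x a t)))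
    sum-respects {q} f x respects {t} {t′} t≈t′ = begin
      ∑ (allFin n) (λ a → f (move x a t))     ≡⟨ ∑-tabulate (λ a → move x a t) f ⟨
      ∑ (tabulate (λ a → move x a t)) f       ≡⟨ ∑-matching (λ c → ev (cell c (forms q))) f
           (λ a → cell-intro a a (forms q) (λ _ → refl))
           (λ {a} {b} h → respects (agree (cell-elim a b (forms q) h)))
           (λ {a} {b} h c → cell-cong a b c (forms q) (cell-elim a b (forms q) h))
           (tabulate (λ a → move x a t)) (tabulate (λ a → move x a t′)) counts ⟩
      ∑ (tabulate (λ a → move x a t′)) f      ≡⟨ ∑-tabulate (λ a → move x a t′) f ⟩
      ∑ (allFin n) (λ a → f (move x a t′))    ∎
      where
      open ≡-Reasoning
      cell-cong : ∀ a b c l → (∀ {φ} → φ ∈ l → ev φ a ≡ ev φ b) → ev (cell c l) a ≡ ev (cell c l) b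
      cell-cong (s , α) (s′ , β) c [] same =
        trans (does-refl (str s) (lookup α x₀)) (sym (does-refl (str s′) (lookup β x₀)))
      cell-cong a b c (φ ∷ l) same with ev φ c
      ... | true  = cong₂ _∧_ (same (here refl)) (cell-cong a b c l (same ∘ there))
      ... | false = cong₂ _∧_ (cong not (same (here refl))) (cell-cong a b c l (same ∘ there))
      counts : ∀ c → count (ev (cell c (forms q))) (tabulate (λ a → move x a t)) ≡
                     count (ev (cell c (forms q))) (tabulate (λ a → move x a t′))
      counts c = trans (count-tabulate χ (λ a → move x a t)) (trans
        (≤ᵇ-injective (countTrue≤ (λ a → χ (move x a t))) (countTrue≤ (λ a → χ (move x a t′))) λ j j≤n →
          trans (sym (eval-exGE (str (proj₁ t)) j x (cell c (forms q)) (proj₂ t))) (trans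
            (same t≈t′ (∈-++⁺ʳ (forms q) (∈-cartesianProductWith⁺ (λ (j , x) → exGE j x)
              (∈-cartesianProduct⁺ (∈-upTo⁺ (s≤s j≤n)) (∈-allFin x)) (cell∈ c (forms q)))))
            (eval-exGE (str (proj₁ t′)) j x (cell c (forms q)) (proj₂ t′))))
        (sym (count-tabulate χ (λ a → move x a t′))))
        where χ = ev (cell c (forms q))

    block-sum-respects : ∀ {q k} (f : Point → ℚ) (xs : Vec (Fin d) k) → Respects q f →
      Respects (k ℕ.+ q) (λ (s , α) → ∑ (vecs (allFin n) k) (λ v → f (s , put xs v α)))
    block-sum-respects f []       respects t≈t′ = cong (_+ 0ℚ) (respects t≈t′)
    block-sum-respects {q} {suc k} f (x ∷ xs) respects {t} {t′} t≈t′ = trans (unfold t) (trans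
        (sum-respects (λ (s , α) → ∑ (vecs (allFin n) k) (λ v → f (s , put xs v α))) x
          (block-sum-respects f xs respects) t≈t′)
        (sym (unfold t′)))
      where
      unfold : ∀ (t : Point) → ∑ (vecs (allFin n) (suc k)) (λ v → f (proj₁ t , put (x ∷ xs) v (proj₂ t))) ≡
        ∑ (allFin n) (λ a → ∑ (vecs (allFin n) k) (λ v → f (proj₁ t , put xs v (proj₂ t [ x ]≔ a))))
      unfold t = ∑-cartesianProductWith _∷_ (allFin n) (vecs (allFin n) k) _

    Distinguished : ℕ → Set
    Distinguished r = Σ (Form Sym ar d) λ ψ → Sentence ψ × qr ψ ℕ.≤ r × 𝔄 ⊨ ψ × ¬ (𝔅 ⊨ ψ)

    -- The candidate closes the type of `α` existentially, which costs `d` quantifiers. It holds in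
    -- `𝔄`; if it holds in `𝔅` as well, its witness is a point of the same type.
    distinguish : ∀ q (α : Vec (Fin n) d) → Distinguished (d ℕ.+ q) ⊎ ∃ λ β → (true , α) ≈[ q ] (false , β)
    distinguish q α with eval 𝔅 (exs (allFin d) (cell (true , α) (forms q))) (λ _ → nothing) in holds
    ... | true  = let β , h = exs-elim 𝔅 (allFin d) χ α (λ _ → nothing) (λ z z∉ → contradiction (∈-allFin z) z∉) holds in
                  inj₂ (β , agree (cell-elim (true , α) (false , β) (forms q) h))
      where χ = cell (true , α) (forms q)
    ... | false = inj₁ (exs (allFin d) χ ,
                        (λ z → free-exs (allFin d) χ (∈-allFin z)) ,
                        ℕₚ.≤-trans (ℕₚ.≤-reflexive (trans (qr-exs (allFin d) χ) (cong (ℕ._+ qr χ) (Listₚ.length-tabulate id))))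
                                   (ℕₚ.+-monoʳ-≤ d (qr-cells (forms q) (qr-forms q) (cell∈ (true , α) (forms q)))) ,
                        exs-intro 𝔄 (allFin d) χ α (λ _ → nothing) (λ z z∉ → contradiction (∈-allFin z) z∉)
                          (cell-intro (true , α) (true , α) (forms q) (λ _ → refl)) ,
                        λ holds′ → contradiction (trans (sym holds) holds′) λ ())
      where χ = cell (true , α) (forms q)

  -- Blocks of variables and sums over tuples

  read : (Fin k → Fin d) → Vec A d → Vec A k
  read pos α = Vec.tabulate (lookup α ∘ pos)

  lookup-read : (pos : Fin k → Fin d) (α : Vec A d) (i : Fin k) → lookup (read pos α) i ≡ lookup α (pos i)
  lookup-read pos α = Vecₚ.lookup∘tabulate (lookup α ∘ pos)

  write : (Fin k → Fin d) → Vec A k → Vec A d → Vec A d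
  write pos = put (Vec.tabulate pos)

  lookup-write-miss : (pos : Fin k → Fin d) (v : Vec A k) (α : Vec A d) (x : Fin d) → (∀ i → x ≢ pos i) →
    lookup (write pos v α) x ≡ lookup α x
  lookup-write-miss pos []      α x miss = refl
  lookup-write-miss pos (a ∷ v) α x miss = trans (lookup-write-miss (pos ∘ Fin.suc) v _ x (miss ∘ Fin.suc))
    (Vecₚ.lookup∘update′ (miss Fin.zero) α a)

  lookup-write-hit : (pos : Fin k → Fin d) → (∀ i j → pos i ≡ pos j → i ≡ j) → (v : Vec A k) (α : Vec A d) (i : Fin k) →
    lookup (write pos v α) (pos i) ≡ lookup v i
  lookup-write-hit pos inj (a ∷ v) α Fin.zero = trans
    (lookup-write-miss (pos ∘ Fin.suc) v _ (pos Fin.zero) (λ i p → case inj Fin.zero (Fin.suc i) p of λ ()))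
    (Vecₚ.lookup∘update (pos Fin.zero) α a)
  lookup-write-hit pos inj (a ∷ v) α (Fin.suc i) =
    lookup-write-hit (pos ∘ Fin.suc) (λ i j p → Finₚ.suc-injective (inj (Fin.suc i) (Fin.suc j) p)) v _ i

  read-write-miss : ∀ {k′} (pos : Fin k → Fin d) (pos′ : Fin k′ → Fin d) → (∀ i j → pos i ≢ pos′ j) →
    (v : Vec A k′) (α : Vec A d) → read pos (write pos′ v α) ≡ read pos α
  read-write-miss pos pos′ disjoint v α = Vecₚ.tabulate-cong λ i → lookup-write-miss pos′ v α (pos i) (disjoint i)

  read-write-hit : (pos : Fin k → Fin d) → (∀ i j → pos i ≡ pos j → i ≡ j) → (v : Vec A k) (α : Vec A d) →
    read pos (write pos v α) ≡ v
  read-write-hit pos inj v α = trans (Vecₚ.tabulate-cong (lookup-write-hit pos inj v α)) (Vecₚ.tabulate∘lookup v)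

  bit : Bool → ℚ
  bit true  = 1ℚ
  bit false = 0ℚ

  ι-countTrue : (f : Fin n → Bool) → ∑ (allFin n) (bit ∘ f) ≡ ι (countTrue f)
  ι-countTrue {n = zero}  f = refl
  ι-countTrue {n = suc n} f = trans
    (cong (bit (f Fin.zero) +_) (trans (∑-tabulate Fin.suc (bit ∘ f)) (ι-countTrue (f ∘ Fin.suc)))) (step (f Fin.zero))
    where
    step : ∀ b → bit b + ι (countTrue (f ∘ Fin.suc)) ≡ ι ((if b then 1 else 0) ℕ.+ countTrue (f ∘ Fin.suc))
    step true  = refl
    step false = ℚₚ.+-identityˡ _

  ∑-single : (g : Fin n → ℚ) (c : Fin n) → (∀ a → a ≢ c → g a ≡ 0ℚ) → ∑ (allFin n) g ≡ g c
  ∑-single g Fin.zero other = trans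
    (cong (g Fin.zero +_) (trans (∑-tabulate Fin.suc g) (∑-0 (allFin _) (λ a → other (Fin.suc a) λ ()))))
    (ℚₚ.+-identityʳ _)
  ∑-single g (Fin.suc c) other = trans
    (cong₂ _+_ (other Fin.zero λ ()) (trans (∑-tabulate Fin.suc g)
      (∑-single (g ∘ Fin.suc) c (λ a a≢c → other (Fin.suc a) (a≢c ∘ Finₚ.suc-injective)))))
    (ℚₚ.+-identityˡ _)

  bit-false : ∀ {b} p → b ≢ true → bit b * p ≡ 0ℚ
  bit-false {true}  p b≢true = contradiction refl b≢true
  bit-false {false} p _      = ℚₚ.*-zeroˡ p

  bit-true : ∀ {b} p → b ≡ true → bit b * p ≡ p
  bit-true p refl = ℚₚ.*-identityˡ p

  tuples : ∀ n k → List (Vec (Fin n) k)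
  tuples n k = vecs (allFin n) k

  ∑-tuples-single : (e : Vec (Fin n) k → Bool) (f : Vec (Fin n) k → ℚ) (v : Vec (Fin n) k) →
    (∀ u → e u ≡ true → u ≡ v) → e v ≡ true → ∑ (tuples n k) (λ u → bit (e u) * f u) ≡ f v
  ∑-tuples-single e f [] sound complete = trans (ℚₚ.+-identityʳ _) (bit-true (f []) complete)
  ∑-tuples-single {n = n} e f (c ∷ v) sound complete = trans (∑-cartesianProductWith _∷_ (allFin n) (tuples n _) _) (trans
    (∑-single _ c λ a a≢c → ∑-0 (tuples n _) λ u → bit-false (f (a ∷ u)) λ h → a≢c (Vecₚ.∷-injectiveˡ (sound (a ∷ u) h)))
    (∑-tuples-single (e ∘ (c ∷_)) (f ∘ (c ∷_)) v (λ u h → Vecₚ.∷-injectiveʳ (sound (c ∷ u) h)) complete))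

  ∑-tuples-line : (e : Vec (Fin n) k → Bool) (f : Vec (Fin n) k → ℚ) (v : Vec (Fin n) k) (j : Fin k) →
    (∀ u → e u ≡ true → ∀ i → i ≢ j → lookup u i ≡ lookup v i) →
    (∀ u → (∀ i → i ≢ j → lookup u i ≡ lookup v i) → e u ≡ true) →
    ∑ (tuples n k) (λ u → bit (e u) * f u) ≡ ∑ (allFin n) (λ w → f (v [ j ]≔ w))
  ∑-tuples-line {n = n} e f (c ∷ v) Fin.zero sound complete = trans (∑-cartesianProductWith _∷_ (allFin n) (tuples n _) _)
    (∑-cong (allFin n) λ a → ∑-tuples-single (e ∘ (a ∷_)) (f ∘ (a ∷_)) v
      (λ u h → trans (sym (Vecₚ.tabulate∘lookup u)) (trans (Vecₚ.tabulate-cong (λ i → sound (a ∷ u) h (Fin.suc i) λ ())) (Vecₚ.tabulate∘lookup v)))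
      (complete (a ∷ v) λ { Fin.zero 0≢0 → contradiction refl 0≢0 ; (Fin.suc i) _ → refl }))
  ∑-tuples-line {n = n} e f (c ∷ v) (Fin.suc j) sound complete = trans (∑-cartesianProductWith _∷_ (allFin n) (tuples n _) _) (trans
    (∑-single _ c λ a a≢c → ∑-0 (tuples n _) λ u → bit-false (f (a ∷ u)) λ h → a≢c (sound (a ∷ u) h Fin.zero λ ()))
    (∑-tuples-line (e ∘ (c ∷_)) (f ∘ (c ∷_)) v j
      (λ u h i i≢j → sound (c ∷ u) h (Fin.suc i) (i≢j ∘ Finₚ.suc-injective))
      (λ u h → complete (c ∷ u) λ { Fin.zero _ → refl ; (Fin.suc i) i≢j → h i (i≢j ∘ cong Fin.suc) })))

  -- Needed between the block sizes in both directions: to pad columns to rows, and to let `b`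
  -- column indices list the `h − 1` row indices other than a given one.
  record Retraction (e c : ℕ) : Set where
    field
      to   : Fin e → Fin c
      from : Fin c → Fin e
      to∘from : ∀ j → to (from j) ≡ j

  retraction : ∀ {e c} → suc c ℕ.≤ e → Retraction e (suc c)
  retraction {e} {c} c<e = record { to = to ; from = λ j → Fin.inject≤ j c<e ; to∘from = to∘from }
    where
    to : Fin e → Fin (suc c)
    to i with Fin.toℕ i ℕ.<? suc c
    ... | yes i< = Fin.fromℕ< i<
    ... | no _   = Fin.zero
    to∘from : ∀ j → to (Fin.inject≤ j c<e) ≡ j
    to∘from j with Fin.toℕ (Fin.inject≤ j c<e) ℕ.<? suc c
    ... | yes i< = Finₚ.toℕ-injective (trans (Finₚ.toℕ-fromℕ< i<) (Finₚ.toℕ-inject≤ j c<e))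
    ... | no  i≮ = contradiction (subst (ℕ._< suc c) (sym (Finₚ.toℕ-inject≤ j c<e)) (Finₚ.toℕ<n j)) i≮

  bools : List Bool
  bools = true ∷ false ∷ []

  ∈-bools : ∀ s → s ∈ bools
  ∈-bools true  = here refl
  ∈-bools false = there (here refl)

  ∑-bools : (g : Bool → ℚ) (s : Bool) → (∀ s′ → s ≢ s′ → g s′ ≡ 0ℚ) → ∑ bools g ≡ g s
  ∑-bools g true  other = trans (cong (λ p → g true + (p + 0ℚ)) (other false λ ()))
    (trans (cong (g true +_) (ℚₚ.+-identityˡ 0ℚ)) (ℚₚ.+-identityʳ _))
  ∑-bools g false other = trans (cong (_+ (g false + 0ℚ)) (other true λ ())) (trans (ℚₚ.+-identityˡ _) (ℚₚ.+-identityʳ _))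

  -- Block-diagonal matrices and sums along one coordinate

  module BlockMatrices (n h b : ℕ) where

    -- The Boolean names the structure, `true` for `𝔄`. One matrix serves both structures, so types
    -- are compared across them inside one ring; this doubles the numbers of rows and columns.
    Rows Cols : Set
    Rows = Bool × Vec (Fin n) h
    Cols = Bool × Vec (Fin n) b

    rows : List Rows
    rows = cartesianProduct bools (tuples n h)

    cols : List Cols
    cols = cartesianProduct bools (tuples n b)

    cover-rows : ∀ x → x ∈ rows
    cover-rows (s , x) = ∈-cartesianProduct⁺ (∈-bools s) (∈-vecs ∈-allFin x)

    cover-cols : ∀ y → y ∈ cols
    cover-cols (s , y) = ∈-cartesianProduct⁺ (∈-bools s) (∈-vecs ∈-allFin y)

    open Operators cover-rows cover-cols public using (_∙_; _ᵀ∙_; tern)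

    Diagonal : Mat Rows Cols → Set
    Diagonal m = ∀ s s′ x y → s ≢ s′ → m (s , x) (s′ , y) ≡ 0ℚ

    -- With the sum over rows outside, `m₃ x′ y` can be evaluated before the column index `y` is
    -- given up.
    tern-swap : ∀ (m₁ m₂ m₃ : Mat Rows Cols) x y →
      tern m₁ m₂ m₃ x y ≡ ∑ rows (λ x′ → ∑ cols (λ y′ → m₁ x y′ * m₂ x′ y′) * m₃ x′ y)
    tern-swap m₁ m₂ m₃ x y = begin
      ∑ cols (λ y′ → m₁ x y′ * ∑ rows (λ x′ → m₂ x′ y′ * m₃ x′ y))
        ≡⟨ ∑-cong cols (λ y′ → sym (∑-*ˡ rows (m₁ x y′) _)) ⟩
      ∑ cols (λ y′ → ∑ rows (λ x′ → m₁ x y′ * (m₂ x′ y′ * m₃ x′ y)))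
        ≡⟨ ∑-swap cols rows _ ⟩
      ∑ rows (λ x′ → ∑ cols (λ y′ → m₁ x y′ * (m₂ x′ y′ * m₃ x′ y)))
        ≡⟨ ∑-cong rows (λ x′ → trans (∑-cong cols (λ y′ → sym (ℚₚ.*-assoc (m₁ x y′) (m₂ x′ y′) (m₃ x′ y))))
                                     (∑-*ʳ cols (m₃ x′ y) _)) ⟩
      ∑ rows (λ x′ → ∑ cols (λ y′ → m₁ x y′ * m₂ x′ y′) * m₃ x′ y) ∎
      where open ≡-Reasoning

    tern-diagonal : ∀ (m₁ m₂ m₃ : Mat Rows Cols) → Diagonal m₁ → Diagonal m₂ → ∀ s s′ x y →
      tern m₁ m₂ m₃ (s , x) (s′ , y) ≡
      ∑ (tuples n h) (λ x′ → ∑ (tuples n b) (λ y′ → m₁ (s , x) (s , y′) * m₂ (s , x′) (s , y′)) * m₃ (s , x′) (s′ , y))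
    tern-diagonal m₁ m₂ m₃ D₁ D₂ s s′ x y = begin
      tern m₁ m₂ m₃ (s , x) (s′ , y)
        ≡⟨ tern-swap m₁ m₂ m₃ (s , x) (s′ , y) ⟩
      ∑ rows (λ x′ → G x′ * m₃ x′ (s′ , y))
        ≡⟨ ∑-cartesianProductWith _,_ bools (tuples n h) _ ⟩
      ∑ bools (λ t → ∑ (tuples n h) (λ x′ → G (t , x′) * m₃ (t , x′) (s′ , y)))
        ≡⟨ ∑-bools _ s (λ t s≢t → ∑-0 (tuples n h) (λ x′ →
             trans (cong (_* m₃ (t , x′) (s′ , y)) (G-off t x′ s≢t)) (ℚₚ.*-zeroˡ (m₃ (t , x′) (s′ , y))))) ⟩
      ∑ (tuples n h) (λ x′ → G (s , x′) * m₃ (s , x′) (s′ , y))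
        ≡⟨ ∑-cong (tuples n h) (λ x′ → cong (_* m₃ (s , x′) (s′ , y)) (G-block (s , x′))) ⟩
      ∑ (tuples n h) (λ x′ → ∑ (tuples n b) (λ y′ → m₁ (s , x) (s , y′) * m₂ (s , x′) (s , y′)) * m₃ (s , x′) (s′ , y)) ∎
      where
      open ≡-Reasoning
      G : Rows → ℚ
      G x′ = ∑ cols (λ y′ → m₁ (s , x) y′ * m₂ x′ y′)
      G-block : ∀ x′ → G x′ ≡ ∑ (tuples n b) (λ y′ → m₁ (s , x) (s , y′) * m₂ x′ (s , y′))
      G-block x′ = trans (∑-cartesianProductWith _,_ bools (tuples n b) _)
        (∑-bools _ s (λ t s≢t → ∑-0 (tuples n b) (λ y′ →
           trans (cong (_* m₂ x′ (t , y′)) (D₁ s t x y′ s≢t)) (ℚₚ.*-zeroˡ (m₂ x′ (t , y′))))))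
      G-off : ∀ t x′ → s ≢ t → G (t , x′) ≡ 0ℚ
      G-off t x′ s≢t = trans (G-block (t , x′)) (∑-0 (tuples n b) (λ y′ →
        trans (cong (m₁ (s , x) (s , y′) *_) (D₂ t s x′ y′ (s≢t ∘ sym))) (ℚₚ.*-zeroʳ (m₁ (s , x) (s , y′)))))

    diag : (Bool → Vec (Fin n) h → Vec (Fin n) b → ℚ) → Mat Rows Cols
    diag g (true  , x) (true  , y) = g true x y
    diag g (false , x) (false , y) = g false x y
    diag g (true  , x) (false , y) = 0ℚ
    diag g (false , x) (true  , y) = 0ℚ

    diag-diagonal : ∀ g → Diagonal (diag g)
    diag-diagonal g true  true  x y s≢s = contradiction refl s≢s
    diag-diagonal g false false x y s≢s = contradiction refl s≢s
    diag-diagonal g true  false x y _   = refl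
    diag-diagonal g false true  x y _   = refl

    diag-on : ∀ g s x y → diag g (s , x) (s , y) ≡ g s x y
    diag-on g true  x y = refl
    diag-on g false x y = refl

    ≗ₘ-diagonal : ∀ {m m′} → Diagonal m → Diagonal m′ → (∀ s x y → m (s , x) (s , y) ≡ m′ (s , x) (s , y)) → m ≗ₘ m′
    ≗ₘ-diagonal D D′ on (s , x) (s′ , y) with s Bool.≟ s′
    ... | yes refl = on s x y
    ... | no s≢s′  = trans (D s s′ x y s≢s′) (sym (D′ s s′ x y s≢s′))

    matches : List (Fin h × Fin b) → Vec (Fin n) h → Vec (Fin n) b → Bool
    matches ps x y = all (λ (i , j) → does (lookup x i Fin.≟ lookup y j)) ps

    matches-sound : ∀ ps x y → matches ps x y ≡ true → ∀ {i j} → (i , j) ∈ ps → lookup x i ≡ lookup y j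
    matches-sound ((i , j) ∷ ps) x y h i∈ with lookup x i Fin.≟ lookup y j
    matches-sound ((i , j) ∷ ps) x y h (here refl) | yes x≡y = x≡y
    matches-sound ((i , j) ∷ ps) x y h (there i∈)  | yes _   = matches-sound ps x y h i∈

    matches-complete : ∀ ps x y → (∀ {i j} → (i , j) ∈ ps → lookup x i ≡ lookup y j) → matches ps x y ≡ true
    matches-complete []             x y same = refl
    matches-complete ((i , j) ∷ ps) x y same with lookup x i Fin.≟ lookup y j
    ... | yes _  = matches-complete ps x y (same ∘ there)
    ... | no x≢y = contradiction (same (here refl)) x≢y

    pattern-matrix : List (Fin h × Fin b) → Mat Rows Cols
    pattern-matrix ps = diag λ _ x y → bit (matches ps x y)

    sum-row : Fin h → Mat Rows Cols → Mat Rows Cols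
    sum-row j m (s , x) y = ∑ (allFin n) (λ w → m (s , x [ j ]≔ w) y)

    sum-col : Fin b → Mat Rows Cols → Mat Rows Cols
    sum-col j m x (s , y) = ∑ (allFin n) (λ w → m x (s , y [ j ]≔ w))

    -- With P x y = [y = x ∘ r], where r enumerates all indices other than j, the matrix P Pᵀ relates
    -- tuples that agree outside j.
    module _ (j : Fin h) (r : Fin b → Fin h) (r≢j : ∀ i → r i ≢ j) (r-onto : ∀ i → i ≢ j → ∃ λ i′ → r i′ ≡ i) where

      row-pattern : List (Fin h × Fin b)
      row-pattern = map (λ i → r i , i) (allFin b)

      sum-row-tern : ∀ m → Diagonal m → tern (pattern-matrix row-pattern) (pattern-matrix row-pattern) m ≗ₘ sum-row j m
      sum-row-tern m D (s , x) (s′ , y) = begin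
        tern P P m (s , x) (s′ , y)
          ≡⟨ tern-diagonal P P m (diag-diagonal _) (diag-diagonal _) s s′ x y ⟩
        ∑ (tuples n h) (λ x′ → ∑ (tuples n b) (λ y′ → P (s , x) (s , y′) * P (s , x′) (s , y′)) * m (s , x′) (s′ , y))
          ≡⟨ ∑-cong (tuples n h) (λ x′ → cong (_* m (s , x′) (s′ , y)) (trans
               (∑-cong (tuples n b) (λ y′ → cong₂ _*_ (diag-on _ s x y′) (diag-on _ s x′ y′)))
               (∑-tuples-single (matches row-pattern x) (bit ∘ matches row-pattern x′) (read r x) (λ u → only u)
                 (matches-complete row-pattern x (read r x) λ i∈ → at-read i∈)))) ⟩
        ∑ (tuples n h) (λ x′ → bit (matches row-pattern x′ (read r x)) * m (s , x′) (s′ , y))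
          ≡⟨ ∑-tuples-line (λ x′ → matches row-pattern x′ (read r x)) (λ x′ → m (s , x′) (s′ , y)) x j sound complete ⟩
        ∑ (allFin n) (λ w → m (s , x [ j ]≔ w) (s′ , y)) ∎
        where
        open ≡-Reasoning
        P = pattern-matrix row-pattern
        ∈-pattern : ∀ i → (r i , i) ∈ row-pattern
        ∈-pattern i = ∈-map⁺ (λ i → r i , i) (∈-allFin i)
        at-read : ∀ {i i′} → (i , i′) ∈ row-pattern → lookup x i ≡ lookup (read r x) i′
        at-read i∈ with ∈-map⁻ (λ i → r i , i) i∈
        ... | i , _ , refl = sym (lookup-read r x i)
        only : ∀ u → matches row-pattern x u ≡ true → u ≡ read r x
        only u h = trans (sym (Vecₚ.tabulate∘lookup u))
          (Vecₚ.tabulate-cong λ i → sym (matches-sound row-pattern x u h (∈-pattern i)))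
        sound : ∀ u → matches row-pattern u (read r x) ≡ true → ∀ i → i ≢ j → lookup u i ≡ lookup x i
        sound u h i i≢j with r-onto i i≢j
        ... | i′ , refl = trans (matches-sound row-pattern u (read r x) h (∈-pattern i′)) (lookup-read r x i′)
        complete : ∀ u → (∀ i → i ≢ j → lookup u i ≡ lookup x i) → matches row-pattern u (read r x) ≡ true
        complete u same = matches-complete row-pattern u (read r x) same′
          where
          same′ : ∀ {i i′} → (i , i′) ∈ row-pattern → lookup u i ≡ lookup (read r x) i′
          same′ i∈ with ∈-map⁻ (λ i → r i , i) i∈
          ... | i , _ , refl = trans (same (r i) (r≢j i)) (sym (lookup-read r x i))

    tern-Diagonal : ∀ {m₁ m₂ m₃} → Diagonal m₁ → Diagonal m₂ → Diagonal m₃ → Diagonal (tern m₁ m₂ m₃)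
    tern-Diagonal {m₁} {m₂} {m₃} D₁ D₂ D₃ s s′ x y s≢s′ = trans (tern-diagonal m₁ m₂ m₃ D₁ D₂ s s′ x y)
      (∑-0 (tuples n h) λ x′ → let g = ∑ (tuples n b) (λ y′ → m₁ (s , x) (s , y′) * m₂ (s , x′) (s , y′)) in
        trans (cong (g *_) (D₃ s s′ x′ y s≢s′)) (ℚₚ.*-zeroʳ g))

    -- The matrix [x′ = y ∘ to] pads columns to rows, so that columns agreeing outside j can be related.
    module _ (j : Fin b) (p : Retraction h b) where

      open Retraction p

      others : List (Fin b)
      others = filter (λ i → ¬? (i Fin.≟ j)) (allFin b)

      pad-pattern line-pattern : List (Fin h × Fin b)
      pad-pattern  = map (λ i → i , to i) (allFin h)
      line-pattern = map (λ i → from i , i) others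

      sum-col-tern : ∀ m → Diagonal m → tern m (pattern-matrix line-pattern) (pattern-matrix pad-pattern) ≗ₘ sum-col j m
      sum-col-tern m D = ≗ₘ-diagonal (tern-Diagonal D (diag-diagonal _) (diag-diagonal _))
        (λ s s′ x y s≢s′ → ∑-0 (allFin n) (λ w → D s s′ x (y [ j ]≔ w) s≢s′)) on
        where
        open ≡-Reasoning
        L P : Mat Rows Cols
        L = pattern-matrix line-pattern
        P = pattern-matrix pad-pattern
        ∈-line : ∀ {i} → i ≢ j → (from i , i) ∈ line-pattern
        ∈-line {i} i≢j = ∈-map⁺ (λ i → from i , i) (∈-filter⁺ (λ i → ¬? (i Fin.≟ j)) (∈-allFin i) i≢j)
        only : ∀ y u → matches pad-pattern u y ≡ true → u ≡ read to y
        only y u h = trans (sym (Vecₚ.tabulate∘lookup u)) (Vecₚ.tabulate-cong λ i →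
          matches-sound pad-pattern u y h (∈-map⁺ (λ i → i , to i) (∈-allFin i)))
        padded : ∀ y → matches pad-pattern (read to y) y ≡ true
        padded y = matches-complete pad-pattern (read to y) y same′
          where
          same′ : ∀ {i i′} → (i , i′) ∈ pad-pattern → lookup (read to y) i ≡ lookup y i′
          same′ i∈ with ∈-map⁻ (λ i → i , to i) i∈
          ... | i , _ , refl = lookup-read to y i
        unpad : ∀ y i → lookup (read to y) (from i) ≡ lookup y i
        unpad y i = trans (lookup-read to y (from i)) (cong (lookup y) (to∘from i))
        sound : ∀ y u → matches line-pattern (read to y) u ≡ true → ∀ i → i ≢ j → lookup u i ≡ lookup y i
        sound y u h i i≢j = trans (sym (matches-sound line-pattern (read to y) u h (∈-line i≢j))) (unpad y i)
        complete : ∀ y u → (∀ i → i ≢ j → lookup u i ≡ lookup y i) → matches line-pattern (read to y) u ≡ true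
        complete y u same = matches-complete line-pattern (read to y) u same′
          where
          same′ : ∀ {i i′} → (i , i′) ∈ line-pattern → lookup (read to y) i ≡ lookup u i′
          same′ i∈ with ∈-map⁻ (λ i → from i , i) i∈
          ... | i , i∈′ , refl = trans (unpad y i) (sym (same i (proj₂ (∈-filter⁻ (λ i → ¬? (i Fin.≟ j)) {xs = allFin b} i∈′))))
        on : ∀ s x y → tern m L P (s , x) (s , y) ≡ sum-col j m (s , x) (s , y)
        on s x y = begin
          tern m L P (s , x) (s , y)
            ≡⟨ tern-diagonal m L P D (diag-diagonal _) s s x y ⟩
          ∑ (tuples n h) (λ x′ → G x′ * P (s , x′) (s , y))
            ≡⟨ ∑-cong (tuples n h) (λ x′ → trans (cong (G x′ *_) (diag-on _ s x′ y)) (ℚₚ.*-comm (G x′) (bit (matches pad-pattern x′ y)))) ⟩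
          ∑ (tuples n h) (λ x′ → bit (matches pad-pattern x′ y) * G x′)
            ≡⟨ ∑-tuples-single (λ x′ → matches pad-pattern x′ y) G (read to y) (only y) (padded y) ⟩
          G (read to y)
            ≡⟨ ∑-cong (tuples n b) (λ y′ → trans (cong (m (s , x) (s , y′) *_) (diag-on _ s (read to y) y′))
                                                 (ℚₚ.*-comm (m (s , x) (s , y′)) (bit (matches line-pattern (read to y) y′)))) ⟩
          ∑ (tuples n b) (λ y′ → bit (matches line-pattern (read to y) y′) * m (s , x) (s , y′))
            ≡⟨ ∑-tuples-line (matches line-pattern (read to y)) (λ y′ → m (s , x) (s , y′)) y j (sound y) (complete y) ⟩
          sum-col j m (s , x) (s , y) ∎
          where
          G : Vec (Fin n) h → ℚ
          G x′ = ∑ (tuples n b) (λ y′ → m (s , x) (s , y′) * L (s , x′) (s , y′))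

  -- Definable matrices and the invariance of formulas

  symbols : ∀ {Sym : Set} {ar : Sym → ℕ} {m} → Form Sym ar m → List Sym
  symbols (eq x y)     = []
  symbols (atom R xs)  = R ∷ []
  symbols (and φ ψ)    = symbols φ ++ symbols ψ
  symbols (neg φ)      = symbols φ
  symbols (ex x φ)     = symbols φ
  symbols (exGE j x φ) = symbols φ

  record Blocks (h b d : ℕ) : Set where
    field
      left right : Fin h → Fin d
      mid        : Fin b → Fin d
      left-injective  : ∀ i j → left i ≡ left j → i ≡ j
      right-injective : ∀ i j → right i ≡ right j → i ≡ j
      mid-injective   : ∀ i j → mid i ≡ mid j → i ≡ j
      left≢right : ∀ i j → left i ≢ right j
      left≢mid   : ∀ i j → left i ≢ mid j
      right≢mid  : ∀ i j → right i ≢ mid j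

  module Invariance {Sym : Set} {ar : Sym → ℕ} {n h b d : ℕ} (𝔄 𝔅 : Structure Sym ar n) (syms : List Sym)
                    (x₀ : Fin d) (blocks : Blocks h b d) where

    open Types 𝔄 𝔅 syms x₀
    open BlockMatrices n h b
    open Blocks blocks

    place : (Fin h → Fin d) → Mat Rows Cols → Point → ℚ
    place pos m (s , α) = m (s , read pos α) (s , read mid α)

    -- With `x` in block `pos` and `y` in `mid`, the outer sum writes `x′` to `pos′`, and `m₃ x′ y`
    -- is read at once. From then on `y` is dispensable, so the inner sum overwrites `mid` with
    -- `y′`. This is why three blocks of variables suffice.
    tern-respects : ∀ {q m₁ m₂ m₃} (pos pos′ : Fin h → Fin d) → (∀ i j → pos′ i ≡ pos′ j → i ≡ j) →
      (∀ i j → pos i ≢ pos′ j) → (∀ i j → pos i ≢ mid j) → (∀ i j → pos′ i ≢ mid j) →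
      Diagonal m₁ → Diagonal m₂ →
      Respects q (place pos m₁) → Respects q (place pos′ m₂) → Respects q (place pos′ m₃) →
      Respects (h ℕ.+ (b ℕ.+ q)) (place pos (tern m₁ m₂ m₃))
    tern-respects {q} {m₁} {m₂} {m₃} pos pos′ inj′ pos≢pos′ pos≢mid pos′≢mid D₁ D₂ R₁ R₂ R₃ {t} {t′} t≈t′ =
      trans (compute t) (trans (block-sum-respects f₃ (Vec.tabulate pos′) R-f₃ t≈t′) (sym (compute t′)))
      where
      f₁ f₂ f₃ : Point → ℚ
      f₁ t = place pos m₁ t * place pos′ m₂ t
      f₂ (s , α) = ∑ (tuples n b) (λ y → f₁ (s , write mid y α))
      f₃ t = f₂ t * place pos′ m₃ t
      R-f₁ : Respects q f₁
      R-f₁ t≈t′ = cong₂ _*_ (R₁ t≈t′) (R₂ t≈t′)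
      R-f₃ : Respects (b ℕ.+ q) f₃
      R-f₃ t≈t′ = cong₂ _*_ (block-sum-respects f₁ (Vec.tabulate mid) R-f₁ t≈t′) (R₃ (≈-mono (ℕₚ.m≤n+m q b) t≈t′))
      compute : ∀ t → place pos (tern m₁ m₂ m₃) t ≡ ∑ (tuples n h) (λ x → f₃ (proj₁ t , write pos′ x (proj₂ t)))
      compute (s , α) = trans (tern-diagonal m₁ m₂ m₃ D₁ D₂ s s (read pos α) (read mid α))
        (∑-cong (tuples n h) λ x′ → cong₂ _*_
          (∑-cong (tuples n b) λ y′ → let β = write pos′ x′ α in cong₂ _*_
            (cong₂ (λ u v → m₁ (s , u) (s , v))
              (sym (trans (read-write-miss pos mid pos≢mid y′ β) (read-write-miss pos pos′ pos≢pos′ x′ α)))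
              (sym (read-write-hit mid mid-injective y′ β)))
            (cong₂ (λ u v → m₂ (s , u) (s , v))
              (sym (trans (read-write-miss pos′ mid pos′≢mid y′ β) (read-write-hit pos′ inj′ x′ α)))
              (sym (read-write-hit mid mid-injective y′ β))))
          (cong₂ (λ u v → m₃ (s , u) (s , v))
            (sym (read-write-hit pos′ inj′ x′ α))
            (sym (read-write-miss mid pos′ (λ i j p → pos′≢mid j i (sym p)) x′ α))))

    -- Block-diagonal matrices whose entries are determined by the rank-q type of the points, whether
    -- the row index is stored in the left or in the right block of variables.
    record Definable (q : ℕ) (m : Mat Rows Cols) : Set where
      constructor definable
      field
        diagonal      : Diagonal m
        respectsˡ : Respects q (place left m)
        respectsʳ : Respects q (place right m)
    open Definable

    definable-space : ∀ q → IsMatrixSpace (Definable q)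
    definable-space q = record
      { ext    = λ {m} {m′} m≗m′ V → definable
          (λ s s′ x y s≢s′ → trans (sym (m≗m′ (s , x) (s′ , y))) (diagonal V s s′ x y s≢s′))
          (λ t≈t′ → trans (sym (m≗m′ _ _)) (trans (respectsˡ V t≈t′) (m≗m′ _ _)))
          (λ t≈t′ → trans (sym (m≗m′ _ _)) (trans (respectsʳ V t≈t′) (m≗m′ _ _)))
      ; zero∈  = definable (λ _ _ _ _ _ → refl) (λ _ → refl) (λ _ → refl)
      ; add    = λ V V′ → definable
          (λ s s′ x y s≢s′ → trans (cong₂ _+_ (diagonal V s s′ x y s≢s′) (diagonal V′ s s′ x y s≢s′)) (ℚₚ.+-identityˡ 0ℚ))
          (λ t≈t′ → cong₂ _+_ (respectsˡ V t≈t′) (respectsˡ V′ t≈t′))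
          (λ t≈t′ → cong₂ _+_ (respectsʳ V t≈t′) (respectsʳ V′ t≈t′))
      ; scale  = λ c V → definable
          (λ s s′ x y s≢s′ → trans (cong (c *_) (diagonal V s s′ x y s≢s′)) (ℚₚ.*-zeroʳ c))
          (λ t≈t′ → cong (c *_) (respectsˡ V t≈t′))
          (λ t≈t′ → cong (c *_) (respectsʳ V t≈t′))
      ; stable = λ ¬¬V → definable
          (λ s s′ x y s≢s′ → ≟-stable (¬¬V >>= λ V → return (diagonal V s s′ x y s≢s′)))
          (λ t≈t′ → ≟-stable (¬¬V >>= λ V → return (respectsˡ V t≈t′)))
          (λ t≈t′ → ≟-stable (¬¬V >>= λ V → return (respectsʳ V t≈t′)))
      }

    definable-mono : ∀ {q r m} → q ℕ.≤ r → Definable q m → Definable r m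
    definable-mono q≤r V = definable (diagonal V) (λ t≈t′ → respectsˡ V (≈-mono q≤r t≈t′)) (λ t≈t′ → respectsʳ V (≈-mono q≤r t≈t′))

    -- The second and third factors are read in the block opposite to that of the result. Each
    -- condition for the product therefore draws on both conditions for the factors.
    tern-definable : ∀ {q m₁ m₂ m₃} → Definable q m₁ → Definable q m₂ → Definable q m₃ →
                     Definable (h ℕ.+ b ℕ.+ q) (tern m₁ m₂ m₃)
    tern-definable {q} {m₁} {m₂} {m₃} V₁ V₂ V₃ = definable
      (tern-Diagonal (diagonal V₁) (diagonal V₂) (diagonal V₃))
      (λ {t} {t′} t≈t′ → tern-respects {q} {m₁} {m₂} {m₃} left right right-injective left≢right left≢mid right≢mid (diagonal V₁) (diagonal V₂)
         (respectsˡ V₁) (respectsʳ V₂) (respectsʳ V₃) {t} {t′} (subst (λ r → t ≈[ r ] t′) (ℕₚ.+-assoc h b q) t≈t′))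
      (λ {t} {t′} t≈t′ → tern-respects {q} {m₁} {m₂} {m₃} right left left-injective (λ i j p → left≢right j i (sym p)) right≢mid left≢mid (diagonal V₁) (diagonal V₂)
         (respectsʳ V₁) (respectsˡ V₂) (respectsˡ V₃) {t} {t′} (subst (λ r → t ≈[ r ] t′) (ℕₚ.+-assoc h b q) t≈t′))

    Invariant : {A : Set} → ℕ → (Bool → Vec (Fin n) h → Vec (Fin n) b → A) → Set
    Invariant q g = Respects q (λ (s , α) → g s (read left α) (read mid α))
                  × Respects q (λ (s , α) → g s (read right α) (read mid α))

    diag-definable : ∀ {q} (g : Bool → Vec (Fin n) h → Vec (Fin n) b → Bool) → Invariant q g →
                     Definable q (diag λ s x y → bit (g s x y))
    diag-definable {q} g (Rˡ , Rʳ) = definable (diag-diagonal _) (on left Rˡ) (on right Rʳ)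
      where
      on : ∀ pos → Respects q (λ (s , α) → g s (read pos α) (read mid α)) →
           Respects q (place pos (diag λ s x y → bit (g s x y)))
      on pos R {s , α} {s′ , β} t≈t′ = trans (diag-on _ s (read pos α) (read mid α))
        (trans (cong bit (R t≈t′)) (sym (diag-on _ s′ (read pos β) (read mid β))))

    respects-equality : ∀ {t t′} → t ≈[ 0 ] t′ → ∀ x y →
      does (lookup (proj₂ t) x Fin.≟ lookup (proj₂ t) y) ≡ does (lookup (proj₂ t′) x Fin.≟ lookup (proj₂ t′) y)
    respects-equality t≈t′ x y = _≈[_]_.same t≈t′ (∈-++⁺ˡ (∈-cartesianProductWith⁺ eq (∈-allFin x) (∈-allFin y)))

    pattern-definable : ∀ q ps → Definable q (pattern-matrix ps)
    pattern-definable q ps = diag-definable (λ _ → matches ps) ((λ t≈t′ → on left ps (≈-mono z≤n t≈t′)) , (λ t≈t′ → on right ps (≈-mono z≤n t≈t′)))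
      where
      on : ∀ pos ps → Respects 0 (λ (s , α) → matches ps (read pos α) (read mid α))
      on pos []             t≈t′ = refl
      on pos ((i , j) ∷ ps) {s , α} {s′ , β} t≈t′ = cong₂ _∧_
        (trans (cong₂ (λ u v → does (u Fin.≟ v)) (lookup-read pos α i) (lookup-read mid α j))
          (trans (respects-equality t≈t′ (pos i) (mid j))
            (sym (cong₂ (λ u v → does (u Fin.≟ v)) (lookup-read pos β i) (lookup-read mid β j)))))
        (on pos ps t≈t′)

    embed : (Fin h → Fin d) → Fin (h ℕ.+ b) → Fin d
    embed pos i = [ pos , mid ]′ (Fin.splitAt h i)

    lookup-embed : ∀ pos (α : Vec (Fin n) d) i → lookup (read pos α Vec.++ read mid α) i ≡ lookup α (embed pos i)
    lookup-embed pos α i = trans (Vecₚ.lookup-splitAt h (read pos α) (read mid α) i) (on (Fin.splitAt h i))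
      where
      on : ∀ k → [ lookup (read pos α) , lookup (read mid α) ]′ k ≡ lookup α ([ pos , mid ]′ k)
      on (inj₁ j) = lookup-read pos α j
      on (inj₂ j) = lookup-read mid α j

    value : Form Sym ar (h ℕ.+ b) → Bool → Vec (Fin n) h → Vec (Fin n) b → Bool
    value θ s x y = eval (str s) θ (total (str s) (x Vec.++ y))

    counts : Fin (h ℕ.+ b) → Form Sym ar (h ℕ.+ b) → Bool → Vec (Fin n) h → Vec (Fin n) b → ℕ
    counts i θ s x y = countTrue (λ a → eval (str s) θ (total (str s) ((x Vec.++ y) [ i ]≔ a)))

    module Closed (q : ℕ) (closed : ∀ {m₁ m₂ m₃} → Definable q m₁ → Definable q m₂ → Definable q m₃ → Definable q (tern m₁ m₂ m₃))
      (rs : ∀ j → Σ (Fin b → Fin h) λ r → (∀ i → r i ≢ j) × (∀ i → i ≢ j → ∃ λ i′ → r i′ ≡ i))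
      (p : Retraction h b) where

      sum-row-definable : ∀ j {m} → Definable q m → Definable q (sum-row j m)
      sum-row-definable j {m} V = let r , r≢j , onto = rs j in
        IsMatrixSpace.ext (definable-space q) (sum-row-tern j r r≢j onto m (diagonal V))
          (closed (pattern-definable q (row-pattern j r r≢j onto)) (pattern-definable q (row-pattern j r r≢j onto)) V)

      sum-col-definable : ∀ j {m} → Definable q m → Definable q (sum-col j m)
      sum-col-definable j {m} V = IsMatrixSpace.ext (definable-space q) (sum-col-tern j p m (diagonal V))
        (closed V (pattern-definable q (line-pattern j p)) (pattern-definable q (pad-pattern j p)))

      -- Summing the 0/1 matrix of `θ` along a coordinate gives the matrix of counts. Closure keeps
      -- it at level `q`, so a quantifier does not raise the rank; `ι-injective` recovers the
      -- natural numbers.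
      count-invariant : ∀ θ → Invariant q (value θ) → ∀ i →
        Invariant q (counts i θ)
      count-invariant θ inv i with Fin.splitAt h i in split
      ... | inj₁ j = on left (respectsˡ V) , on right (respectsʳ V)
        where
        V = sum-row-definable j (diag-definable (value θ) inv)
        sums : ∀ s x y → sum-row j (diag λ s x y → bit (value θ s x y)) (s , x) (s , y) ≡
          ι (counts i θ s x y)
        sums s x y = trans (∑-cong (allFin n) λ a → trans (diag-on _ s (x [ j ]≔ a) y)
            (cong (λ v → bit (eval (str s) θ (total (str s) v)))
              (trans (sym (Vecₚ.[]≔-++-↑ˡ x y j)) (cong (λ k → (x Vec.++ y) [ k ]≔ a) (Finₚ.splitAt⁻¹-↑ˡ split)))))
          (ι-countTrue (λ a → eval (str s) θ (total (str s) ((x Vec.++ y) [ i ]≔ a))))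
        on : ∀ pos → Respects q (place pos (sum-row j (diag λ s x y → bit (value θ s x y)))) →
          Respects q (λ (s , α) → counts i θ s (read pos α) (read mid α))
        on pos R {s , α} {s′ , β} t≈t′ = ι-injective _ _ (trans (sym (sums s (read pos α) (read mid α)))
          (trans (R t≈t′) (sums s′ (read pos β) (read mid β))))
      ... | inj₂ j = on left (respectsˡ V) , on right (respectsʳ V)
        where
        V = sum-col-definable j (diag-definable (value θ) inv)
        sums : ∀ s x y → sum-col j (diag λ s x y → bit (value θ s x y)) (s , x) (s , y) ≡
          ι (counts i θ s x y)
        sums s x y = trans (∑-cong (allFin n) λ a → trans (diag-on _ s x (y [ j ]≔ a))
            (cong (λ v → bit (eval (str s) θ (total (str s) v)))
              (trans (sym (Vecₚ.[]≔-++-↑ʳ x y j)) (cong (λ k → (x Vec.++ y) [ k ]≔ a) (Finₚ.splitAt⁻¹-↑ʳ split)))))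
          (ι-countTrue (λ a → eval (str s) θ (total (str s) ((x Vec.++ y) [ i ]≔ a))))
        on : ∀ pos → Respects q (place pos (sum-col j (diag λ s x y → bit (value θ s x y)))) →
          Respects q (λ (s , α) → counts i θ s (read pos α) (read mid α))
        on pos R {s , α} {s′ , β} t≈t′ = ι-injective _ _ (trans (sym (sums s (read pos α) (read mid α)))
          (trans (R t≈t′) (sums s′ (read pos β) (read mid β))))

      map-invariant : ∀ {A : Set} (g : Bool → Vec (Fin n) h → Vec (Fin n) b → A) {g′ : Bool → Vec (Fin n) h → Vec (Fin n) b → Bool}
        (f : A → Bool) → (∀ s x y → g′ s x y ≡ f (g s x y)) → Invariant q g → Invariant q g′
      map-invariant g f g′≡ (Rˡ , Rʳ) =
        (λ t≈t′ → trans (g′≡ _ _ _) (trans (cong f (Rˡ t≈t′)) (sym (g′≡ _ _ _)))) ,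
        (λ t≈t′ → trans (g′≡ _ _ _) (trans (cong f (Rʳ t≈t′)) (sym (g′≡ _ _ _))))

      -- The level `q` stays fixed through the whole induction, however deep the quantifiers of `θ`
      -- are nested.
      formula-invariant : ∀ θ → (∀ {R} → R ∈ symbols θ → R ∈ syms) → Invariant q (value θ)
      formula-invariant (eq x y) R∈ = on left , on right
        where
        on : ∀ pos → Respects q (λ (s , α) → value (eq x y) s (read pos α) (read mid α))
        on pos {s , α} {s′ , β} t≈t′ = trans
          (cong₂ (λ u v → does (u Fin.≟ v)) (lookup-embed pos α x) (lookup-embed pos α y)) (trans
          (respects-equality (≈-mono z≤n t≈t′) (embed pos x) (embed pos y))
          (sym (cong₂ (λ u v → does (u Fin.≟ v)) (lookup-embed pos β x) (lookup-embed pos β y))))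
      formula-invariant (atom R xs) R∈ = on left , on right
        where
        on : ∀ pos → Respects q (λ (s , α) → value (atom R xs) s (read pos α) (read mid α))
        on pos {s , α} {s′ , β} t≈t′ = trans (atom≡ s α) (trans
            (_≈[_]_.same (≈-mono {0} z≤n t≈t′) (∈-++⁺ʳ equations (∈-concatMap⁺ _ (Any.map (λ { refl →
               ∈-map⁺ (λ v → atom R (lookup v)) (∈-vecs ∈-allFin args) }) (R∈ (here refl))))))
            (sym (atom≡ s′ β)))
          where
          args = Vec.tabulate (embed pos ∘ xs)
          atom≡ : ∀ s α → value (atom R xs) s (read pos α) (read mid α) ≡ ev (atom R (lookup args)) (s , α)
          atom≡ s α = eval-atom (str s) R xs (lookup args) (total (str s) (read pos α Vec.++ read mid α)) (total (str s) α) λ i → cong just (trans (lookup-embed pos α (xs i))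
            (cong (lookup α) (sym (Vecₚ.lookup∘tabulate (embed pos ∘ xs) i))))
      formula-invariant (and φ ψ) R∈ =
        let φˡ , φʳ = formula-invariant φ (R∈ ∘ ∈-++⁺ˡ)
            ψˡ , ψʳ = formula-invariant ψ (R∈ ∘ ∈-++⁺ʳ (symbols φ))
        in (λ t≈t′ → cong₂ _∧_ (φˡ t≈t′) (ψˡ t≈t′)) , (λ t≈t′ → cong₂ _∧_ (φʳ t≈t′) (ψʳ t≈t′))
      formula-invariant (neg φ) R∈ = map-invariant (value φ) not (λ _ _ _ → refl) (formula-invariant φ R∈)
      formula-invariant (ex i φ) R∈ = map-invariant (counts i φ) (1 ≤ᵇ_)
        (λ s x y → trans (eval-ex (str s) i φ (x Vec.++ y)) (anyFin≡1≤count (λ a → eval (str s) φ (total (str s) ((x Vec.++ y) [ i ]≔ a)))))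
        (count-invariant φ (formula-invariant φ R∈) i)
      formula-invariant (exGE j i φ) R∈ = map-invariant (counts i φ) (j ≤ᵇ_)
        (λ s x y → eval-exGE (str s) j i φ (x Vec.++ y))
        (count-invariant φ (formula-invariant φ R∈) i)

-- Block sizes and the arithmetic of the rank

open import Data.Nat using (_+_; _*_; _^_; _≤_; _<_; _/_; _%_)
open ℕ-Solver.+-*-Solver using (solve; _:+_; _:*_; con; _:=_)

two-blocks : ∀ h b → Blocks h b (h + (b + h))
two-blocks h b = record
  { left  = λ i → i Fin.↑ˡ (b + h)
  ; right = λ i → h Fin.↑ʳ (b Fin.↑ʳ i)
  ; mid   = λ i → h Fin.↑ʳ (i Fin.↑ˡ h)
  ; left-injective  = Finₚ.↑ˡ-injective (b + h)
  ; right-injective = λ i j p → Finₚ.↑ʳ-injective b i j (Finₚ.↑ʳ-injective h _ _ p)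
  ; mid-injective   = λ i j p → Finₚ.↑ˡ-injective h i j (Finₚ.↑ʳ-injective h _ _ p)
  ; left≢right = λ i j → ↑ˡ≢↑ʳ h i (b Fin.↑ʳ j)
  ; left≢mid   = λ i j → ↑ˡ≢↑ʳ h i (j Fin.↑ˡ h)
  ; right≢mid  = λ i j p → ↑ˡ≢↑ʳ b j i (sym (Finₚ.↑ʳ-injective h _ _ p))
  }
  where
  ↑ˡ≢↑ʳ : ∀ m {n} (i : Fin m) (j : Fin n) → i Fin.↑ˡ n ≢ m Fin.↑ʳ j
  ↑ˡ≢↑ʳ m {n} i j p with trans (sym (Finₚ.splitAt-↑ˡ m i n)) (trans (cong (Fin.splitAt m) p) (Finₚ.splitAt-↑ʳ m n j))
  ... | ()

-- `punchIn j` lists the indices other than `j`; the retraction adapts the length of this list to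
-- `b`.
avoid : ∀ {h b} → Retraction b h → ∀ (j : Fin (suc h)) →
  Σ (Fin b → Fin (suc h)) λ r → (∀ i → r i ≢ j) × (∀ i → i ≢ j → ∃ λ i′ → r i′ ≡ i)
avoid p j = Fin.punchIn j ∘ to , (λ i → Finₚ.punchInᵢ≢i j (to i)) , λ i i≢j →
  from (Fin.punchOut (i≢j ∘ sym)) , trans (cong (Fin.punchIn j) (to∘from _)) (Finₚ.punchIn-punchOut (i≢j ∘ sym))
  where open Retraction p

sentence-value : ∀ {Sym : Set} {ar : Sym → ℕ} {n m} (S : Structure Sym ar n) (φ : Form Sym ar m) → Sentence φ →
  ∀ α → eval S φ α ≡ eval S φ (λ _ → nothing)
sentence-value S φ sentence α = eval-agree S φ α (λ _ → nothing) λ z free-z →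
  contradiction (trans (sym free-z) (sentence z)) λ ()

-- Either the closed type of `α₀` separates the structures, or `𝔅` has a point of that type, at
-- which `φ` would keep its value from `𝔄`. Any `α₀` serves, as `φ` is a sentence. Rows are
-- `suc h`-tuples here.
bounded-rank : ∀ {Sym : Set} {ar : Sym → ℕ} {n h b} (𝔄 𝔅 : Structure Sym ar (suc n)) →
  Retraction (suc h) b → Retraction b h → (φ : Form Sym ar (suc h + b)) →
  Sentence φ → 𝔄 ⊨ φ → ¬ (𝔅 ⊨ φ) → ∀ j →
  (2 * suc n ^ suc h) * (2 * suc n ^ b) < 2 ^ j →
  Σ (Form Sym ar (suc h + (b + suc h))) λ ψ → Sentence ψ ×
    qr ψ ≤ (suc h + (b + suc h)) + suc (2 * suc n ^ suc h + 2 * suc n ^ b) * (j * (suc h + b)) ×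
    𝔄 ⊨ ψ × ¬ (𝔅 ⊨ ψ)
bounded-rank {n = n} {h} {b} 𝔄 𝔅 p p′ φ sentence 𝔄⊨φ 𝔅⊭φ j long with distinguish Q α₀
  where
  open Types 𝔄 𝔅 (symbols φ) (Fin.zero {h + (b + suc h)})
  Q = suc (2 * suc n ^ suc h + 2 * suc n ^ b) * (j * (suc h + b))
  α₀ = Vec.replicate (suc h + (b + suc h)) (Fin.zero {n})
... | inj₁ distinguished = distinguished
-- The goal is `⊥`, so the doubly negated result of `closed-level` may be used as if it were given.
... | inj₂ (β , α₀≈β) = ⊥-elim (closed-level j long′ λ (q , q≤Q , closed) →
    let inv = proj₁ (Closed.formula-invariant q closed (avoid p′) p φ id) (≈-mono (ℕₚ.≤-trans q≤Q (ℕₚ.≤-reflexive sizes)) α₀≈β)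
    in 𝔅⊭φ (trans (sym (sentence-value 𝔅 φ sentence _)) (trans (sym inv) (trans (sentence-value 𝔄 φ sentence _) 𝔄⊨φ))))
  where
  open Types 𝔄 𝔅 (symbols φ) (Fin.zero {h + (b + suc h)})
  open BlockMatrices (suc n) (suc h) b using (rows; cols; cover-rows; cover-cols)
  open Invariance 𝔄 𝔅 (symbols φ) (Fin.zero {h + (b + suc h)}) (two-blocks (suc h) b)
  open Generation cover-rows cover-cols
  open Levels Definable definable-space definable-mono (suc h + b) tern-definable
  size : ∀ k → length (cartesianProduct bools (tuples (suc n) k)) ≡ 2 * suc n ^ k
  size k = trans (length-cartesianProductWith _,_ bools (tuples (suc n) k)) (cong (2 *_)
    (trans (length-vecs (allFin (suc n)) k) (cong (_^ k) (Listₚ.length-tabulate {n = suc n} id))))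
  sizes : suc (length rows + length cols) * (j * (suc h + b)) ≡
          suc (2 * suc n ^ suc h + 2 * suc n ^ b) * (j * (suc h + b))
  sizes = cong₂ (λ r c → suc (r + c) * (j * (suc h + b))) (size (suc h)) (size b)
  suc-word-length : ∀ j → suc (word-length j) ≡ 2 ^ j
  suc-word-length zero    = refl
  suc-word-length (suc j) = trans (sym (ℕₚ.+-suc (suc (word-length j)) (word-length j))) (cong₂ _+_ (suc-word-length j)
    (trans (suc-word-length j) (sym (ℕₚ.+-identityʳ (2 ^ j)))))
  long′ : length rows * length cols ≤ word-length j
  long′ = ℕₚ.≤-pred (subst₂ _<_ (sym (cong₂ _*_ (size (suc h)) (size b))) (sym (suc-word-length j)) long)

n≤2^1+log : ∀ n → n ≤ 2 ^ suc ⌊log₂ n ⌋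
n≤2^1+log n = ℕₚ.≮⇒≥ λ 2^<n → ℕₚ.<-irrefl refl
  (subst (_≤ ⌊log₂ n ⌋) (⌊log₂[2^n]⌋≡n (suc ⌊log₂ n ⌋)) (⌊log₂⌋-mono-≤ (ℕₚ.<⇒≤ 2^<n)))

-- The two factors 2 give 4, raised to `8 = 2 ^ 3` for strictness, and each power of `n` is at most
-- `2 ^ (h * ℓ)`. Strictness is needed because `word-length j` is `2 ^ j − 1`.
word-bound : ∀ n h b ℓ → 1 ≤ n → b ≤ h → n ≤ 2 ^ ℓ →
  (2 * n ^ h) * (2 * n ^ b) < 2 ^ (3 + 2 * (h * ℓ))
word-bound n@(suc _) h b ℓ 1≤n b≤h n≤2^ℓ = begin-strict
  (2 * n ^ h) * (2 * n ^ b)     ≤⟨ ℕₚ.*-mono-≤ (ℕₚ.*-monoʳ-≤ 2 n^h≤) (ℕₚ.*-monoʳ-≤ 2 (ℕₚ.≤-trans (ℕₚ.^-monoʳ-≤ n b≤h) n^h≤)) ⟩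
  (2 * P) * (2 * P)             ≡⟨ solve 1 (λ p → (con 2 :* p) :* (con 2 :* p) := con 4 :* (p :* p)) refl P ⟩
  4 * (P * P)                     <⟨ ℕₚ.*-monoˡ-< (P * P) {{ℕ.>-nonZero (ℕₚ.*-mono-≤ P≥1 P≥1)}} (ℕₚ.m≤m+n 5 3) ⟩
  8 * (P * P)                     ≡⟨ cong (8 *_) (sym (ℕₚ.^-distribˡ-+-* 2 (h * ℓ) (h * ℓ))) ⟩
  8 * 2 ^ (h * ℓ + h * ℓ)     ≡⟨ cong (λ e → 8 * 2 ^ e) (solve 1 (λ p → p :+ p := con 2 :* p) refl (h * ℓ)) ⟩
  8 * 2 ^ (2 * (h * ℓ))         ≡⟨ ℕₚ.^-distribˡ-+-* 2 3 (2 * (h * ℓ)) ⟨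
  2 ^ (3 + 2 * (h * ℓ))         ∎
  where
  open ℕₚ.≤-Reasoning
  P = 2 ^ (h * ℓ)
  P≥1 : 1 ≤ P
  P≥1 = ℕₚ.m^n>0 2 (h * ℓ)
  n^h≤ : n ^ h ≤ P
  n^h≤ = ℕₚ.≤-trans (ℕₚ.^-monoˡ-≤ h n≤2^ℓ) (ℕₚ.≤-reflexive (trans (ℕₚ.^-*-assoc 2 ℓ h) (cong (2 ^_) (ℕₚ.*-comm ℓ h))))

-- The constant is `3 + 5 * 5 * 2`: at most `3 k` quantifiers for the existential closure, `5 N`
-- stages, `5 k ℓ` doublings per stage, and `2 k` for one ternary product.
rank-bound : ∀ k h b N M ℓ → 1 ≤ k → h ≤ k → h + b ≡ suc k → 1 ≤ N → M ≤ N → 1 ≤ ℓ →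
  (h + (b + h)) + suc (2 * N + 2 * M) * ((3 + 2 * (h * ℓ)) * (h + b)) ≤
  53 * (k ^ 2) * N * ℓ
rank-bound k h b N M ℓ 1≤k h≤k h+b≡ 1≤N M≤N 1≤ℓ = begin
  (h + (b + h)) + suc (2 * N + 2 * M) * ((3 + 2 * (h * ℓ)) * (h + b))
    ≤⟨ ℕₚ.+-mono-≤ vars (ℕₚ.*-mono-≤ stages (ℕₚ.*-mono-≤ depth h+b≤2k)) ⟩
  3 * k + (5 * N) * ((5 * (k * ℓ)) * (2 * k))
    ≤⟨ ℕₚ.+-monoˡ-≤ _ (ℕₚ.*-monoʳ-≤ 3 k≤) ⟩
  3 * (k * (k * N * ℓ)) + (5 * N) * ((5 * (k * ℓ)) * (2 * k))
    ≡⟨ solve 3 (λ k N ℓ → con 3 :* (k :* (k :* N :* ℓ)) :+ (con 5 :* N) :* ((con 5 :* (k :* ℓ)) :* (con 2 :* k))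
                 := con 53 :* (k :* (k :* con 1)) :* N :* ℓ) refl k N ℓ ⟩
  53 * (k ^ 2) * N * ℓ ∎
  where
  open ℕₚ.≤-Reasoning
  h+b≤2k : h + b ≤ 2 * k
  h+b≤2k = ℕₚ.≤-trans (ℕₚ.≤-reflexive h+b≡) (ℕₚ.≤-trans (ℕₚ.+-monoˡ-≤ k 1≤k) (ℕₚ.≤-reflexive (cong (k +_) (sym (ℕₚ.+-identityʳ k)))))
  vars : h + (b + h) ≤ 3 * k
  vars = begin
    h + (b + h)   ≡⟨ sym (ℕₚ.+-assoc h b h) ⟩
    (h + b) + h   ≤⟨ ℕₚ.+-mono-≤ h+b≤2k h≤k ⟩
    2 * k + k     ≡⟨ solve 1 (λ k → con 2 :* k :+ k := con 3 :* k) refl k ⟩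
    3 * k           ∎
  stages : suc (2 * N + 2 * M) ≤ 5 * N
  stages = begin
    1 + (2 * N + 2 * M)   ≤⟨ ℕₚ.+-mono-≤ 1≤N (ℕₚ.+-monoʳ-≤ (2 * N) (ℕₚ.*-monoʳ-≤ 2 M≤N)) ⟩
    N + (2 * N + 2 * N)   ≡⟨ solve 1 (λ n → n :+ (con 2 :* n :+ con 2 :* n) := con 5 :* n) refl N ⟩
    5 * N ∎
  depth : 3 + 2 * (h * ℓ) ≤ 5 * (k * ℓ)
  depth = begin
    3 + 2 * (h * ℓ)                   ≤⟨ ℕₚ.+-mono-≤ (ℕₚ.*-monoʳ-≤ 3 (ℕₚ.*-mono-≤ 1≤k 1≤ℓ)) (ℕₚ.*-monoʳ-≤ 2 (ℕₚ.*-monoˡ-≤ ℓ h≤k)) ⟩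
    3 * (k * ℓ) + 2 * (k * ℓ)     ≡⟨ solve 1 (λ p → con 3 :* p :+ con 2 :* p := con 5 :* p) refl (k * ℓ) ⟩
    5 * (k * ℓ) ∎
  k≤ : k ≤ k * (k * N * ℓ)
  k≤ = begin
    k                          ≡⟨ sym (ℕₚ.*-identityʳ k) ⟩
    k * 1                    ≤⟨ ℕₚ.*-monoʳ-≤ k (ℕₚ.*-mono-≤ (ℕₚ.*-mono-≤ 1≤k 1≤N) 1≤ℓ) ⟩
    k * (k * N * ℓ)      ∎

-- Here `b` is `⌈k/2⌉`, and `(3 * (k + 1) + 1) / 2` is `3 (k + 1) / 2` rounded up. By `half≤b` a
-- column can list all row coordinates but one; by `b≤1+half` columns can be padded to rows.
record Halves (k : ℕ) : Set where
  field
    b         : ℕ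
    total-k   : suc k ≡ suc (k / 2) + b
    total-d   : (3 * (k + 1) + 1) / 2 ≡ suc (k / 2) + (b + suc (k / 2))
    half≤b    : k / 2 ≤ b
    b≤1+half  : b ≤ suc (k / 2)

halves : ∀ k → Halves k
halves k with k % 2 | m≡m%n+[m/n]*n k 2 | m%n<n k 2
... | 0 | k≡ | _ = record
  { b = e ; half≤b = ℕₚ.≤-refl ; b≤1+half = ℕₚ.n≤1+n e
  ; total-k = cong suc (trans k≡ (solve 1 (λ e → e :* con 2 := e :+ e) refl e))
  ; total-d = trans (cong (λ k → (3 * (k + 1) + 1) / 2) k≡) (trans
      (cong (_/ 2) (solve 1 (λ e → con 3 :* (e :* con 2 :+ con 1) :+ con 1
                                    := (con 1 :+ e :+ (e :+ (con 1 :+ e))) :* con 2) refl e))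
      (m*n/n≡m (suc e + (e + suc e)) 2))
  }
  where e = k / 2
... | 1 | k≡ | _ = record
  { b = suc e ; half≤b = ℕₚ.n≤1+n e ; b≤1+half = ℕₚ.≤-refl
  ; total-k = cong suc (trans k≡ (solve 1 (λ e → con 1 :+ e :* con 2 := e :+ (con 1 :+ e)) refl e))
  ; total-d = trans (cong (λ k → (3 * (k + 1) + 1) / 2) k≡) (trans
      (cong (_/ 2) (solve 1 (λ e → con 3 :* ((con 1 :+ e :* con 2) :+ con 1) :+ con 1
                                    := con 1 :+ (con 1 :+ e :+ ((con 1 :+ e) :+ (con 1 :+ e))) :* con 2) refl e)) (trans
      (+-distrib-/-∣ʳ 1 {d = 2} (divides (suc e + (suc e + suc e)) refl))
      (m*n/n≡m (suc e + (suc e + suc e)) 2)))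
  }
  where e = k / 2
... | suc (suc _) | _ | s≤s (s≤s ())

-- The empty universe

allAssigned-nothing : ∀ {Sym : Set} {ar : Sym → ℕ} {n} (S : Structure Sym ar n) {l} (f : Fin l → Maybe (Fin n)) i →
  f i ≡ nothing → allAssigned S f ≡ nothing
allAssigned-nothing S f Fin.zero    none with f Fin.zero
... | nothing = refl
allAssigned-nothing S f (Fin.suc i) none
  with f Fin.zero | allAssigned S (f ∘ Fin.suc) | allAssigned-nothing S (f ∘ Fin.suc) i none
... | just _  | .nothing | refl = refl
... | nothing | .nothing | refl = refl

fin? : ∀ l → Fin l ⊎ ¬ Fin l
fin? zero    = inj₂ λ ()
fin? (suc l) = inj₁ Fin.zero

module _ {Sym : Set} {ar : Sym → ℕ} (𝔄 𝔅 : Structure Sym ar 0) where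

  eval-atom-empty : ∀ (S : Structure Sym ar 0) {m} R (xs : Fin (ar R) → Fin m) (α : Assign S m) →
    Fin (ar R) → eval S (atom R xs) α ≡ false
  eval-atom-empty S R xs α i with allAssigned S (α ∘ xs) | allAssigned-nothing S (α ∘ xs) i (no-element (α (xs i)))
    where
    no-element : (a : Maybe (Fin 0)) → a ≡ nothing
    no-element nothing = refl
  ... | .nothing | refl = refl

  -- Over the empty universe, only propositional atoms can be told apart.
  differing-atom : ∀ {m} (φ : Form Sym ar m) (α : Fin m → Maybe (Fin 0)) → eval 𝔄 φ α ≢ eval 𝔅 φ α →
    Σ Sym λ R → ¬ Fin (ar R) × (∀ {m′} (xs : Fin (ar R) → Fin m′) α′ → eval 𝔄 (atom R xs) α′ ≢ eval 𝔅 (atom R xs) α′)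
  differing-atom (eq x y) α differ with α x | α y
  ... | nothing | _ = contradiction refl differ
  differing-atom (atom R xs) α differ with fin? (ar R)
  ... | inj₁ i     = contradiction (trans (eval-atom-empty 𝔄 R xs α i) (sym (eval-atom-empty 𝔅 R xs α i))) differ
  ... | inj₂ empty = R , empty , λ xs′ α′ same → differ (trans
      (eval-atom 𝔄 R xs xs′ α α′ (⊥-elim ∘ empty)) (trans same (eval-atom 𝔅 R xs′ xs α′ α (⊥-elim ∘ empty))))
  differing-atom (and φ ψ) α differ with eval 𝔄 φ α Bool.≟ eval 𝔅 φ α | eval 𝔄 ψ α Bool.≟ eval 𝔅 ψ α
  ... | no  φ≢ | _      = differing-atom φ α φ≢
  ... | yes _  | no ψ≢  = differing-atom ψ α ψ≢
  ... | yes φ≡ | yes ψ≡ = contradiction (cong₂ _∧_ φ≡ ψ≡) differ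
  differing-atom (neg φ) α differ = differing-atom φ α (differ ∘ cong not)
  differing-atom (ex x φ) α differ = contradiction refl differ
  differing-atom (exGE j x φ) α differ = contradiction refl differ

  -- For `n = 0` the factor `0 ^ (k / 2 + 1)` makes the required bound zero, so the sentence must be
  -- quantifier-free: a nullary atom or its negation.
  empty-universe : ∀ {m d} (φ : Form Sym ar m) → 𝔄 ⊨ φ → ¬ (𝔅 ⊨ φ) →
    Σ (Form Sym ar d) λ ψ → Sentence ψ × qr ψ ≤ 0 × 𝔄 ⊨ ψ × ¬ (𝔅 ⊨ ψ)
  empty-universe {d = d} φ 𝔄⊨φ 𝔅⊭φ with differing-atom φ (λ _ → nothing) (λ same → 𝔅⊭φ (trans (sym same) 𝔄⊨φ))
  ... | R , empty , differ = signed (eval 𝔄 ψ (λ _ → nothing)) (eval 𝔅 ψ (λ _ → nothing)) refl refl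
    where
    ψ : Form Sym ar d
    ψ = atom R (⊥-elim ∘ empty)
    closed : Sentence ψ
    closed z with free ψ z in free-z
    ... | false = refl
    ... | true  = ⊥-elim (empty (proj₁ (anyFin-witness (λ i → does (⊥-elim (empty i) Fin.≟ z)) free-z)))
    signed : ∀ u v → eval 𝔄 ψ (λ _ → nothing) ≡ u → eval 𝔅 ψ (λ _ → nothing) ≡ v →
      Σ (Form Sym ar d) λ ψ → Sentence ψ × qr ψ ≤ 0 × 𝔄 ⊨ ψ × ¬ (𝔅 ⊨ ψ)
    signed true  v     𝔄≡ 𝔅≡ = ψ , closed , z≤n , 𝔄≡ , λ 𝔅⊨ψ → differ (⊥-elim ∘ empty) (λ (_ : Fin d) → nothing) (trans 𝔄≡ (sym 𝔅⊨ψ))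
    signed false true  𝔄≡ 𝔅≡ = neg ψ , closed , z≤n , cong not 𝔄≡ , λ 𝔅⊨¬ψ → contradiction (trans (sym 𝔅⊨¬ψ) (cong not 𝔅≡)) λ ()
    signed false false 𝔄≡ 𝔅≡ = ⊥-elim (differ (⊥-elim ∘ empty) (λ (_ : Fin d) → nothing) (trans 𝔄≡ (sym 𝔅≡)))

-- Assembling the bound

retract-≤ : ∀ {e c} → 1 ≤ c → c ≤ e → Retraction e c
retract-≤ {c = suc c} _ c≤e = retraction c≤e

-- The numbers of variables enter through equations, so that matching on `refl` brings `φ` and `ψ`
-- into block form without transport.
nonempty-universe : ∀ k → 2 ≤ k → ∀ {Sym : Set} {ar : Sym → ℕ} n (𝔄 𝔅 : Structure Sym ar (suc n)) {m d} →
  (H : Halves k) → m ≡ suc (k / 2) + Halves.b H → d ≡ suc (k / 2) + (Halves.b H + suc (k / 2)) →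
  (φ : Form Sym ar m) → Sentence φ → 𝔄 ⊨ φ → ¬ (𝔅 ⊨ φ) →
  Σ (Form Sym ar d) λ ψ → Sentence ψ ×
    qr ψ ≤ 53 * (k ^ 2) * (suc n ^ (k / 2 + 1)) * (1 + ⌊log₂ suc n ⌋) × 𝔄 ⊨ ψ × ¬ (𝔅 ⊨ ψ)
nonempty-universe k 2≤k n 𝔄 𝔅 H refl refl φ sentence 𝔄⊨φ 𝔅⊭φ =
  let ψ , closed , rank , 𝔄⊨ψ , 𝔅⊭ψ = bounded-rank 𝔄 𝔅
        (retract-≤ (ℕₚ.≤-trans 1≤e half≤b) b≤1+half) (retract-≤ 1≤e half≤b) φ sentence 𝔄⊨φ 𝔅⊭φ
        (3 + 2 * (suc e * ℓ)) (word-bound (suc n) (suc e) b ℓ (s≤s z≤n) b≤1+half (n≤2^1+log (suc n)))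
  in ψ , closed , ℕₚ.≤-trans rank (ℕₚ.≤-trans
       (rank-bound k (suc e) b (suc n ^ suc e) (suc n ^ b) ℓ (ℕₚ.≤-trans (s≤s z≤n) 2≤k) 1+e≤k (sym total-k)
          (ℕₚ.m^n>0 (suc n) (suc e)) (ℕₚ.^-monoʳ-≤ (suc n) b≤1+half) (s≤s z≤n))
       (ℕₚ.≤-reflexive (cong (λ h → 53 * (k ^ 2) * (suc n ^ h) * ℓ) (ℕₚ.+-comm 1 e)))) , 𝔄⊨ψ , 𝔅⊭ψ
  where
  open Halves H
  e = k / 2
  ℓ = suc ⌊log₂ suc n ⌋
  -- Both retractions need a nonempty target, and this is where `2 ≤ k` provides it.
  1≤e : 1 ≤ e
  1≤e = /-monoˡ-≤ 2 2≤k
  1+e≤k : suc e ≤ k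
  1+e≤k = ℕₚ.≤-trans (ℕₚ.+-mono-≤ 1≤e half≤b) (ℕₚ.≤-reflexive (sym (ℕₚ.suc-injective total-k)))

theorem1p6 : Σ ℕ λ c →
    (k : ℕ) → 2 ≤ k →
    (Sym : Set) (ar : Sym → ℕ) → ((R : Sym) → ar R ≤ k) →
    (n : ℕ) (𝔄 𝔅 : Structure Sym ar n) →
    (φ : Form Sym ar (suc k)) → Sentence φ → _⊨_ 𝔄 φ → ¬ (_⊨_ 𝔅 φ) →
    Σ (Form Sym ar ((3 * (k + 1) + 1) / 2)) λ ψ →
    Sentence ψ
    × qr ψ ≤ c * (k ^ 2) * (n ^ (k / 2 + 1)) * (1 + ⌊log₂ n ⌋)
    × _⊨_ 𝔄 ψ
    × ¬ (_⊨_ 𝔅 ψ)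
theorem1p6 = 53 , λ where
  k 2≤k Sym ar _ zero 𝔄 𝔅 φ _ 𝔄⊨φ 𝔅⊭φ →
    let ψ , closed , rank , models = empty-universe 𝔄 𝔅 φ 𝔄⊨φ 𝔅⊭φ in ψ , closed , ℕₚ.≤-trans rank z≤n , models
  k 2≤k Sym ar _ (suc n) 𝔄 𝔅 φ sentence 𝔄⊨φ 𝔅⊭φ →
    nonempty-universe k 2≤k n 𝔄 𝔅 (halves k) (Halves.total-k (halves k)) (Halves.total-d (halves k)) φ sentence 𝔄⊨φ 𝔅⊭φ
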